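{- Let $G$ be a $3$-connected graph. Then $G$ has no $K_{2,4}$ minor if and only if $G \in \widetilde{\mathcal{G}}$ or $G$ is isomorphic to one of the nine graphs $K_5$, $K_{3,3}$, $A$, $A^+$, $B$, $B^+$, $C$, $C^+$, $D$.
   Context: All graphs are simple; minors are taken with parallel edges and loops removed after contraction. For $n \ge 3$ and $r,s \in \{0,1,\ldots,n-3\}$, the graph $G_{n,r,s}$ has vertex set $\{v_1,\ldots,v_n\}$ and consists of the path $v_1v_2\ldots v_n$, the edges $v_1v_{n-i}$ for $1 \le i \le r$, and the edges $v_nv_{1+j}$ for $1 \le j \le s$; $G^+_{n,r,s}$ is $G_{n,r,s}$ plus the edge $v_1v_n$. $\mathcal{G}$ is the set of graphs of the form $G_{n,r,s}$ or $G^+_{n,r,s}$ that are $3$-connected and $K_{2,4}$-minor-free, and $\widetilde{\mathcal{G}}$ is the class of graphs isomorphic to a member of $\mathcal{G}$. The nine exceptional graphs: $K_5$; $K_{3,3}$; $A$ = $K_{3,3}$ plus one edge joining two vertices in the same part; $A^+$ = $K_{3,3}$ plus one edge inside each part; $C^+$ = the graph on $\{v_1,\ldots,v_8\}$ with edges $v_1v_2, v_1v_3, v_2v_3, v_1v_7, v_2v_8, v_3v_6, v_4v_5$ and $v_iv_j$ for $i \in \{4,5\}$, $j \in \{6,7,8\}$; $C = C^+\backslash v_4v_5$; $B^+$ = the graph on $\{w,v_2,v_3,v_4,v_5,v_6,v_8\}$ with edges $wv_2, wv_3, v_2v_3, wv_4, wv_5, v_4v_5, v_4v_6, v_4v_8,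 v_5v_6, v_5v_8, v_3v_6, v_2v_8$; $B = B^+\backslash v_4v_5$; $D$ = the triangular prism (triangles $a_1a_2a_3$, $b_1b_2b_3$ and edges $a_ib_i$) plus a new vertex adjacent to $a_1,a_2,a_3$. -}

module Defs where

open import Data.Nat using (ℕ; zero; suc; _+_; _∸_; _≤_; _<_; _≤ᵇ_; _≡ᵇ_)
open import Data.Bool using (Bool; true; false; _∧_; _∨_; not; if_then_else_)
open import Data.Bool.Properties using (∨-comm)
open import Data.Fin using (Fin; toℕ)
open import Data.Fin.Properties using (_≟_)
open import Data.Fin.Subset using (Subset; _∉_; ∣_∣)
open import Data.List using (List; []; _∷_)
open import Data.Bool.ListAction using (any)
open import Data.Maybe using (Maybe; just)
open import Data.Product using (Σ; ∃; _×_; _,_; proj₁)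
open import Data.Sum using (_⊎_)
open import Function.Bundles using (_↔_; Inverse)
open import Relation.Nullary using (yes; no; ¬_)
open import Relation.Nullary.Decidable using (⌊_⌋)
open import Relation.Binary.PropositionalEquality using (_≡_; refl; sym; cong₂)

record Graph : Set where
  field
    size   : ℕ
    adj    : Fin size → Fin size → Bool
    adj-sym    : ∀ u v → adj u v ≡ adj v u
    adj-irrefl : ∀ u → adj u u ≡ false

open Graph public

Edge : (G : Graph) → Fin (size G) → Fin (size G) → Set
Edge G u v = adj G u v ≡ true

private
  eqb : ∀ {n} → Fin n → Fin n → Bool
  eqb a b = ⌊ a ≟ b ⌋

  eqb-sym : ∀ {n} (a b : Fin n) → eqb a b ≡ eqb b a
  eqb-sym a b with a ≟ b | b ≟ a
  ... | yes _ | yes _ = refl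
  ... | no _  | no _  = refl
  ... | yes p | no q  with q (sym p)
  ... | ()
  eqb-sym a b | no q | yes p with q (sym p)
  ... | ()

  eqb-refl : ∀ {n} (a : Fin n) → eqb a a ≡ true
  eqb-refl a with a ≟ a
  ... | yes _ = refl
  ... | no q with q refl
  ... | ()

fromRel : (n : ℕ) → (Fin n → Fin n → Bool) → Graph
fromRel n e = record
  { size = n
  ; adj = λ a b → not (eqb a b) ∧ (e a b ∨ e b a)
  ; adj-sym = λ a b → cong₂ (λ x y → not x ∧ y) (eqb-sym a b) (∨-comm (e a b) (e b a))
  ; adj-irrefl = λ a → cong₂ (λ x y → not x ∧ y) (eqb-refl a) refl
  }

fromEdges : (n : ℕ) → List (ℕ × ℕ) → Graph
fromEdges n es = fromRel n (λ a b → any (λ { (i , j) → (toℕ a ≡ᵇ i) ∧ (toℕ b ≡ᵇ j) }) es)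

data Walk (G : Graph) (P : Fin (size G) → Set) : Fin (size G) → Fin (size G) → Set where
  here : ∀ {u} → P u → Walk G P u u
  step : ∀ {u w v} → P u → Edge G u w → Walk G P w v → Walk G P u v

KConnected : ℕ → Graph → Set
KConnected k G =
  k < size G ×
  ((S : Subset (size G)) → ∣ S ∣ < k →
     ∀ u v → u ∉ S → v ∉ S → Walk G (λ x → x ∉ S) u v)

ThreeConnected : Graph → Set
ThreeConnected = KConnected 3

-- Minors (via minor models / branch sets)
-- ρ assigns each vertex of G to at most one branch set; branch sets are
-- nonempty, induce connected subgraphs, and every edge of H is realised
-- by an edge of G between the corresponding branch sets.

HasMinor : (G H : Graph) → Set
HasMinor G H =
  Σ (Fin (size G) → Maybe (Fin (size H))) λ ρ →
    ((h : Fin (size H)) → ∃ λ v → ρ v ≡ just h) ×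
    ((h : Fin (size H)) → ∀ u v → ρ u ≡ just h → ρ v ≡ just h →
        Walk G (λ x → ρ x ≡ just h) u v) ×
    ((h h' : Fin (size H)) → Edge H h h' →
        ∃ λ u → ∃ λ v → ρ u ≡ just h × ρ v ≡ just h' × Edge G u v)

_≅_ : Graph → Graph → Set
G ≅ H = Σ (Fin (size G) ↔ Fin (size H)) λ f →
  ∀ u v → adj G u v ≡ adj H (Inverse.to f u) (Inverse.to f v)

-- The families G_{n,r,s} and G^+_{n,r,s}
-- Vertex v_i is represented by the index i-1 (so v_1 = 0, v_n = n-1).

gRel : (n r s : ℕ) → (plus : Bool) → Fin n → Fin n → Bool
gRel n r s plus a b =
  (suc (toℕ a) ≡ᵇ toℕ b)
  -- v_1 v_{n-i}, 1 ≤ i ≤ r   (index n-1-i, i.e. n-1-r ≤ index ≤ n-2)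
  ∨ ((toℕ a ≡ᵇ 0) ∧ (n ∸ suc r ≤ᵇ toℕ b) ∧ (suc (toℕ b) ≤ᵇ n ∸ 1))
  -- v_n v_{1+j}, 1 ≤ j ≤ s   (index j, 1 ≤ j ≤ s)
  ∨ ((toℕ a ≡ᵇ n ∸ 1) ∧ (1 ≤ᵇ toℕ b) ∧ (toℕ b ≤ᵇ s))
  ∨ (plus ∧ (toℕ a ≡ᵇ 0) ∧ (toℕ b ≡ᵇ n ∸ 1))

Gnrs : (n r s : ℕ) → (plus : Bool) → Graph
Gnrs n r s plus = fromRel n (gRel n r s plus)

K24 : Graph
K24 = fromEdges 6
  ( (0 , 2) ∷ (0 , 3) ∷ (0 , 4) ∷ (0 , 5)
  ∷ (1 , 2) ∷ (1 , 3) ∷ (1 , 4) ∷ (1 , 5) ∷ [])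

InCalG~ : Graph → Set
InCalG~ G = Σ ℕ λ n → Σ ℕ λ r → Σ ℕ λ s → Σ Bool λ plus →
  3 ≤ n × r ≤ n ∸ 3 × s ≤ n ∸ 3 ×
  ThreeConnected (Gnrs n r s plus) ×
  ¬ HasMinor (Gnrs n r s plus) K24 ×
  G ≅ Gnrs n r s plus

K5 : Graph
K5 = fromRel 5 (λ _ _ → true)

K33-edges : List (ℕ × ℕ)
K33-edges =
    (0 , 3) ∷ (0 , 4) ∷ (0 , 5)
  ∷ (1 , 3) ∷ (1 , 4) ∷ (1 , 5)
  ∷ (2 , 3) ∷ (2 , 4) ∷ (2 , 5) ∷ []

K33 : Graph
K33 = fromEdges 6 K33-edges

GA : Graph
GA = fromEdges 6 ((0 , 1) ∷ K33-edges)

GA⁺ : Graph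
GA⁺ = fromEdges 6 ((0 , 1) ∷ (3 , 4) ∷ K33-edges)

-- C^+ on v_1..v_8 = 0..7
C-edges : List (ℕ × ℕ)
C-edges =
    (0 , 1) ∷ (0 , 2) ∷ (1 , 2)
  ∷ (0 , 6) ∷ (1 , 7) ∷ (2 , 5)
  ∷ (3 , 5) ∷ (3 , 6) ∷ (3 , 7)
  ∷ (4 , 5) ∷ (4 , 6) ∷ (4 , 7) ∷ []

GC : Graph
GC = fromEdges 8 C-edges

GC⁺ : Graph
GC⁺ = fromEdges 8 ((3 , 4) ∷ C-edges)

-- B^+ on w,v2,v3,v4,v5,v6,v8 = 0,1,2,3,4,5,6
B-edges : List (ℕ × ℕ)
B-edges =
    (0 , 1) ∷ (0 , 2) ∷ (1 , 2)
  ∷ (0 , 3) ∷ (0 , 4)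
  ∷ (3 , 5) ∷ (3 , 6) ∷ (4 , 5) ∷ (4 , 6)
  ∷ (2 , 5) ∷ (1 , 6) ∷ []

GB : Graph
GB = fromEdges 7 B-edges

GB⁺ : Graph
GB⁺ = fromEdges 7 ((3 , 4) ∷ B-edges)

-- D: prism a1a2a3 = 0,1,2, b1b2b3 = 3,4,5, plus vertex 6 adjacent to a1,a2,a3
GD : Graph
GD = fromEdges 7
  ( (0 , 1) ∷ (1 , 2) ∷ (0 , 2)
  ∷ (3 , 4) ∷ (4 , 5) ∷ (3 , 5)
  ∷ (0 , 3) ∷ (1 , 4) ∷ (2 , 5)
  ∷ (6 , 0) ∷ (6 , 1) ∷ (6 , 2) ∷ [])

{-# OPTIONS --safe #-}
module Submission where

-- Induction along contractible edges. Call a graph h-hub if deleting some h of its vertices, the hubs, leaves an induced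
-- path; it is then given by the edges between hubs and by the label of each path vertex, the set of hubs adjacent to it.
-- A 3-connected K24-minor-free graph is shown to be two-hub or exceptional. Contracting an edge that preserves
-- 3-connectivity leaves such a graph by induction, and the graph is recovered by splitting a vertex. Splitting an
-- exceptional graph is a finite check. Splitting a two-hub graph gives a two-hub or a three-hub graph, and a hub of the
-- latter whose only neighbour on the path is an end can be appended to the path, which leaves two hubs. With at most six
-- path vertices the other three-hub graphs are a finite check. With seven or more, either there is a K24 minor, which
-- for seven is a finite check and otherwise follows by merging two consecutive path vertices, or two consecutive
-- interior path vertices have the same single hub y, of degree at least six; contracting the edge between them then
-- preserves 3-connectivity, y stays a hub of the resulting two-hub graph, and undoing the contraction prolongs the path.
-- In a two-hub graph without a K24 minor the labels of the interior path vertices are monotone along the path, since two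
-- violations in opposite directions give a minor; the graph is then a G_{n,r,s} or G^+_{n,r,s}.

open import Defs
open import Data.Empty using (⊥; ⊥-elim)
open import Data.Unit using (⊤; tt)
open import Data.Bool using (Bool; true; false; _∧_; _∨_; not; if_then_else_)
import Data.Bool.Properties as Bool
open import Data.Bool.ListAction using (any; all)
open import Data.Nat using (ℕ; zero; suc; _+_; _∸_; _≤_; _<_; z≤n; s≤s; _≡ᵇ_; _≤ᵇ_; _≤?_; _<?_; _/_; _%_)
import Data.Nat.Properties as ℕ
open import Data.Fin using (Fin; zero; suc; toℕ; punchIn; punchOut; inject₁; fromℕ; _↑ʳ_; _↑ˡ_)
open import Data.Fin.Properties using (_≟_; any?; all?; punchIn-injective; punchInᵢ≢i; punchIn-punchOut; suc-injective; toℕ-injective; toℕ<n; toℕ-inject₁; toℕ-fromℕ)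
open import Data.Fin.Permutation using (Permutation; Permutation′; _⟨$⟩ʳ_; _⟨$⟩ˡ_; inverseˡ; inverseʳ; insert; lift₀; flip; _∘ₚ_; permutation; insert-punchIn)
open import Data.Fin.Patterns
import Data.Fin.Permutation as Perm
import Data.Fin.Properties as Fin
open import Data.Fin.Relation.Unary.Top using (View; view; ‵fromℕ; ‵inject₁)
open import Data.Fin.Subset using (Subset; ⁅_⁆; _∪_; ∣_∣) renaming (_∈_ to _∈ˢ_; _∉_ to _∉ˢ_)
import Data.Fin.Subset.Properties as Subset
open import Data.Vec using (Vec; []; _∷_; lookup; tabulate)
import Data.Vec as Vec
import Data.Vec.Properties as Vec
open import Data.List using (List; []; _∷_)
import Data.List as List
open import Data.List.Membership.Propositional using () renaming (_∈_ to _∈ˡ_)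
open import Data.List.Membership.Propositional.Properties using (∈-map⁻)
open import Data.List.Relation.Unary.Any using (here; there)
open import Data.Maybe using (Maybe; just; nothing)
import Data.Maybe.Properties as Maybe
open import Data.Product using (Σ; ∃; _×_; _,_; proj₁; proj₂)
open import Data.Sum using (_⊎_; inj₁; inj₂; [_,_]′)
import Data.Sum as Sum
open import Function using (_∘_; id; case_of_)
open import Function.Bundles using (_⇔_; mk⇔)
open import Relation.Nullary using (¬_; Dec; yes; no; does)
open import Relation.Nullary.Decidable using (⌊_⌋; _×-dec_; _⊎-dec_; ¬?; _→-dec_; map′)
open import Relation.Binary.PropositionalEquality
open import Relation.Binary.Definitions using (tri<; tri≈; tri>)

-- Paths of every length occur, so no finite check can treat three-hub graphs by itself. Seven path
-- vertices suffice because the check does not speak of 3-connectivity, which is hard to follow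
-- through a merge, but of local conditions: every path vertex has enough hubs (`Fed`), and none of
-- three ways out is open (`Bad`). A merge of two interior path vertices preserves these conditions
-- as long as no hub of degree three is adjacent to both, and near the start of a long path such a
-- pair can always be found. Only the ways out are answered with the 3-connectivity of the graph
-- itself.
--
-- The bound six on the degree of the hub of a run comes from the fact that a path vertex of a
-- three-hub graph has at most five neighbours, three hubs and two on the path. A vertex of degree
-- six is therefore a hub in every three-hub presentation.
--
-- The long lists of numerals are data to be verified: each number spells a minor model or an
-- isomorphism, and a verified search shows that the lists cover all cases.

private variable
  m n k : ℕ


-- Graphs with a given vertex count, and maps along which minors lift

record Gr (n : ℕ) : Set where
  field
    e   : Fin n → Fin n → Bool
    sy  : ∀ u v → e u v ≡ e v u
    irr : ∀ u → e u u ≡ false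

open Gr public

⟪_⟫ : Gr n → Graph
⟪ g ⟫ = record { size = _ ; adj = e g ; adj-sym = sy g ; adj-irrefl = irr g }

gr : (G : Graph) → Gr (size G)
gr G = record { e = adj G ; sy = adj-sym G ; irr = adj-irrefl G }

K24-minor : Gr n → Set
K24-minor g = HasMinor ⟪ g ⟫ K24

t≢f : ∀ {b} → b ≡ true → b ≡ false → ⊥
t≢f refl ()

∨-inv : ∀ a {b} → a ∨ b ≡ true → a ≡ true ⊎ b ≡ true
∨-inv true  _ = inj₁ refl
∨-inv false p = inj₂ p

∨-r : ∀ a {b} → b ≡ true → a ∨ b ≡ true
∨-r true  _ = refl
∨-r false p = p

∧-inv : ∀ a {b} → a ∧ b ≡ true → a ≡ true × b ≡ true
∧-inv true p = refl , p

iff-≡ : ∀ {a b} → (a ≡ true → b ≡ true) → (b ≡ true → a ≡ true) → a ≡ b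
iff-≡ {true}  {true}  _ _ = refl
iff-≡ {false} {false} _ _ = refl
iff-≡ {true}  {false} f _ = sym (f refl)
iff-≡ {false} {true}  _ h = h refl

edge≢ : (g : Gr n) → ∀ {u v} → e g u v ≡ true → u ≢ v
edge≢ g {u} p refl = t≢f p (irr g u)

esym : (g : Gr n) → ∀ {u v} → e g u v ≡ true → e g v u ≡ true
esym g {u} {v} p = trans (sy g v u) p

-- Contractions, deletions of edges and isomorphisms all have this form. Edges of `g` may be lost on
-- the way to `h`; connected fibres and liftable edges are what pulling a minor model back along `f`
-- takes.
record _↠_ (g : Gr n) (h : Gr m) : Set where
  field
    f     : Fin n → Fin m
    onto  : ∀ x → ∃ λ u → f u ≡ x
    fibre : ∀ u v → f u ≡ f v → Walk ⟪ g ⟫ (λ w → f w ≡ f u) u v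
    lift  : ∀ x y → e h x y ≡ true → ∃ λ u → ∃ λ v → f u ≡ x × f v ≡ y × e g u v ≡ true

module _ {G : Graph} where
  _++ʷ_ : ∀ {P : Fin (size G) → Set} {u v w} → Walk G P u v → Walk G P v w → Walk G P u w
  here _ ++ʷ b = b
  step p q a ++ʷ b = step p q (a ++ʷ b)

  mapʷ : ∀ {P Q : Fin (size G) → Set} → (∀ {x} → P x → Q x) → ∀ {u v} → Walk G P u v → Walk G Q u v
  mapʷ f (here p) = here (f p)
  mapʷ f (step p q w) = step (f p) q (mapʷ f w)

  walk-start : ∀ {P : Fin (size G) → Set} {u v} → Walk G P u v → P u
  walk-start (here p) = p
  walk-start (step p _ _) = p

  walk-end : ∀ {P : Fin (size G) → Set} {u v} → Walk G P u v → P v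
  walk-end (here p) = p
  walk-end (step _ _ w) = walk-end w

  snocʷ : ∀ {P : Fin (size G) → Set} {u v w} → Walk G P u v → Edge G v w → P w → Walk G P u w
  snocʷ (here p) q r = step p q (here r)
  snocʷ (step p q a) q' r = step p q (snocʷ a q' r)

  reverseʷ : ∀ {P : Fin (size G) → Set} {u v} → Walk G P u v → Walk G P v u
  reverseʷ (here p) = here p
  reverseʷ (step {u} {w} p q a) = snocʷ (reverseʷ a) (trans (adj-sym G w u) q) p

module _ {g : Gr n} {h : Gr m} (c : g ↠ h) where
  open _↠_ c

  -- Each edge of the walk lifts to an edge between the right fibres, and the gaps between
  -- consecutive lifted edges are bridged inside the fibres.
  walk-lift : ∀ {P : Fin m → Set} {x y} → Walk ⟪ h ⟫ P x y → ∀ u v → f u ≡ x → f v ≡ y →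
    Walk ⟪ g ⟫ (P ∘ f) u v
  walk-lift {P} (here p) u v refl q = mapʷ (λ r → subst P (sym r) p) (fibre u v (sym q))
  walk-lift {P} (step {u = x} {w = y} p q w) u v refl r with lift x y q
  ... | a , b , fa , fb , ab =
    mapʷ (λ r → subst P (sym r) p) (fibre u a (sym fa)) ++ʷ step (subst P (sym fa) p) ab (walk-lift w b v fb r)

  minor-lift : ∀ {K} → HasMinor ⟪ h ⟫ K → HasMinor ⟪ g ⟫ K
  minor-lift (ρ , ne , cn , ed) = ρ ∘ f
    , (λ x → let (v , q) = ne x ; (u , r) = onto v in u , trans (cong ρ r) q)
    , (λ x u v p q → walk-lift (cn x (f u) (f v) p q) u v refl refl)
    , λ x y xy → let (u , v , p , q , uv) = ed x y xy
                     (a , b , fa , fb , ab) = lift u v uv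
                 in a , b , trans (cong ρ fa) p , trans (cong ρ fb) q , ab

K24-lift : {g : Gr n} {h : Gr m} → g ↠ h → K24-minor h → K24-minor g
K24-lift {g = g} {h} c = minor-lift {g = g} {h} c {K24}

infix 4 _⊆ᵍ_
_⊆ᵍ_ : (g h : Gr n) → Set
g ⊆ᵍ h = ∀ u v → e g u v ≡ true → e h u v ≡ true

⊆⇒↠ : {g h : Gr n} → g ⊆ᵍ h → h ↠ g
⊆⇒↠ s = record { f = id ; onto = λ x → x , refl ; fibre = λ { u _ refl → here refl }
  ; lift = λ x y p → x , y , refl , refl , s x y p }

record _≃_ (g : Gr n) (h : Gr m) : Set where
  constructor iso
  field
    perm : Permutation n m
    e-eq : ∀ u v → e g u v ≡ e h (perm ⟨$⟩ʳ u) (perm ⟨$⟩ʳ v)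

≃-sym : {g : Gr n} {h : Gr m} → g ≃ h → h ≃ g
≃-sym {h = h} (iso π q) = iso (flip π) λ u v → sym (trans (q _ _) (cong₂ (e h) (inverseʳ π) (inverseʳ π)))

≃-trans : {g : Gr n} {h : Gr m} {i : Gr k} → g ≃ h → h ≃ i → g ≃ i
≃-trans (iso π q) (iso σ r) = iso (π ∘ₚ σ) λ u v → trans (q u v) (r _ _)

≃⇒↠ : {g : Gr n} {h : Gr m} → g ≃ h → g ↠ h
≃⇒↠ {h = h} (iso π q) = record
  { f = π ⟨$⟩ʳ_
  ; onto = λ x → π ⟨$⟩ˡ x , inverseʳ π
  ; fibre = λ u v r → case trans (sym (inverseˡ π)) (trans (cong (π ⟨$⟩ˡ_) r) (inverseˡ π)) of λ { refl → here refl }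
  ; lift = λ x y p → π ⟨$⟩ˡ x , π ⟨$⟩ˡ y , inverseʳ π , inverseʳ π
      , trans (q _ _) (trans (cong₂ (e h) (inverseʳ π) (inverseʳ π)) p) }

relabel : Permutation n m → Gr m → Gr n
relabel π g = record { e = λ u v → e g (π ⟨$⟩ʳ u) (π ⟨$⟩ʳ v) ; sy = λ u v → sy g _ _ ; irr = λ u → irr g _ }

relabel-≃ : (π : Permutation n m) (g : Gr m) → relabel π g ≃ g
relabel-≃ π g = iso π λ _ _ → refl

-- Connectivity of the graph without the vertices in C.
Cross : Gr n → (Fin n → Set) → Set
Cross {n} g C = (A : Fin n → Bool) (a b : Fin n) → A a ≡ true → A b ≡ false → ¬ C a → ¬ C b →
  ∃ λ u → ∃ λ v → A u ≡ true × A v ≡ false × ¬ C u × ¬ C v × e g u v ≡ true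

-- Connectivity in terms of two-colourings passes along vertex maps more easily than walks do. `s`
-- and `t` may coincide, which covers the removal of a single vertex.
Conn3 : Gr n → Set
Conn3 g = ∀ s t → Cross g (λ v → v ≡ s ⊎ v ≡ t)

-- Removing the merged vertex of a contraction together with `z` amounts to removing `u`, `v` and
-- `z`. This is the part of 3-connectivity that contracting `uv` could lose.
Tight : Gr n → Fin n → Fin n → Set
Tight g u v = ∀ z → Cross g (λ w → w ≡ u ⊎ w ≡ v ⊎ w ≡ z)

Cross-push : {g : Gr n} {h : Gr m} (f : Fin n → Fin m) → (∀ x → ∃ λ u → f u ≡ x) →
  (∀ u v → e g u v ≡ true → f u ≡ f v ⊎ e h (f u) (f v) ≡ true) →
  {C : Fin n → Set} {D : Fin m → Set} → (∀ u → C u → D (f u)) → (∀ u → D (f u) → C u) →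
  Cross g C → Cross h D
Cross-push {g = g} {h} f onto push {C} {D} to from cr A a b Aa Ab a∉ b∉ with onto a | onto b
... | a' , refl | b' , refl with cr (A ∘ f) a' b' Aa Ab (a∉ ∘ to _) (b∉ ∘ to _)
... | u , v , Au , Av , u∉ , v∉ , uv with push u v uv
... | inj₂ p = f u , f v , Au , Av , u∉ ∘ from u , v∉ ∘ from v , p
... | inj₁ p = ⊥-elim (t≢f Au (trans (cong A p) Av))

perm-inj : (π : Permutation n m) → ∀ {i j} → π ⟨$⟩ʳ i ≡ π ⟨$⟩ʳ j → i ≡ j
perm-inj π r = trans (sym (inverseˡ π)) (trans (cong (π ⟨$⟩ˡ_) r) (inverseˡ π))

module _ {g : Gr n} {h : Gr m} (i : g ≃ h) where
  open _≃_ i renaming (perm to π; e-eq to q)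
  private
    back : ∀ {u s} → u ≡ π ⟨$⟩ˡ s → π ⟨$⟩ʳ u ≡ s
    back refl = inverseʳ π
    forth : ∀ {u s} → π ⟨$⟩ʳ u ≡ s → u ≡ π ⟨$⟩ˡ s
    forth refl = sym (inverseˡ π)
    psh : ∀ u v → e g u v ≡ true → π ⟨$⟩ʳ u ≡ π ⟨$⟩ʳ v ⊎ e h (π ⟨$⟩ʳ u) (π ⟨$⟩ʳ v) ≡ true
    psh u v p = inj₂ (trans (sym (q u v)) p)
    ont : ∀ x → ∃ λ u → π ⟨$⟩ʳ u ≡ x
    ont x = π ⟨$⟩ˡ x , inverseʳ π

  Conn3-≃ : Conn3 g → Conn3 h
  Conn3-≃ c s t = Cross-push {g = g} {h} (π ⟨$⟩ʳ_) ont psh (λ _ → Sum.map back back) (λ _ → Sum.map forth forth)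
    (c (π ⟨$⟩ˡ s) (π ⟨$⟩ˡ t))

  Tight-≃ : ∀ {s t} → Tight g s t → Tight h (π ⟨$⟩ʳ s) (π ⟨$⟩ʳ t)
  Tight-≃ c z = Cross-push {g = g} {h} (π ⟨$⟩ʳ_) ont psh
    (λ { _ (inj₁ refl) → inj₁ refl ; _ (inj₂ (inj₁ refl)) → inj₂ (inj₁ refl) ; _ (inj₂ (inj₂ p)) → inj₂ (inj₂ (back p)) })
    (λ { _ (inj₁ p) → inj₁ (perm-inj π p) ; _ (inj₂ (inj₁ p)) → inj₂ (inj₁ (perm-inj π p)) ; _ (inj₂ (inj₂ p)) → inj₂ (inj₂ (forth p)) })
    (c (π ⟨$⟩ˡ z))

crossing : ∀ {G : Graph} {P : Fin (size G) → Set} (A : Fin (size G) → Bool) {u v} → A u ≡ true → A v ≡ false →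
  Walk G P u v → ∃ λ a → ∃ λ b → A a ≡ true × A b ≡ false × P a × P b × adj G a b ≡ true
crossing A p q (here _) = ⊥-elim (t≢f p q)
crossing A p q (step {w = w} r s ws) with A w in eq
... | false = _ , w , p , eq , r , walk-start ws , s
... | true  = crossing A eq q ws

∪-size : (p q : Subset n) → ∣ p ∪ q ∣ ≤ ∣ p ∣ + ∣ q ∣
∪-size [] [] = z≤n
∪-size (true ∷ p) (true ∷ q) = s≤s (ℕ.≤-trans (∪-size p q) (ℕ.+-monoʳ-≤ ∣ p ∣ (ℕ.n≤1+n _)))
∪-size (true ∷ p) (false ∷ q) = s≤s (∪-size p q)
∪-size (false ∷ p) (true ∷ q) = ℕ.≤-trans (s≤s (∪-size p q)) (ℕ.≤-reflexive (sym (ℕ.+-suc ∣ p ∣ ∣ q ∣)))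
∪-size (false ∷ p) (false ∷ q) = ∪-size p q

conn3 : (G : Graph) → ThreeConnected G → Conn3 (gr G)
conn3 G (_ , c) s t A a b Aa Ab a∉ b∉ with crossing A Aa Ab (c S small a b (a∉ ∘ ∈S) (b∉ ∘ ∈S))
  where
  S = ⁅ s ⁆ ∪ ⁅ t ⁆
  small : ∣ S ∣ < 3
  small = s≤s (ℕ.≤-trans (∪-size ⁅ s ⁆ ⁅ t ⁆)
    (ℕ.≤-reflexive (cong₂ _+_ (Subset.∣⁅x⁆∣≡1 s) (Subset.∣⁅x⁆∣≡1 t))))
  ∈S : ∀ {v} → v ∈ˢ S → v ≡ s ⊎ v ≡ t
  ∈S p = Sum.map (Subset.x∈⁅y⁆⇒x≡y s) (Subset.x∈⁅y⁆⇒x≡y t) (Subset.x∈p∪q⁻ ⁅ s ⁆ ⁅ t ⁆ p)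
... | u , v , Au , Av , u∉ , v∉ , uv = u , v , Au , Av , u∉ ∘ S∋ , v∉ ∘ S∋ , uv
  where
  S∋ : ∀ {v} → v ≡ s ⊎ v ≡ t → v ∈ˢ (⁅ s ⁆ ∪ ⁅ t ⁆)
  S∋ (inj₁ refl) = Subset.x∈p∪q⁺ (inj₁ (Subset.x∈⁅x⁆ s))
  S∋ (inj₂ refl) = Subset.x∈p∪q⁺ (inj₂ (Subset.x∈⁅x⁆ t))

does-true : {A : Set} (d : Dec A) → does d ≡ true → A
does-true (yes a) _ = a

does-yes : {A : Set} (d : Dec A) → A → does d ≡ true
does-yes (yes _) a = refl
does-yes (no q) a = ⊥-elim (q a)

does-no : {A : Set} (d : Dec A) → ¬ A → does d ≡ false
does-no (yes a) q = ⊥-elim (q a)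
does-no (no _) q = refl

does-suc : (i j : Fin n) → does (i ≟ j) ≡ does (suc i ≟ suc j)
does-suc i j with i ≟ j
... | yes _ = refl
... | no _ = refl

data PunchView {n} (r : Fin (suc n)) : Fin (suc n) → Set where
  new : PunchView r r
  old : ∀ y → PunchView r (punchIn r y)

punchView : (r v : Fin (suc n)) → PunchView r v
punchView r v with r ≟ v
... | yes refl = new
... | no q = subst (PunchView r) (punchIn-punchOut q) (old (punchOut q))

-- Contractible edges

_∈ᵇ_ : Fin n → Vec Bool n → Set
v ∈ᵇ D = lookup D v ≡ true

_∈ᵇ?_ : (v : Fin n) (D : Vec Bool n) → Dec (v ∈ᵇ D)
v ∈ᵇ? D = lookup D v Bool.≟ true

-- `D` is a nonempty union of components left by the removal of `C`, but not all of them. Being a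
-- bit vector it can be searched for among all subsets, which makes the alternative `cross⊎sep`
-- constructive.
record SepAt (g : Gr n) (C : Fin n → Set) (D : Vec Bool n) : Set where
  constructor sepAt
  field
    inside  : ∃ λ d → d ∈ᵇ D
    outside : ∃ λ b → ¬ (b ∈ᵇ D) × ¬ C b
    avoids  : ∀ u → u ∈ᵇ D → ¬ C u
    closed  : ∀ u → u ∈ᵇ D → ∀ v → e g u v ≡ true → v ∈ᵇ D ⊎ C v

sepAt? : (g : Gr n) {C : Fin n → Set} → (∀ v → Dec (C v)) → ∀ D → Dec (SepAt g C D)
sepAt? g C? D = map′ (λ { (a , b , c , d) → sepAt a b c d }) (λ { (sepAt a b c d) → a , b , c , d })
  (any? (_∈ᵇ? D) ×-dec any? (λ b → ¬? (b ∈ᵇ? D) ×-dec ¬? (C? b)) ×-dec all? (λ u → u ∈ᵇ? D →-dec ¬? (C? u))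
   ×-dec all? (λ u → u ∈ᵇ? D →-dec all? λ v → e g u v Bool.≟ true →-dec (v ∈ᵇ? D ⊎-dec C? v)))

-- The true class of a colouring without a crossing edge, taken without `C`, would be a separated
-- set.
cross⊎sep : (g : Gr n) {C : Fin n → Set} → (∀ v → Dec (C v)) → Cross g C ⊎ ∃ (SepAt g C)
cross⊎sep {n} g {C} C? with Subset.anySubset? (sepAt? g C?)
... | yes s = inj₂ s
... | no ¬s = inj₁ cr
  where
  cr : Cross g C
  cr A a b Aa Ab a∉ b∉
    with any? (λ u → any? λ v → A u Bool.≟ true ×-dec A v Bool.≟ false ×-dec ¬? (C? u) ×-dec ¬? (C? v) ×-dec e g u v Bool.≟ true)
  ... | yes p = p
  ... | no ¬p = ⊥-elim (¬s (D , sepAt (a , into Aa a∉) (b , (λ q → t≢f (proj₁ (out q)) Ab) , b∉) (λ u → proj₂ ∘ out)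
          λ u q v uv → cl u v (out q) uv))
    where
    D = tabulate (λ v → A v ∧ not (does (C? v)))
    into : ∀ {v} → A v ≡ true → ¬ C v → v ∈ᵇ D
    into {v} p q rewrite Vec.lookup∘tabulate (λ v → A v ∧ not (does (C? v))) v | p with C? v
    ... | yes c = ⊥-elim (q c)
    ... | no _ = refl
    out : ∀ {v} → v ∈ᵇ D → A v ≡ true × ¬ C v
    out {v} q rewrite Vec.lookup∘tabulate (λ v → A v ∧ not (does (C? v))) v with A v | C? v
    ... | true | no c = refl , c
    cl : ∀ u v → A u ≡ true × ¬ C u → e g u v ≡ true → v ∈ᵇ D ⊎ C v
    cl u v (Au , u∉) uv with C? v | A v in eq
    ... | yes c | _ = inj₂ c
    ... | no c | true = inj₁ (into eq c)
    ... | no c | false = ⊥-elim (¬p (u , v , Au , eq , u∉ , c , uv))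

Trio : Fin n → Fin n → Fin n → Fin n → Set
Trio x y z v = v ≡ x ⊎ v ≡ y ⊎ v ≡ z

trio? : (x y z v : Fin n) → Dec (Trio x y z v)
trio? x y z v = v ≟ x ⊎-dec v ≟ y ⊎-dec v ≟ z

-- Lets an argument choose whichever side of a separation suits it.
complement : {g : Gr n} {C : Fin n → Set} (C? : ∀ v → Dec (C v)) → ∀ {D} → SepAt g C D →
  ∃ λ B → SepAt g C B × (∀ v → v ∈ᵇ B → ¬ (v ∈ᵇ D)) × (∀ v → ¬ (v ∈ᵇ D) → ¬ C v → v ∈ᵇ B)
complement {g = g} {C} C? {D} (sepAt (d , d∈) (b , b∉ , b∉C) av cl) = tabulate B
  , sepAt (b , into b∉ b∉C) (d , (λ q → proj₁ (out q) d∈) , av d d∈) (λ u → proj₂ ∘ out)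
    (λ u u∈ v uv → clB u v (out u∈) uv)
  , (λ v → proj₁ ∘ out) , λ v → into
  where
  B : Fin _ → Bool
  B v = not (lookup D v) ∧ not (does (C? v))
  into : ∀ {v} → ¬ (v ∈ᵇ D) → ¬ C v → v ∈ᵇ tabulate B
  into {v} p q rewrite Vec.lookup∘tabulate B v with lookup D v | C? v
  ... | true  | _ = ⊥-elim (p refl)
  ... | false | yes c = ⊥-elim (q c)
  ... | false | no _ = refl
  out : ∀ {v} → v ∈ᵇ tabulate B → ¬ (v ∈ᵇ D) × ¬ C v
  out {v} q rewrite Vec.lookup∘tabulate B v with lookup D v | C? v
  ... | false | no c = (λ ()) , c
  clB : ∀ u v → ¬ (u ∈ᵇ D) × ¬ C u → e g u v ≡ true → v ∈ᵇ tabulate B ⊎ C v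
  clB u v (u∉ , uC) uv with C? v | v ∈ᵇ? D
  ... | yes c | _ = inj₂ c
  ... | no c | no v∉ = inj₁ (into v∉ c)
  ... | no c | yes v∈ = ⊥-elim ([ u∉ , uC ]′ (cl v v∈ u (esym g uv)))

module _ {g : Gr n} (c3 : Conn3 g) where

  -- The vertices `x` and `y` alone do not separate `D` from `o`, so an edge leaves `D` elsewhere,
  -- and only `z` remains for its end. This also shows that `z` is a genuine third vertex.
  reach : ∀ {x y z D} → SepAt g (Trio x y z) D → ∀ o → ¬ (o ∈ᵇ D) → o ≢ x → o ≢ y →
    ∃ λ v → v ∈ᵇ D × e g v z ≡ true × z ≢ x × z ≢ y
  reach {x} {y} {z} {D} (sepAt (d , d∈) _ av cl) o o∉ o≢x o≢y
    with c3 x y (lookup D) d o d∈ (Bool.¬-not o∉) (av d d∈ ∘ Sum.map₂ inj₁) [ o≢x , o≢y ]′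
  ... | u , v , u∈ , v∉ , _ , v∉C , uv with cl u u∈ v uv
  ... | inj₁ v∈ = ⊥-elim (t≢f v∈ v∉)
  ... | inj₂ (inj₁ p) = ⊥-elim (v∉C (inj₁ p))
  ... | inj₂ (inj₂ (inj₁ p)) = ⊥-elim (v∉C (inj₂ p))
  ... | inj₂ (inj₂ (inj₂ refl)) = u , u∈ , uv , v∉C ∘ inj₁ , v∉C ∘ inj₂

  private
    tight⊎sep : ∀ u v → Tight g u v ⊎ ∃ λ z → ∃ (SepAt g (Trio u v z))
    tight⊎sep u v with any? (λ z → Subset.anySubset? (sepAt? g (trio? u v z)))
    ... | yes p = inj₂ p
    ... | no ¬p = inj₁ λ z → case cross⊎sep g (trio? u v z) of λ
      { (inj₁ c) → c ; (inj₂ s) → ⊥-elim (¬p (z , s)) }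

    -- The side of a second separation {z, v, w} avoiding the adjacent pair x, y meets D in a smaller separated set.
    shrink : ∀ s x y z D → ∣ D ∣ < s → e g x y ≡ true → SepAt g (Trio x y z) D →
      ∃ λ u → ∃ λ v → e g u v ≡ true × Tight g u v
    shrink (suc s) x y z D (s≤s lt) xy sp@(sepAt (d , d∈) (b , b∉ , b∉C) av cl)
      with reach sp b b∉ (b∉C ∘ inj₁) (b∉C ∘ inj₂ ∘ inj₁)
    ... | v , v∈ , vz , z≢x , z≢y with tight⊎sep z v
    ... | inj₁ tgt = z , v , esym g vz , tgt
    ... | inj₂ (w , D' , sp') = next
      where
      x≢y : x ≢ y
      x≢y = edge≢ g xy
      x≢v : x ≢ v
      x≢v refl = av x v∈ (inj₁ refl)
      y≢v : y ≢ v
      y≢v refl = av y v∈ (inj₂ (inj₁ refl))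
      -- The adjacent vertices `x` and `y` cannot lie on opposite sides, so if `D'` contains one of
      -- them, its complement contains neither.
      side : ∃ λ E → SepAt g (Trio z v w) E × ¬ (x ∈ᵇ E) × ¬ (y ∈ᵇ E)
      side with x ∈ᵇ? D' | y ∈ᵇ? D'
      ... | no p | no q = D' , sp' , p , q
      ... | yes p | _ with complement {g = g} (trio? z v w) sp'
      ...   | B , sB , dj , _ = B , sB , (λ q → dj x q p) , λ q → case SepAt.closed sp' x p y xy of λ
                { (inj₁ r) → dj y q r ; (inj₂ r) → SepAt.avoids sB y q r }
      side | no p' | yes p with complement {g = g} (trio? z v w) sp'
      ...   | B , sB , dj , _ = B , sB , (λ q → case SepAt.closed sp' y p x (esym g xy) of λ
                { (inj₁ r) → dj x q r ; (inj₂ r) → SepAt.avoids sB x q r }) , λ q → dj y q p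
      next : ∃ λ u → ∃ λ v → e g u v ≡ true × Tight g u v
      next with side
      ... | E , sE@(sepAt (d' , d'∈) _ avE clE) , x∉ , y∉ = shrink s z v w F (ℕ.≤-trans F<D lt) (esym g vz) sF
        where
        F = tabulate (λ u → lookup D u ∧ lookup E u)
        into : ∀ {u} → u ∈ᵇ D → u ∈ᵇ E → u ∈ᵇ F
        into {u} p q = trans (Vec.lookup∘tabulate _ u) (cong₂ _∧_ p q)
        out : ∀ {u} → u ∈ᵇ F → u ∈ᵇ D × u ∈ᵇ E
        out {u} q = ∧-inv _ (trans (sym (Vec.lookup∘tabulate _ u)) q)
        v∉E : ¬ (v ∈ᵇ E)
        v∉E q = avE v q (inj₂ (inj₁ refl))
        -- Obtained from `reach` with `x` as the vertex outside `E`; it ensures that removing `z`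
        -- and `w` leaves `v` in place.
        third : w ≢ z × w ≢ v
        third = case x ≟ z of λ
          { (yes refl) → ⊥-elim (z≢x refl)
          ; (no x≢z) → let (_ , _ , _ , p , q) = reach sE x x∉ x≢z x≢v in p , q }
        F<D : ∣ F ∣ < ∣ D ∣
        F<D = Subset.p⊂q⇒∣p∣<∣q∣ {p = F} {D} ((λ {u} p → Vec.lookup⇒[]= u D (proj₁ (out {u} (Vec.[]=⇒lookup p))))
          , v , Vec.lookup⇒[]= v D v∈ , λ p → v∉E (proj₂ (out {v} (Vec.[]=⇒lookup p))))
        -- Since `z` and `w` do not separate `E` from `v`, the vertex `v` has a neighbour in `E`. As
        -- a neighbour of `v` it lies in `D` or is one of `x`, `y`, `z`, and none of these three is
        -- in `E`.
        meet : ∃ λ u → u ∈ᵇ F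
        meet with c3 z w (lookup E) d' v d'∈ (Bool.¬-not v∉E) (avE d' d'∈ ∘ Sum.map₂ inj₂)
                [ (λ { refl → edge≢ g vz refl }) , proj₂ third ∘ sym ]′
        ... | u , t , u∈ , t∉ , _ , t∉C , ut with clE u u∈ t ut
        ... | inj₁ r = ⊥-elim (t≢f r t∉)
        ... | inj₂ (inj₁ r) = ⊥-elim (t∉C (inj₁ r))
        ... | inj₂ (inj₂ (inj₂ r)) = ⊥-elim (t∉C (inj₂ r))
        ... | inj₂ (inj₂ (inj₁ refl)) with cl v v∈ u (esym g ut)
        ... | inj₁ r = u , into r u∈
        ... | inj₂ (inj₁ refl) = ⊥-elim (x∉ u∈)
        ... | inj₂ (inj₂ (inj₁ refl)) = ⊥-elim (y∉ u∈)
        ... | inj₂ (inj₂ (inj₂ refl)) = ⊥-elim (avE u u∈ (inj₁ refl))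
        -- At most one of `x` and `y` equals `w`; the other is left outside.
        rest : ∃ λ b → ¬ (b ∈ᵇ F) × ¬ Trio z v w b
        rest with x ≟ w
        ... | no x≢w = x , x∉ ∘ proj₂ ∘ out , λ { (inj₁ r) → z≢x (sym r) ; (inj₂ (inj₁ r)) → x≢v r ; (inj₂ (inj₂ r)) → x≢w r }
        ... | yes refl = y , y∉ ∘ proj₂ ∘ out , λ { (inj₁ r) → z≢y (sym r) ; (inj₂ (inj₁ r)) → y≢v r ; (inj₂ (inj₂ r)) → x≢y (sym r) }
        sF : SepAt g (Trio z v w) F
        sF = sepAt meet rest (λ u u∈ → avE u (proj₂ (out u∈))) λ u u∈ t ut → cF u t (out u∈) ut
          where
          cF : ∀ u t → u ∈ᵇ D × u ∈ᵇ E → e g u t ≡ true → t ∈ᵇ F ⊎ Trio z v w t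
          cF u t (uD , uE) ut with clE u uE t ut | cl u uD t ut
          ... | inj₂ r | _ = inj₂ r
          ... | inj₁ tE | inj₁ tD = inj₁ (into tD tE)
          ... | inj₁ tE | inj₂ (inj₁ refl) = ⊥-elim (x∉ tE)
          ... | inj₁ tE | inj₂ (inj₂ (inj₁ refl)) = ⊥-elim (y∉ tE)
          ... | inj₁ tE | inj₂ (inj₂ (inj₂ refl)) = ⊥-elim (avE _ tE (inj₁ refl))

  contractible-edge : ∀ x y → e g x y ≡ true → ∃ λ u → ∃ λ v → e g u v ≡ true × Tight g u v
  contractible-edge x y xy with tight⊎sep x y
  ... | inj₁ t = x , y , xy , t
  ... | inj₂ (z , D , sp) = shrink (suc ∣ D ∣) x y z D ℕ.≤-refl xy sp

-- Contraction of the edge 01 onto the vertex 0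

merge₀ : Fin (suc (suc n)) → Fin (suc n)
merge₀ zero = zero
merge₀ (suc u) = u

contract : Gr (suc (suc n)) → Gr (suc n)
contract g = record
  { e = λ { zero zero → false
          ; zero (suc v) → e g zero (suc (suc v)) ∨ e g 1F (suc (suc v))
          ; (suc u) zero → e g zero (suc (suc u)) ∨ e g 1F (suc (suc u))
          ; (suc u) (suc v) → e g (suc (suc u)) (suc (suc v)) }
  ; sy = λ { zero zero → refl ; zero (suc v) → refl ; (suc u) zero → refl ; (suc u) (suc v) → sy g _ _ }
  ; irr = λ { zero → refl ; (suc u) → irr g _ } }

contract-push : (g : Gr (suc (suc n))) → ∀ u v → e g u v ≡ true →
  merge₀ u ≡ merge₀ v ⊎ e (contract g) (merge₀ u) (merge₀ v) ≡ true
contract-push g zero zero p = inj₁ refl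
contract-push g zero 1F p = inj₁ refl
contract-push g zero (suc (suc v)) p rewrite p = inj₂ refl
contract-push g 1F zero p = inj₁ refl
contract-push g 1F 1F p = inj₁ refl
contract-push g 1F (suc (suc v)) p = inj₂ (∨-r (e g zero (suc (suc v))) p)
contract-push g (suc (suc u)) zero p rewrite esym g p = inj₂ refl
contract-push g (suc (suc u)) 1F p = inj₂ (∨-r (e g zero (suc (suc u))) (esym g p))
contract-push g (suc (suc u)) (suc (suc v)) p = inj₂ p

merge₀-onto : (x : Fin (suc n)) → ∃ λ u → merge₀ u ≡ x
merge₀-onto x = suc x , refl

contract-↠ : (g : Gr (suc (suc n))) → e g zero 1F ≡ true → g ↠ contract g
contract-↠ g p = record { f = merge₀ ; onto = merge₀-onto ; fibre = fib ; lift = lft }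
  where
  fib : ∀ u v → merge₀ u ≡ merge₀ v → Walk ⟪ g ⟫ (λ w → merge₀ w ≡ merge₀ u) u v
  fib zero zero q = here refl
  fib zero (suc .zero) refl = step refl p (here refl)
  fib (suc .zero) zero refl = step refl (esym g p) (here refl)
  fib (suc u) (suc .u) refl = here refl
  lft : ∀ x y → e (contract g) x y ≡ true → ∃ λ u → ∃ λ v → merge₀ u ≡ x × merge₀ v ≡ y × e g u v ≡ true
  lft zero (suc y) q with ∨-inv (e g zero (suc (suc y))) q
  ... | inj₁ r = zero , suc (suc y) , refl , refl , r
  ... | inj₂ r = suc zero , suc (suc y) , refl , refl , r
  lft (suc x) zero q with ∨-inv (e g zero (suc (suc x))) q
  ... | inj₁ r = suc (suc x) , zero , refl , refl , esym g r
  ... | inj₂ r = suc (suc x) , suc zero , refl , refl , esym g r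
  lft (suc x) (suc y) q = suc (suc x) , suc (suc y) , refl , refl , q

Conn3-contract : (g : Gr (suc (suc n))) → Conn3 g → Tight g zero 1F → Conn3 (contract g)
Conn3-contract {n} g c t = go
  where
  push : ∀ {C : Fin (suc (suc n)) → Set} {D : Fin (suc n) → Set} → (∀ u → C u → D (merge₀ u)) → (∀ u → D (merge₀ u) → C u) →
    Cross g C → Cross (contract g) D
  push = Cross-push {g = g} {contract g} merge₀ merge₀-onto (contract-push g)
  go : Conn3 (contract g)
  go zero zero = push
    (λ { u (inj₁ refl) → inj₁ refl ; u (inj₂ (inj₁ refl)) → inj₁ refl ; u (inj₂ (inj₂ refl)) → inj₁ refl })
    (λ { zero _ → inj₁ refl ; (suc u) (inj₁ refl) → inj₂ (inj₁ refl) ; (suc u) (inj₂ refl) → inj₂ (inj₁ refl) }) (t zero)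
  go zero (suc z) = push
    (λ { u (inj₁ refl) → inj₁ refl ; u (inj₂ (inj₁ refl)) → inj₁ refl ; u (inj₂ (inj₂ refl)) → inj₂ refl })
    (λ { zero _ → inj₁ refl ; (suc u) (inj₁ refl) → inj₂ (inj₁ refl) ; (suc u) (inj₂ refl) → inj₂ (inj₂ refl) }) (t (suc (suc z)))
  go (suc z) zero = push
    (λ { u (inj₁ refl) → inj₂ refl ; u (inj₂ (inj₁ refl)) → inj₂ refl ; u (inj₂ (inj₂ refl)) → inj₁ refl })
    (λ { zero _ → inj₁ refl ; (suc u) (inj₁ refl) → inj₂ (inj₂ refl) ; (suc u) (inj₂ refl) → inj₂ (inj₁ refl) }) (t (suc (suc z)))
  go (suc y) (suc z) = push
    (λ { u (inj₁ refl) → inj₁ refl ; u (inj₂ refl) → inj₂ refl })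
    (λ { zero (inj₁ ()) ; zero (inj₂ ()) ; (suc u) (inj₁ refl) → inj₁ refl ; (suc u) (inj₂ refl) → inj₂ refl })
    (c (suc (suc y)) (suc (suc z)))

pairFirst : (u v : Fin (suc (suc n))) → u ≢ v → Permutation′ (suc (suc n))
pairFirst u v u≢v = insert zero u (insert zero (punchOut u≢v) Perm.id)

pairFirst-1 : (u v : Fin (suc (suc n))) (u≢v : u ≢ v) → pairFirst u v u≢v ⟨$⟩ʳ suc zero ≡ v
pairFirst-1 u v u≢v = punchIn-punchOut u≢v

-- Induced paths

-- Oriented, so that the two path neighbours of a vertex can be told apart: there is at most one
-- successor and at most one predecessor.
next : Fin k → Fin k → Bool
next zero    1F    = true
next zero    _             = false
next (suc _) zero          = false
next (suc i) (suc j)       = next i j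

pathE : Fin k → Fin k → Bool
pathE i j = next i j ∨ next j i

pathE-sym : (i j : Fin k) → pathE i j ≡ pathE j i
pathE-sym i j = Bool.∨-comm (next i j) (next j i)

next-irr : (i : Fin k) → next i i ≡ false
next-irr zero    = refl
next-irr (suc i) = next-irr i

next-zero : (i : Fin (suc k)) → next i zero ≡ false
next-zero zero    = refl
next-zero (suc i) = refl

next-functional : ∀ (i j l : Fin k) → next i j ≡ true → next i l ≡ true → j ≡ l
next-functional zero    1F 1F _ _ = refl
next-functional (suc i) (suc j)    (suc l)    p q = cong suc (next-functional i j l p q)

next-injective : ∀ (i j l : Fin k) → next j i ≡ true → next l i ≡ true → j ≡ l
next-injective 1F    zero    zero    _ _ = refl
next-injective (suc (suc i)) (suc j) (suc l) p q = cong suc (next-injective (suc i) j l p q)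
next-injective 1F    zero    (suc l) _ q = ⊥-elim (t≢f q (next-zero l))
next-injective 1F    (suc j) _       p _ = ⊥-elim (t≢f p (next-zero j))

next≢ : (i j : Fin k) → next i j ≡ true → i ≢ j
next≢ i j p refl = t≢f p (next-irr i)

-- ins p renumbers a path after the insertion of a new vertex at position inject₁ p, just before the vertex p.
ins : Fin k → Fin k → Fin (suc k)
ins p = punchIn (inject₁ p)

next-ins : (p i j : Fin k) → i ≢ p → j ≢ p → next (ins p i) (ins p j) ≡ next i j
next-ins zero    zero    j       i≢ j≢ = ⊥-elim (i≢ refl)
next-ins zero    (suc i) j       i≢ j≢ = refl
next-ins (suc p) zero    zero    i≢ j≢ = refl
next-ins 1F    zero 1F    i≢ j≢ = ⊥-elim (j≢ refl)
next-ins 1F    zero (suc (suc j)) i≢ j≢ = refl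
next-ins (suc (suc p)) zero 1F    i≢ j≢ = refl
next-ins (suc (suc p)) zero (suc (suc j)) i≢ j≢ = refl
next-ins (suc p) (suc i) zero    i≢ j≢ = refl
next-ins (suc p) (suc i) (suc j) i≢ j≢ = next-ins p i j (i≢ ∘ cong suc) (j≢ ∘ cong suc)

next-ins-from : (p j : Fin k) → next (ins p p) (ins p j) ≡ next p j
next-ins-from zero    j       = refl
next-ins-from (suc p) zero    = refl
next-ins-from (suc p) (suc j) = next-ins-from p j

next-ins-to : (p i : Fin k) → i ≢ p → next (ins p i) (ins p p) ≡ false
next-ins-to zero    i i≢ = next-zero i
next-ins-to 1F    zero _ = refl
next-ins-to (suc (suc p)) zero _ = refl
next-ins-to (suc p) (suc i) i≢ = next-ins-to p i (i≢ ∘ cong suc)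

next-new-from : (p j : Fin k) → next (inject₁ p) (ins p j) ≡ does (j ≟ p)
next-new-from zero    zero    = refl
next-new-from zero    (suc j) = refl
next-new-from (suc p) zero    = refl
next-new-from (suc p) (suc j) = trans (next-new-from p j) (does-suc j p)

next-new-to : (p i : Fin k) → next (ins p i) (inject₁ p) ≡ next i p
next-new-to zero    i       = sym (next-zero i)
next-new-to 1F    zero = refl
next-new-to (suc (suc p)) zero = refl
next-new-to (suc p) (suc i) = next-new-to p i

next-inject₁ : (i j : Fin k) → next (inject₁ i) (inject₁ j) ≡ next i j
next-inject₁ zero    zero          = refl
next-inject₁ zero    1F    = refl
next-inject₁ zero    (suc (suc j)) = refl
next-inject₁ (suc i) zero          = refl
next-inject₁ (suc i) (suc j)       = next-inject₁ i j

last : Fin (suc k)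
last = fromℕ _

next-last : (j : Fin (suc k)) → next last j ≡ false
next-last {zero}  zero    = refl
next-last {suc k} zero    = refl
next-last {suc k} (suc j) = next-last j

next-to-last : (i : Fin (suc k)) → next (inject₁ i) (fromℕ (suc k)) ≡ does (i ≟ last)
next-to-last {zero}  zero    = refl
next-to-last {suc k} zero    = refl
next-to-last {suc k} (suc i) = trans (next-to-last i) (does-suc i last)

punchIn-last : (i : Fin k) → punchIn last i ≡ inject₁ i
punchIn-last zero    = refl
punchIn-last (suc i) = cong suc (punchIn-last i)

-- Graphs whose vertices from h onwards form an induced path; the first h vertices are the hubs.
Std : (h : ℕ) → Gr (h + k) → Set
Std h g = ∀ i j → e g (h ↑ʳ i) (h ↑ʳ j) ≡ pathE i j

HubPath : (h : ℕ) → Gr (h + k) → Set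
HubPath {k} h g = Σ (Gr (h + k)) λ g' → g ≃ g' × Std h g'

HubPath-≃ : ∀ h {g g' : Gr (h + k)} → g ≃ g' → HubPath h g' → HubPath h g
HubPath-≃ h i (a , j , s) = a , ≃-trans i j , s

insert-self : (i j : Fin (suc n)) (π : Permutation′ n) → insert i j π ⟨$⟩ʳ i ≡ j
insert-self i j π with i ≟ i
... | yes _ = refl
... | no i≢ = ⊥-elim (i≢ refl)

module _ (g : Gr (suc (2 + k))) (j : Fin (suc k))
  (new-row : ∀ i → e g zero (3 ↑ʳ i) ≡ pathE j (punchIn j i))
  (old-rows : ∀ i l → e g (3 ↑ʳ i) (3 ↑ʳ l) ≡ pathE (punchIn j i) (punchIn j l)) where

  private
    σ : Permutation′ (3 + k)
    σ = insert (2 ↑ʳ j) zero Perm.id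

    σ-new : σ ⟨$⟩ʳ (2 ↑ʳ j) ≡ zero
    σ-new = insert-self (2 ↑ʳ j) zero Perm.id

    σ-old : ∀ i → σ ⟨$⟩ʳ (2 ↑ʳ punchIn j i) ≡ 3 ↑ʳ i
    σ-old i = insert-punchIn (2 ↑ʳ j) zero Perm.id (2 ↑ʳ i)

  -- The hypotheses say that `zero` and the old path vertices satisfy the path equations once `zero`
  -- sits at position `j`. The permutation `σ` moves it there, which leaves two hubs.
  insert-hub : HubPath {suc k} 2 g
  insert-hub = relabel σ g , ≃-sym (relabel-≃ σ g) , std
    where
    std : Std {suc k} 2 (relabel σ g)
    std p q with punchView j p | punchView j q
    ... | new | new = trans (irr g _) (sym (cong₂ _∨_ (next-irr j) (next-irr j)))
    ... | new | old i = trans (cong₂ (e g) σ-new (σ-old i)) (new-row i)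
    ... | old i | new =
      trans (cong₂ (e g) (σ-old i) σ-new) (trans (sy g _ _) (trans (new-row i) (pathE-sym j _)))
    ... | old i | old l = trans (cong₂ (e g) (σ-old i) (σ-old l)) (old-rows i l)

append-first : (g : Gr (3 + suc k)) → Std 3 g → e g zero (3 ↑ʳ zero) ≡ true →
  (∀ i → e g zero (3 ↑ʳ suc i) ≡ false) → HubPath {suc (suc k)} 2 g
append-first g s p q = insert-hub g zero (λ { zero → p ; (suc i) → q i }) s

append-last : (g : Gr (3 + suc k)) → Std 3 g → e g zero (3 ↑ʳ last) ≡ true →
  (∀ i → i ≢ last → e g zero (3 ↑ʳ i) ≡ false) → HubPath {suc (suc k)} 2 g
append-last {k} g s p q = insert-hub g (fromℕ (suc k)) row rows
  where
  row : ∀ i → e g zero (3 ↑ʳ i) ≡ pathE (fromℕ (suc k)) (punchIn (fromℕ (suc k)) i)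
  row i rewrite punchIn-last i | next-last (inject₁ i) | next-to-last i with i ≟ last
  ... | yes refl = p
  ... | no i≢ = q i i≢
  rows : ∀ i l → e g (3 ↑ʳ i) (3 ↑ʳ l) ≡ pathE (punchIn (fromℕ (suc k)) i) (punchIn (fromℕ (suc k)) l)
  rows i l rewrite punchIn-last i | punchIn-last l | next-inject₁ i l | next-inject₁ l i = s i l

-- Vertex splitting: the edge joining zero and suc x contracts onto the vertex x of M.
record Split (g : Gr (suc n)) (M : Gr n) (x : Fin n) : Set where
  field
    joined : e g zero (suc x) ≡ true
    merged : ∀ y → y ≢ x → e M x y ≡ e g zero (suc y) ∨ e g (suc x) (suc y)
    others : ∀ y z → y ≢ x → z ≢ x → e g (suc y) (suc z) ≡ e M y z

-- `lift₀` keeps the vertex `zero` of `g` in place and lets the isomorphism name all others. The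
-- other end of the contracted edge thereby takes the name that the merged vertex has in `M`.
contract-split : (g : Gr (suc (suc n))) → e g zero 1F ≡ true → {M : Gr (suc n)} (i : contract g ≃ M) →
  Split (relabel (flip (lift₀ (_≃_.perm i))) g) M (_≃_.perm i ⟨$⟩ʳ zero)
contract-split g p {M} (iso π q) = record { joined = jn ; merged = mg ; others = oth }
  where
  b = π ⟨$⟩ˡ_
  M-eq : ∀ y z → e M y z ≡ e (contract g) (b y) (b z)
  M-eq y z = sym (trans (q _ _) (cong₂ (e M) (inverseʳ π) (inverseʳ π)))
  b0 : b (π ⟨$⟩ʳ zero) ≡ zero
  b0 = inverseˡ π
  ne : ∀ y → y ≢ π ⟨$⟩ʳ zero → ∃ λ w → b y ≡ suc w
  ne y y≢ with b y in eq
  ... | zero = ⊥-elim (y≢ (trans (sym (inverseʳ π)) (cong (π ⟨$⟩ʳ_) eq)))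
  ... | suc w = w , refl
  jn : e g zero (suc (b (π ⟨$⟩ʳ zero))) ≡ true
  jn rewrite b0 = p
  mg : ∀ y → y ≢ π ⟨$⟩ʳ zero → e M (π ⟨$⟩ʳ zero) y ≡ e g zero (suc (b y)) ∨ e g (suc (b (π ⟨$⟩ʳ zero))) (suc (b y))
  mg y y≢ with ne y y≢
  ... | w , eq rewrite M-eq (π ⟨$⟩ʳ zero) y | b0 | eq = refl
  oth : ∀ y z → y ≢ π ⟨$⟩ʳ zero → z ≢ π ⟨$⟩ʳ zero → e g (suc (b y)) (suc (b z)) ≡ e M y z
  oth y z y≢ z≢ with ne y y≢ | ne z z≢
  ... | w , eq | w' , eq' rewrite M-eq y z | eq | eq' = refl

swap₀ : Fin n → Permutation′ (suc n)
swap₀ x = Perm.transpose zero (suc x)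

module _ (x : Fin n) where
  swap₀-x : swap₀ x ⟨$⟩ʳ suc x ≡ zero
  swap₀-x with x ≟ x
  ... | yes _ = refl
  ... | no q = ⊥-elim (q refl)
  swap₀-o : ∀ y → y ≢ x → swap₀ x ⟨$⟩ʳ suc y ≡ suc y
  swap₀-o y y≢ with y ≟ x
  ... | yes q = ⊥-elim (y≢ q)
  ... | no _ = refl

-- The ends of the split edge play the same part, so every case for one end has a mirror image.
Split-swap : {g : Gr (suc n)} {M : Gr n} {x : Fin n} → Split g M x → Split (relabel (swap₀ x) g) M x
Split-swap {g = g} {M} {x} s = record
  { joined = trans (cong (e g (suc x)) (swap₀-x x)) (esym g joined)
  ; merged = λ y y≢ → trans (merged y y≢) (trans (Bool.∨-comm _ (e g (suc x) (suc y)))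
      (sym (cong₂ _∨_ (cong (e g (suc x)) (swap₀-o x y y≢)) (cong₂ (e g) (swap₀-x x) (swap₀-o x y y≢)))))
  ; others = λ y z y≢ z≢ → trans (cong₂ (e g) (swap₀-o x y y≢) (swap₀-o x z z≢)) (others y z y≢ z≢) }
  where open Split s

2↑-inj : ∀ {i j : Fin k} → 2 ↑ʳ i ≡ 2 ↑ʳ j → i ≡ j
2↑-inj refl = refl

module _ {g : Gr (3 + k)} {M : Gr (2 + k)} (st : Std 2 M) where

  split-hub : ∀ {x} → Split g M x → (∀ i → 2 ↑ʳ i ≢ x) → Std 3 g
  split-hub s x≢ i j = trans (Split.others s _ _ (x≢ i) (x≢ j)) (st i j)

  -- The end that keeps all path neighbours of `p` takes the place of `p`; the other end, `zero`,
  -- becomes a third hub, whatever its own neighbours are.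
  split-full : ∀ {p} → Split g M (2 ↑ʳ p) → (∀ i → pathE p i ≡ true → e g (3 ↑ʳ p) (3 ↑ʳ i) ≡ true) → Std 3 g
  split-full {p} s full i j with i ≟ p | j ≟ p
  ... | no i≢ | no j≢ = trans (Split.others s _ _ (i≢ ∘ 2↑-inj) (j≢ ∘ 2↑-inj)) (st i j)
  ... | yes refl | yes refl = trans (irr g _) (sym (cong₂ _∨_ (next-irr p) (next-irr p)))
  ... | yes refl | no j≢ = iff-≡ (λ q → trans (sym (st p j)) (trans (Split.merged s _ (j≢ ∘ 2↑-inj)) (∨-r _ q))) (full j)
  ... | no i≢ | yes refl = iff-≡
    (λ q → trans (pathE-sym i p) (trans (sym (st p i)) (trans (Split.merged s _ (i≢ ∘ 2↑-inj)) (∨-r _ (esym g q)))))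
    (λ q → esym g (full i (trans (pathE-sym p i) q)))

  -- The two path neighbours of `p` are shared out: `a` is joined to `zero` only and `b` to the
  -- other end only. The split edge then lies on a path that is longer by one vertex, with `zero`
  -- just before `p`.
  split-insert : ∀ {p a b} → Split g M (2 ↑ʳ p) → next a p ≡ true → next p b ≡ true →
    e g (3 ↑ʳ p) (3 ↑ʳ a) ≡ false → e g zero (3 ↑ʳ b) ≡ false → HubPath {suc k} 2 g
  split-insert {p} {a} {b} s ap pb va ub = insert-hub g (inject₁ p) row rows
    where
    a≢ : a ≢ p
    a≢ = next≢ a p ap
    b≢ : b ≢ p
    b≢ r = next≢ p b pb (sym r)
    mg : ∀ i → i ≢ p → pathE p i ≡ e g zero (3 ↑ʳ i) ∨ e g (3 ↑ʳ p) (3 ↑ʳ i)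
    mg i i≢ = trans (sym (st p i)) (Split.merged s _ (i≢ ∘ 2↑-inj))
    u-next : ∀ i → i ≢ p → e g zero (3 ↑ʳ i) ≡ next i p
    u-next i i≢ = iff-≡
      (λ q → case ∨-inv (next p i) (trans (mg i i≢) (cong (_∨ e g (3 ↑ʳ p) (3 ↑ʳ i)) q)) of λ
        { (inj₁ r) → ⊥-elim (t≢f (subst (λ i → e g zero (3 ↑ʳ i) ≡ true) (next-functional p i b r pb) q) ub)
        ; (inj₂ r) → r })
      (λ q → case next-injective p i a q ap of λ { refl → case ∨-inv (e g zero (3 ↑ʳ i)) (trans (sym (mg i i≢)) (∨-r (next p i) q)) of λ
        { (inj₁ r) → r ; (inj₂ r) → ⊥-elim (t≢f r va) } })
    v-next : ∀ i → i ≢ p → e g (3 ↑ʳ p) (3 ↑ʳ i) ≡ next p i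
    v-next i i≢ = iff-≡
      (λ q → case ∨-inv (next p i) (trans (mg i i≢) (∨-r _ q)) of λ
        { (inj₁ r) → r
        ; (inj₂ r) → ⊥-elim (t≢f (subst (λ i → e g (3 ↑ʳ p) (3 ↑ʳ i) ≡ true) (next-injective p i a r ap) q) va) })
      (λ q → case next-functional p i b q pb of λ { refl → case ∨-inv (e g zero (3 ↑ʳ i)) (trans (sym (mg i i≢)) (cong (_∨ next i p) q)) of λ
        { (inj₁ r) → ⊥-elim (t≢f r ub) ; (inj₂ r) → r } })
    row : ∀ i → e g zero (3 ↑ʳ i) ≡ pathE (inject₁ p) (ins p i)
    row i rewrite next-new-from p i | next-new-to p i with i ≟ p
    ... | yes refl = Split.joined s
    ... | no i≢ = u-next i i≢
    v-row : ∀ j → j ≢ p → e g (3 ↑ʳ p) (3 ↑ʳ j) ≡ pathE (ins p p) (ins p j)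
    v-row j j≢ rewrite next-ins-from p j | next-ins-to p j j≢ | Bool.∨-identityʳ (next p j) = v-next j j≢
    rows : ∀ i j → e g (3 ↑ʳ i) (3 ↑ʳ j) ≡ pathE (ins p i) (ins p j)
    rows i j with i ≟ p | j ≟ p
    ... | no i≢ | no j≢ = trans (Split.others s _ _ (i≢ ∘ 2↑-inj) (j≢ ∘ 2↑-inj))
      (trans (st i j) (sym (cong₂ _∨_ (next-ins p i j i≢ j≢) (next-ins p j i j≢ i≢))))
    ... | yes refl | yes refl = trans (irr g _) (sym (cong₂ _∨_ (next-irr (ins p p)) (next-irr (ins p p))))
    ... | yes refl | no j≢ = v-row j j≢
    ... | no i≢ | yes refl = trans (sy g _ _) (trans (v-row i i≢) (pathE-sym (ins p p) (ins p i)))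

-- The outcome of splitting a vertex of a two-hub graph; in a three-hub outcome the vertex zero
-- is an end of the split edge, and P records what is known about it whichever end that is.
data Outcome {k} (P : Gr (3 + k) → Set) (g : Gr (3 + k)) (M : Gr (2 + k)) (x : Fin (2 + k)) : Set where
  two   : HubPath {suc k} 2 g → Outcome P g M x
  three : (g' : Gr (3 + k)) → P g' → g ≃ g' → Split g' M x → Std 3 g' →
    (∀ p i → x ≡ 2 ↑ʳ p → pathE p i ≡ true → e g' (3 ↑ʳ p) (3 ↑ʳ i) ≡ true) → Outcome P g M x

≃-refl : {g : Gr n} → g ≃ g
≃-refl = iso Perm.id λ _ _ → refl

-- For `x` on the path, an end that keeps all path neighbours of `x` replaces it. Otherwise each end
-- misses one. They cannot miss the same one, since that would be no neighbour of the merged vertex,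
-- so one misses the successor and the other the predecessor, and the path grows.
split-two : {P : Gr (3 + k) → Set} {g : Gr (3 + k)} {M : Gr (2 + k)} → Std 2 M → ∀ x → Split g M x →
  P g → P (relabel (swap₀ x) g) → Outcome P g M x
split-two {g = g} st zero s P₁ P₂ = three g P₁ ≃-refl s (split-hub st s λ _ ()) λ _ _ ()
split-two {g = g} st 1F s P₁ P₂ = three g P₁ ≃-refl s (split-hub st s λ _ ()) λ _ _ ()
split-two {k} {P} {g} {M} st (suc (suc p)) s P₁ P₂ = go (test g) (test g⁻)
  where
  g⁻ = relabel (swap₀ (2 ↑ʳ p)) g
  s⁻ = Split-swap s
  Missing : Gr (3 + k) → Set
  Missing g = ∃ λ i → pathE p i ≡ true × e g (3 ↑ʳ p) (3 ↑ʳ i) ≡ false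
  Full : Gr (3 + k) → Set
  Full g = ∀ i → pathE p i ≡ true → e g (3 ↑ʳ p) (3 ↑ʳ i) ≡ true
  test : ∀ g → Missing g ⊎ Full g
  test g with any? (λ i → pathE p i Bool.≟ true ×-dec e g (3 ↑ʳ p) (3 ↑ʳ i) Bool.≟ false)
  ... | yes q = inj₁ q
  ... | no q = inj₂ λ i r → Bool.¬-not λ t → q (i , r , t)
  go : Missing g ⊎ Full g → Missing g⁻ ⊎ Full g⁻ → Outcome P g M (2 ↑ʳ p)
  go (inj₂ full) _ = three g P₁ ≃-refl s (split-full st s full) λ { _ i refl → full i }
  go _ (inj₂ full) = three g⁻ P₂ (≃-sym (relabel-≃ (swap₀ (2 ↑ʳ p)) g)) s⁻ (split-full st s⁻ full) λ { _ i refl → full i }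
  go (inj₁ (a , pa , va)) (inj₁ (b , pb , ub)) with a ≟ b
  ... | yes refl = ⊥-elim (t≢f (trans (sym (Split.merged s (2 ↑ʳ a) (≢p pa ∘ 2↑-inj))) (trans (st p a) pa))
                     (cong₂ _∨_ (trans (sym (u⁻ a (≢p pa))) ub) va))
    where
    ≢p : ∀ {a} → pathE p a ≡ true → a ≢ p
    ≢p q refl = t≢f q (cong₂ _∨_ (next-irr p) (next-irr p))
    u⁻ : ∀ a → a ≢ p → e g⁻ (3 ↑ʳ p) (3 ↑ʳ a) ≡ e g zero (3 ↑ʳ a)
    u⁻ a a≢ = cong₂ (e g) (swap₀-x (2 ↑ʳ p)) (swap₀-o (2 ↑ʳ p) (2 ↑ʳ a) (a≢ ∘ 2↑-inj))
  ... | no a≢b = fin (∨-inv (next p a) pa) (∨-inv (next p b) pb)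
    where
    ≢p : ∀ {a} → pathE p a ≡ true → a ≢ p
    ≢p q refl = t≢f q (cong₂ _∨_ (next-irr p) (next-irr p))
    u⁻ : ∀ a → a ≢ p → e g⁻ (3 ↑ʳ p) (3 ↑ʳ a) ≡ e g zero (3 ↑ʳ a)
    u⁻ a a≢ = cong₂ (e g) (swap₀-x (2 ↑ʳ p)) (swap₀-o (2 ↑ʳ p) (2 ↑ʳ a) (a≢ ∘ 2↑-inj))
    v⁻ : ∀ a → a ≢ p → e g⁻ zero (3 ↑ʳ a) ≡ e g (3 ↑ʳ p) (3 ↑ʳ a)
    v⁻ a a≢ = cong (e g (3 ↑ʳ p)) (swap₀-o (2 ↑ʳ p) (2 ↑ʳ a) (a≢ ∘ 2↑-inj))
    fin : next p a ≡ true ⊎ next a p ≡ true → next p b ≡ true ⊎ next b p ≡ true → Outcome P g M (2 ↑ʳ p)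
    fin (inj₁ q) (inj₁ r) = ⊥-elim (a≢b (next-functional p a b q r))
    fin (inj₂ q) (inj₂ r) = ⊥-elim (a≢b (next-injective p a b q r))
    fin (inj₂ q) (inj₁ r) = two (split-insert st s q r va (trans (sym (u⁻ b (≢p pb))) ub))
    fin (inj₁ q) (inj₂ r) = two (HubPath-≃ {suc k} 2 (≃-sym (relabel-≃ (swap₀ (2 ↑ʳ p)) g))
      (split-insert st s⁻ r q ub (trans (v⁻ a (≢p pa)) va)))

-- Exhaustive search over the graphs obtained by switching on some optional edges

record Letter : Set where
  constructor ltr
  field b₀ b₁ b₂ : Bool

bit : Fin 3 → Letter → Bool
bit zero             = Letter.b₀
bit 1F       = Letter.b₁
bit 2F = Letter.b₂

-- A possible edge is either decided or read off one bit of one letter, so a `Family` is a set of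
-- graphs parametrised by words, and its graphs grow with the word.
data Cell (s : ℕ) : Set where
  fix : Bool → Cell s
  var : Fin s → Fin 3 → Cell s

Word : ℕ → Set
Word = Vec Letter

Rel : ℕ → Set
Rel n = Fin n → Fin n → Bool

Family : ℕ → ℕ → Set
Family n s = Fin n → Fin n → Cell s

eval : ∀ {s} → Word s → Cell s → Bool
eval w (fix b)   = b
eval w (var i t) = bit t (lookup w i)

rel : ∀ {s} → Family n s → Word s → Rel n
rel F w u v = eval w (F u v)

_⇒ᵇ_ : Bool → Bool → Bool
false ⇒ᵇ _ = true
true  ⇒ᵇ b = b

_⊑_ : Letter → Letter → Bool
ltr a b c ⊑ ltr x y z = (a ⇒ᵇ x) ∧ (b ⇒ᵇ y) ∧ (c ⇒ᵇ z)

⊑-bit : ∀ ℓ ℓ' → ℓ ⊑ ℓ' ≡ true → ∀ t → bit t ℓ ≡ true → bit t ℓ' ≡ true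
⊑-bit (ltr true _ _) (ltr true _ _) p zero refl = refl
⊑-bit (ltr a true _) (ltr x y _) p 1F refl = proj₁ (∧-inv y (proj₂ (∧-inv (a ⇒ᵇ x) p)))
⊑-bit (ltr a b true) (ltr x y z) p 2F refl = proj₂ (∧-inv (b ⇒ᵇ y) (proj₂ (∧-inv (a ⇒ᵇ x) p)))

blank : Letter → Bool
blank (ltr false false false) = true
blank _ = false

blank-⊑ : ∀ ℓ ℓ' → blank ℓ ≡ true → ℓ ⊑ ℓ' ≡ true
blank-⊑ (ltr false false false) _ _ = refl

-- A larger word has more edges, so a minor certified for `c` settles every word above `c`.
_⊑ʷ_ : ∀ {s} → Word s → Word s → Set
c ⊑ʷ w = ∀ i → lookup c i ⊑ lookup w i ≡ true

blanks : ∀ {s} → Word s → Bool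
blanks []      = true
blanks (ℓ ∷ w) = blank ℓ ∧ blanks w

blanks-⊑ : ∀ {s} (c w : Word s) → blanks c ≡ true → c ⊑ʷ w
blanks-⊑ (ℓ ∷ c) (ℓ' ∷ w) p zero    = blank-⊑ ℓ ℓ' (proj₁ (∧-inv (blank ℓ) p))
blanks-⊑ (ℓ ∷ c) (ℓ' ∷ w) p (suc i) = blanks-⊑ c w (proj₂ (∧-inv (blank ℓ) p)) i

letters : List Letter
letters = ltr false false false ∷ ltr true false false ∷ ltr false true false ∷ ltr false false true
  ∷ ltr true true false ∷ ltr true false true ∷ ltr false true true ∷ ltr true true true ∷ []

any-inv : {A : Set} (p : A → Bool) (xs : List A) → any p xs ≡ true → ∃ λ x → x ∈ˡ xs × p x ≡ true
any-inv p (x ∷ xs) q with p x in eq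
... | true = x , (here refl) , eq
... | false = let (y , m , r) = any-inv p xs q in y , there m , r

all-inv : {A : Set} (p : A → Bool) {xs : List A} → all p xs ≡ true → ∀ {x} → x ∈ˡ xs → p x ≡ true
all-inv p {x ∷ xs} q m with p x in eq
all-inv p {x ∷ xs} q (here refl)     | true = eq
all-inv p {x ∷ xs} q (there m) | true = all-inv p q m

letters-complete : ∀ ℓ → ℓ ∈ˡ letters
letters-complete (ltr false false false) = (here refl)
letters-complete (ltr true false false)  = there (here refl)
letters-complete (ltr false true false)  = there (there (here refl))
letters-complete (ltr false false true)  = there (there (there (here refl)))
letters-complete (ltr true true false)   = there (there (there (there (here refl))))
letters-complete (ltr true false true)   = there (there (there (there (there (here refl)))))
letters-complete (ltr false true true)   = there (there (there (there (there (there (here refl))))))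
letters-complete (ltr true true true)    = there (there (there (there (there (there (there (here refl)))))))

tails : ∀ {s} → Letter → List (Word (suc s)) → List (Word s)
tails ℓ []              = []
tails ℓ ((ℓ' ∷ c) ∷ cs) = if ℓ' ⊑ ℓ then c ∷ tails ℓ cs else tails ℓ cs

tails-inv : ∀ {s} ℓ (cs : List (Word (suc s))) {c} → c ∈ˡ tails ℓ cs → ∃ λ ℓ' → (ℓ' ∷ c) ∈ˡ cs × ℓ' ⊑ ℓ ≡ true
tails-inv ℓ ((ℓ' ∷ c) ∷ cs) m with ℓ' ⊑ ℓ in eq
tails-inv ℓ ((ℓ' ∷ c) ∷ cs) (here refl)     | true = ℓ' , (here refl) , eq
tails-inv ℓ ((ℓ' ∷ c) ∷ cs) (there m) | true = let (x , m' , r) = tails-inv ℓ cs m in x , there m' , r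
tails-inv ℓ ((ℓ' ∷ c) ∷ cs) m      | false = let (x , m' , r) = tails-inv ℓ cs m in x , there m' , r

-- `cs` holds the unread parts of the certificates that lie below the letters chosen so far. One
-- with no bit left lies below every continuation and settles the whole branch, so `leaf` has to
-- hold only for words that no certificate covers.
search : ∀ {s} → Vec (Letter → Bool) s → List (Word s) → (Word s → Bool) → Bool
search []       cs leaf = any blanks cs ∨ leaf []
search (c ∷ ch) cs leaf = any blanks cs ∨
  all (λ ℓ → if c ℓ then search ch (tails ℓ cs) (λ w → leaf (ℓ ∷ w)) else true) letters

search-sound : ∀ {s} (ch : Vec (Letter → Bool) s) cs leaf → search ch cs leaf ≡ true →
  ∀ w → (∀ i → lookup ch i (lookup w i) ≡ true) → (∃ λ c → c ∈ˡ cs × c ⊑ʷ w) ⊎ leaf w ≡ true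
search-sound [] cs leaf p [] _ with ∨-inv (any blanks cs) p
... | inj₂ q = inj₂ q
... | inj₁ q = let (c , m , r) = any-inv blanks cs q in inj₁ (c , m , λ ())
search-sound (c ∷ ch) cs leaf p (ℓ ∷ w) ok with ∨-inv (any blanks cs) p
... | inj₁ q = let (c , m , r) = any-inv blanks cs q in inj₁ (c , m , blanks-⊑ c (ℓ ∷ w) r)
... | inj₂ q with all-inv (λ ℓ → if c ℓ then search ch (tails ℓ cs) (λ w → leaf (ℓ ∷ w)) else true) q (letters-complete ℓ)
... | r rewrite ok zero with search-sound ch (tails ℓ cs) (λ w → leaf (ℓ ∷ w)) r w (λ i → ok (suc i))
... | inj₂ lf = inj₂ lf
... | inj₁ (d , m , s) = let (ℓ' , m' , t) = tails-inv ℓ cs m in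
  inj₁ (ℓ' ∷ d , m' , λ { zero → t ; (suc i) → s i })

-- Minor models given by the branch set of each vertex

Reach : Rel n → (Fin n → Set) → ℕ → Fin n → Fin n → Set
Reach E P zero    u v = u ≡ v
Reach E P (suc t) u v = u ≡ v ⊎ ∃ λ w → P w × E u w ≡ true × Reach E P t w v

reach? : (E : Rel n) {P : Fin n → Set} → (∀ w → Dec (P w)) → ∀ t u v → Dec (Reach E P t u v)
reach? E P? zero    u v = u ≟ v
reach? E P? (suc t) u v = u ≟ v ⊎-dec any? λ w → P? w ×-dec E u w Bool.≟ true ×-dec reach? E P? t w v

-- A decidable condition sufficient for a minor. The four branch sets on the large side are single
-- vertices; nothing is lost by this, because such a set has to meet only two others and can be cut
-- down to a path, all but one vertex of which passes to one of them. The other two sets are tested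
-- for connectedness by walks of at most five steps.
Model : Rel n → (Fin n → Maybe (Fin 6)) → Set
Model E ρ =
  (∀ h → ∃ λ v → ρ v ≡ just h) ×
  (∀ u → ρ u ≡ just 0F ⊎ ρ u ≡ just 1F → ∀ v → ρ v ≡ ρ u → Reach E (λ w → ρ w ≡ ρ u) 5 u v) ×
  (∀ (h : Fin 4) → (∀ u → ρ u ≡ just (2 ↑ʳ h) → ∀ v → ρ v ≡ just (2 ↑ʳ h) → u ≡ v) ×
    (∀ (c : Fin 2) → ∃ λ u → ρ u ≡ just (2 ↑ʳ h) × ∃ λ v → ρ v ≡ just (c ↑ˡ 4) × E u v ≡ true))

model? : (E : Rel n) (ρ : Fin n → Maybe (Fin 6)) → Dec (Model E ρ)
model? E ρ =
  all? (λ h → any? λ v → ρ v ≟ᵐ just h) ×-dec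
  all? (λ u → (ρ u ≟ᵐ just 0F ⊎-dec ρ u ≟ᵐ just 1F) →-dec
    all? λ v → ρ v ≟ᵐ ρ u →-dec reach? E (λ w → ρ w ≟ᵐ ρ u) 5 u v) ×-dec
  all? (λ h → all? (λ u → ρ u ≟ᵐ just (2 ↑ʳ h) →-dec all? λ v → ρ v ≟ᵐ just (2 ↑ʳ h) →-dec u ≟ v) ×-dec
    all? λ c → any? λ u → ρ u ≟ᵐ just (2 ↑ʳ h) ×-dec any? λ v → ρ v ≟ᵐ just (c ↑ˡ 4) ×-dec E u v Bool.≟ true)
  where
  _≟ᵐ_ : (x y : Maybe (Fin 6)) → Dec (x ≡ y)
  _≟ᵐ_ = Maybe.≡-dec _≟_

reach-walk : (g : Gr n) {E : Rel n} {P : Fin n → Set} → (∀ u v → E u v ≡ true → e g u v ≡ true) →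
  ∀ t {u v} → P u → Reach E P t u v → Walk ⟪ g ⟫ P u v
reach-walk g s zero    p refl = here p
reach-walk g s (suc t) p (inj₁ refl) = here p
reach-walk g s (suc t) p (inj₂ (w , q , uw , r)) = step p (s _ _ uw) (reach-walk g s t q r)

K24-leaves : ∀ h h' → ¬ Edge K24 (2 ↑ʳ h) (2 ↑ʳ h')
K24-leaves zero zero ()
K24-leaves zero 1F ()
K24-leaves zero 2F ()
K24-leaves zero 3F ()
K24-leaves 1F zero ()
K24-leaves 1F 1F ()
K24-leaves 1F 2F ()
K24-leaves 1F 3F ()
K24-leaves 2F zero ()
K24-leaves 2F 1F ()
K24-leaves 2F 2F ()
K24-leaves 2F 3F ()
K24-leaves 3F zero ()
K24-leaves 3F 1F ()
K24-leaves 3F 2F ()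
K24-leaves 3F 3F ()

model-minor : (g : Gr n) {E : Rel n} {ρ : Fin n → Maybe (Fin 6)} → (∀ u v → E u v ≡ true → e g u v ≡ true) →
  Model E ρ → K24-minor g
model-minor g {E} {ρ} s (ne , cn , lf) = ρ , ne , conn , ed
  where
  hubs : ∀ (h : Fin 6) → (∀ u v → ρ u ≡ just h → ρ v ≡ just h → Reach E (λ w → ρ w ≡ ρ u) 5 u v) →
    ∀ u v → ρ u ≡ just h → ρ v ≡ just h → Walk ⟪ g ⟫ (λ x → ρ x ≡ just h) u v
  hubs h r u v p q = mapʷ (λ a → trans a p) (reach-walk g s 5 refl (r u v p q))
  conn : ∀ (h : Fin 6) → ∀ u v → ρ u ≡ just h → ρ v ≡ just h → Walk ⟪ g ⟫ (λ x → ρ x ≡ just h) u v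
  conn zero = hubs zero λ u v p q → cn u (inj₁ p) v (trans q (sym p))
  conn 1F = hubs 1F λ u v p q → cn u (inj₂ p) v (trans q (sym p))
  conn (suc (suc h)) u v p q = subst (Walk ⟪ g ⟫ (λ x → ρ x ≡ just (suc (suc h))) u) (proj₁ (lf h) u p v q) (here p)
  to : ∀ (h : Fin 4) (c : Fin 2) → ∃ λ u → ∃ λ v → ρ u ≡ just (2 ↑ʳ h) × ρ v ≡ just (c ↑ˡ 4) × Edge ⟪ g ⟫ u v
  to h c = let (u , p , v , q , uv) = proj₂ (lf h) c in u , v , p , q , s u v uv
  from : ∀ (h : Fin 4) (c : Fin 2) → ∃ λ u → ∃ λ v → ρ u ≡ just (c ↑ˡ 4) × ρ v ≡ just (2 ↑ʳ h) × Edge ⟪ g ⟫ u v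
  from h c = let (u , v , p , q , uv) = to h c in v , u , q , p , esym g uv
  ed : ∀ (h h' : Fin 6) → Edge K24 h h' → ∃ λ u → ∃ λ v → ρ u ≡ just h × ρ v ≡ just h' × Edge ⟪ g ⟫ u v
  ed zero (suc (suc h)) _ = from h zero
  ed 1F (suc (suc h)) _ = from h 1F
  ed (suc (suc h)) zero _ = to h zero
  ed (suc (suc h)) 1F _ = to h 1F
  ed zero zero ()
  ed zero 1F ()
  ed 1F zero ()
  ed 1F 1F ()
  ed (suc (suc h)) (suc (suc h')) p = ⊥-elim (K24-leaves h h' p)

-- A certificate is a number whose decimal digits, read from the right, spell a word (digits 0-7 in binary)
-- followed by the branch set of each vertex (0 for none).

digits : ℕ → ℕ → List ℕ
digits zero    _ = []
digits (suc f) n = n % 10 ∷ digits f (n / 10)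

toLetter : ℕ → Letter
toLetter n = ltr (n % 2 ≡ᵇ 1) ((n / 2) % 2 ≡ᵇ 1) (n / 4 ≡ᵇ 1)

clamp : ℕ → Fin (suc n)
clamp zero = zero
clamp {zero} (suc i) = zero
clamp {suc n} (suc i) = suc (clamp i)

take : {A : Set} → ∀ n → (ℕ → A) → List ℕ → Vec A n
take zero    f xs       = []
take (suc n) f []       = f 0 ∷ take n f []
take (suc n) f (x ∷ xs) = f x ∷ take n f xs

branch : ℕ → Maybe (Fin 6)
branch zero    = nothing
branch (suc n) = just (clamp n)

certWord : ∀ s → ℕ → Word s
certWord s c = take s toLetter (digits s c)

certBranch : ∀ s n → ℕ → Vec (Maybe (Fin 6)) n
certBranch s n c = take n branch (List.drop s (digits (s + n) c))

valid : ∀ {s} → Family n s → ℕ → Bool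
valid {n} {s} F c = does (model? (rel F (certWord s c)) (lookup (certBranch s n c)))

valid-model : ∀ {s} (F : Family n s) c → valid F c ≡ true → Model (rel F (certWord s c)) (lookup (certBranch s n c))
valid-model {n} {s} F c = does-true (model? (rel F (certWord s c)) (lookup (certBranch s n c)))

rel-mono : ∀ {s} (F : Family n s) {c w : Word s} → c ⊑ʷ w → ∀ u v → rel F c u v ≡ true → rel F w u v ≡ true
rel-mono F {c} {w} p u v q with F u v
... | fix b = q
... | var i t = ⊑-bit (lookup c i) (lookup w i) (p i) t q

exhaust : ∀ {s} (F : Family n s) ch (certs : List ℕ) leaf → all (valid F) certs ≡ true →
  search ch (List.map (certWord s) certs) leaf ≡ true →
  ∀ w → (∀ i → lookup ch i (lookup w i) ≡ true) → (g : Gr n) → (∀ u v → e g u v ≡ rel F w u v) →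
  K24-minor g ⊎ leaf w ≡ true
exhaust {n} {s} F ch certs leaf ok p w cw g eq = [ found , inj₂ ]′ (search-sound ch (List.map (certWord s) certs) leaf p w cw)
  where
  found : (∃ λ c → c ∈ˡ List.map (certWord s) certs × c ⊑ʷ w) → K24-minor g ⊎ leaf w ≡ true
  found (c , m , c⊑) = let (x , m' , q) = ∈-map⁻ (certWord s) m in
    inj₁ (model-minor g {rel F (certWord s x)} {lookup (certBranch s n x)}
      (λ u v r → trans (eq u v) (rel-mono F {certWord s x} {w} (subst (_⊑ʷ w) q c⊑) u v r))
      (valid-model F x (all-inv (valid F) ok m')))

-- Three-hub graphs as words

hubView : Fin (3 + k) → Fin 3 ⊎ Fin k
hubView zero                = inj₁ 0F
hubView 1F          = inj₁ 1F
hubView 2F    = inj₁ 2F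
hubView (suc (suc (suc i))) = inj₂ i

-- The slots hold the labels of both path ends, then those of the interior vertices, then the edges between hubs.
slot : Fin (2 + k) → Fin (3 + k)
slot zero    = zero
slot (suc i) = if does (i ≟ last) then suc zero else suc (suc i)

hubCell : Fin 3 → Fin 3 → Cell (3 + k)
hubCell zero             1F       = var last 0F
hubCell 1F       zero             = var last 0F
hubCell zero             2F = var last 1F
hubCell 2F zero             = var last 1F
hubCell 1F       2F = var last 2F
hubCell 2F 1F       = var last 2F
hubCell _                _                = fix false

threeCell : Fin 3 ⊎ Fin (2 + k) → Fin 3 ⊎ Fin (2 + k) → Cell (3 + k)
threeCell (inj₁ a) (inj₁ b) = hubCell a b
threeCell (inj₁ a) (inj₂ j) = var (slot j) a
threeCell (inj₂ i) (inj₁ b) = var (slot i) b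
threeCell (inj₂ i) (inj₂ j) = fix (pathE i j)

Three : Family (5 + k) (3 + k)
Three u v = threeCell (hubView u) (hubView v)

label : Gr (3 + k) → Fin (3 + k) → Letter
label g v = ltr (e g 0F v) (e g 1F v) (e g 2F v)

-- Of the slots after those of the two path ends, the final one holds the edges between hubs. The
-- decision is an argument so that proofs can distinguish cases without unfolding the vector of
-- letters.
interior : Gr (5 + k) → (i : Fin (suc k)) → Dec (i ≡ last) → Letter
interior g i (yes _) = ltr (e g 0F 1F) (e g 0F 2F) (e g 1F 2F)
interior g i (no _)  = label g (3 ↑ʳ suc i)

letterAt : Gr (5 + k) → Fin (3 + k) → Letter
letterAt g zero          = label g 3F
letterAt g 1F    = label g (3 ↑ʳ last)
letterAt g (suc (suc i)) = interior g i (i ≟ last)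

some : Letter → Bool
some (ltr a b c) = a ∨ b ∨ c

two-of : Letter → Bool
two-of (ltr a b c) = (a ∧ b) ∨ (a ∧ c) ∨ (b ∧ c)

Choice : Fin (3 + k) → Letter → Bool
Choice zero          = two-of
Choice 1F    = two-of
Choice (suc (suc i)) = λ ℓ → does (i ≟ last) ∨ some ℓ

-- What minimum degree three says about path vertices: an end has one path neighbour and needs two
-- hubs, an interior vertex has two and needs one. Unlike connectivity, this is read off the labels
-- and is inherited when interior path vertices are merged.
record Fed (g : Gr (5 + k)) : Set where
  field
    first-two : two-of (label g 3F) ≡ true
    last-two  : two-of (label g (3 ↑ʳ last)) ≡ true
    all-some  : ∀ i → some (label g (3 ↑ʳ i)) ≡ true

word : Gr (5 + k) → Word (3 + k)
word g = tabulate (letterAt g)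

word-choice : (g : Gr (5 + k)) → Fed g → ∀ i → lookup (tabulate Choice) i (lookup (word g) i) ≡ true
word-choice g f i rewrite Vec.lookup∘tabulate Choice i | Vec.lookup∘tabulate (letterAt g) i = go i
  where
  open Fed f
  go : ∀ i → Choice i (letterAt g i) ≡ true
  go zero       = first-two
  go 1F = last-two
  go (suc (suc i)) with i ≟ last
  ... | yes _ = refl
  ... | no _  = all-some (suc i)

bit-label : (g : Gr (3 + k)) → ∀ a v → bit a (label g v) ≡ e g (a ↑ˡ k) v
bit-label g zero v = refl
bit-label g 1F v = refl
bit-label g 2F v = refl

word-slot : (g : Gr (5 + k)) → ∀ j → lookup (word g) (slot j) ≡ label g (3 ↑ʳ j)
word-slot g zero = refl
word-slot g (suc i) = lem i (i ≟ last) refl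
  where
  lem : ∀ i (d : Dec (i ≡ last)) → (i ≟ last) ≡ d →
    lookup (word g) (if does d then suc zero else suc (suc i)) ≡ label g (3 ↑ʳ suc i)
  lem i (yes refl) _ = refl
  lem i (no i≢) q = trans (Vec.lookup∘tabulate (letterAt g) (suc (suc i))) (cong (interior g i) q)

word-hub : (g : Gr (5 + k)) → lookup (word g) last ≡ ltr (e g 0F 1F) (e g 0F 2F) (e g 1F 2F)
word-hub {k} g = trans (Vec.lookup∘tabulate (letterAt g) (fromℕ (2 + k))) (lem (fromℕ k ≟ fromℕ k))
  where
  lem : (d : Dec (fromℕ k ≡ fromℕ k)) → interior g (fromℕ k) d ≡ ltr (e g 0F 1F) (e g 0F 2F) (e g 1F 2F)
  lem (yes _) = refl
  lem (no q) = ⊥-elim (q refl)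

word-rel : (g : Gr (5 + k)) → Std 3 g → ∀ u v → e g u v ≡ rel Three (word g) u v
word-rel {k} g s u v = go u v
  where
  hl : ∀ t → bit t (lookup (word g) last) ≡ bit t (ltr (e g 0F 1F) (e g 0F 2F) (e g 1F 2F))
  hl t = cong (bit t) (word-hub g)
  hp : ∀ (a : Fin 3) j → e g (a ↑ˡ (2 + k)) (3 ↑ʳ j) ≡ bit a (lookup (word g) (slot j))
  hp a j = sym (trans (cong (bit a) (word-slot g j)) (bit-label g a (3 ↑ʳ j)))
  go : ∀ u v → e g u v ≡ eval (word g) (threeCell (hubView u) (hubView v))
  go zero zero = irr g _
  go zero 1F = sym (hl 0F)
  go zero 2F = sym (hl 1F)
  go 1F zero = trans (sy g _ _) (sym (hl 0F))
  go 1F 1F = irr g _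
  go 1F 2F = sym (hl 2F)
  go 2F zero = trans (sy g _ _) (sym (hl 1F))
  go 2F 1F = trans (sy g _ _) (sym (hl 2F))
  go 2F 2F = irr g _
  go zero (suc (suc (suc j))) = hp 0F j
  go 1F (suc (suc (suc j))) = hp 1F j
  go 2F (suc (suc (suc j))) = hp 2F j
  go (suc (suc (suc i))) zero = trans (sy g _ _) (hp 0F i)
  go (suc (suc (suc i))) 1F = trans (sy g _ _) (hp 1F i)
  go (suc (suc (suc i))) 2F = trans (sy g _ _) (hp 2F i)
  go (suc (suc (suc i))) (suc (suc (suc j))) = s i j

-- Degrees and bad three-hub graphs

deg : (Fin n → Bool) → ℕ
deg {zero}  f = 0
deg {suc n} f = if f zero then suc (deg (f ∘ suc)) else deg (f ∘ suc)

hub : Fin 3 → Fin (3 + k)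
hub a = a ↑ˡ _

Low : Rel (3 + k) → Set
Low E = ∃ λ z → deg (E (hub z)) ≤ 2

OnlyAt : Rel (3 + k) → Fin 3 → Fin k → Set
OnlyAt E z j = ∀ i → i ≡ j ⊎ E (hub z) (3 ↑ʳ i) ≡ false

Appendable : Rel (3 + suc k) → Set
Appendable E = ∃ λ z → OnlyAt E z zero ⊎ OnlyAt E z last

Sole : Rel (3 + k) → Fin 3 → Fin k → Set
Sole E z i = ∀ a → E (hub a) (3 ↑ʳ i) ≡ does (a ≟ z)

-- Both path vertices are interior and have degree three. With three hubs and two path neighbours a
-- path vertex reaches degree five only, so the bound six lets `hub z` be recognised as a hub again
-- after the graph has been contracted and split.
Run : Rel (3 + suc k) → Set
Run E = ∃ λ z → 6 ≤ deg (E (hub z)) × ∃ λ i → i ≢ zero × Sole E z i × ∃ λ j → j ≢ last × next i j ≡ true × Sole E z j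

low? : (E : Rel (3 + k)) → Dec (Low E)
low? E = any? λ z → deg (E (hub z)) ≤? 2

onlyAt? : (E : Rel (3 + k)) → ∀ z j → Dec (OnlyAt E z j)
onlyAt? E z j = all? λ i → i ≟ j ⊎-dec E (hub z) (3 ↑ʳ i) Bool.≟ false

appendable? : (E : Rel (3 + suc k)) → Dec (Appendable E)
appendable? E = any? λ z → onlyAt? E z zero ⊎-dec onlyAt? E z last

sole? : (E : Rel (3 + k)) → ∀ z i → Dec (Sole E z i)
sole? E z i = all? λ a → E (hub a) (3 ↑ʳ i) Bool.≟ does (a ≟ z)

run? : (E : Rel (3 + suc k)) → Dec (Run E)
run? E = any? λ z → 6 ≤? deg (E (hub z)) ×-dec any? λ i → ¬? (i ≟ zero) ×-dec sole? E z i ×-dec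
  any? λ j → ¬? (j ≟ last) ×-dec next i j Bool.≟ true ×-dec sole? E z j

-- The cases in which no minor is claimed. For a 3-connected graph the first cannot occur, the
-- second leads to two hubs, and the third is contracted and left to induction.
Bad : Rel (3 + suc k) → Set
Bad E = Low E ⊎ Appendable E ⊎ Run E

bad? : (E : Rel (3 + suc k)) → Dec (Bad E)
bad? E = low? E ⊎-dec appendable? E ⊎-dec run? E

deg-cong : {f h : Fin n → Bool} → (∀ i → f i ≡ h i) → deg f ≡ deg h
deg-cong {zero} q = refl
deg-cong {suc n} {f} {h} q rewrite q zero | deg-cong {n} {f ∘ suc} {h ∘ suc} (q ∘ suc) = refl

module _ {E E' : Rel (3 + suc k)} (q : ∀ u v → E u v ≡ E' u v) where
  Low-cong : Low E → Low E'
  Low-cong (z , p) = z , subst (_≤ 2) (deg-cong (q (hub z))) p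

  OnlyAt-cong : ∀ {z j} → OnlyAt E z j → OnlyAt E' z j
  OnlyAt-cong p i = Sum.map₂ (trans (sym (q _ _))) (p i)

  App-cong : Appendable E → Appendable E'
  App-cong (z , p) = z , Sum.map OnlyAt-cong OnlyAt-cong p

  Sole-cong : ∀ {z i} → Sole E z i → Sole E' z i
  Sole-cong p a = trans (sym (q _ _)) (p a)

  Bad-cong : Bad E → Bad E'
  Bad-cong = Sum.map Low-cong (Sum.map App-cong
    λ { (z , d , i , i≢ , s , j , j≢ , n , t) → z , subst (6 ≤_) (deg-cong (q (hub z))) d , i , i≢ , Sole-cong s , j , j≢ , n , Sole-cong t })

AllBad : ∀ m → List ℕ → Set
AllBad m cs = all (valid (Three {m})) cs ≡ true ×
  search (tabulate (Choice {m})) (List.map (certWord (3 + m)) cs) (λ w → does (bad? (rel (Three {m}) w))) ≡ true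

minor-or-bad : ∀ m {cs} → AllBad m cs → (g : Gr (5 + m)) → Std 3 g → Fed g → K24-minor g ⊎ Bad (e g)
minor-or-bad m {cs} (ok , p) g s f = Sum.map₂
  (λ q → Bad-cong {E = E} (λ u v → sym (word-rel g s u v)) (does-true (bad? E) q))
  (exhaust (Three {m}) (tabulate Choice) cs (λ w → does (bad? (rel (Three {m}) w))) ok p
    (word g) (word-choice g f) g (word-rel g s))
  where E = rel (Three {m}) (word g)

-- Recognising two-hub and exceptional graphs

excG : Fin 9 → Graph
excG zero = K5
excG 1F = K33
excG 2F = GA
excG 3F = GA⁺
excG 4F = GB
excG 5F = GB⁺
excG 6F = GC
excG 7F = GC⁺
excG 8F = GD

data Res (g : Gr (4 + k)) : Set where
  path : HubPath {2 + k} 2 g → Res g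
  exc  : ∀ i → g ≃ gr (excG i) → Res g

Res-≃ : {g g' : Gr (4 + k)} → g ≃ g' → Res g' → Res g
Res-≃ {k} i (path p) = path (HubPath-≃ {2 + k} 2 i p)
Res-≃ i (exc x j) = exc x (≃-trans i j)

Bij : (Fin m → Fin n) → Set
Bij p = (∀ x y → p x ≡ p y → x ≡ y) × (∀ y → ∃ λ x → p x ≡ y)

bij? : (p : Fin m → Fin n) → Dec (Bij p)
bij? p = all? (λ x → all? λ y → p x ≟ p y →-dec x ≟ y) ×-dec all? λ y → any? λ x → p x ≟ y

bijection : {p : Fin m → Fin n} → Bij p → Permutation m n
bijection {p = p} (inj , sur) = permutation p (proj₁ ∘ sur) (λ y → proj₂ (sur y)) (λ x → inj _ _ (proj₂ (sur (p x))))

PathVia : Rel (4 + k) → (Fin (4 + k) → Fin (4 + k)) → Set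
PathVia {k} E p = (∀ i j → E (p (2 ↑ʳ i)) (p (2 ↑ʳ j)) ≡ pathE {2 + k} i j) × Bij p

ExcVia : Rel (4 + k) → (i : Fin 9) → (Fin (size (excG i)) → Fin (4 + k)) → Set
ExcVia E i p = (∀ u v → adj (excG i) u v ≡ E (p u) (p v)) × Bij p

-- A placement is a number whose last digit is 0 for a two-hub graph and otherwise names an exceptional graph;
-- the other digits, read from the right, are the images of its vertices.
placed : Rel (4 + k) → ℕ → Bool
placed {k} E c = go (c % 10) (c / 10)
  where
  go : ℕ → ℕ → Bool
  go zero c = does (all? (λ i → all? λ j → E (p (2 ↑ʳ i)) (p (2 ↑ʳ j)) Bool.≟ pathE {2 + k} i j) ×-dec bij? p)
    where p = lookup (take (4 + k) clamp (digits (4 + k) c))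
  go (suc i) c = does (all? (λ u → all? λ v → adj (excG x) u v Bool.≟ E (p u) (p v)) ×-dec bij? p)
    where
    x = clamp i
    p = lookup (take (size (excG x)) clamp (digits (size (excG x)) c))

module _ (g : Gr (4 + k)) {E : Rel (4 + k)} (eq : ∀ u v → e g u v ≡ E u v) where
  path-via : ∀ {p} → PathVia E p → Res g
  path-via (s , b) = path (relabel (bijection b) g , ≃-sym (relabel-≃ (bijection b) g) , λ i j → trans (eq _ _) (s i j))

  exc-via : ∀ {i p} → ExcVia E i p → Res g
  exc-via {i} (s , b) = exc i (≃-sym (iso (bijection b) λ u v → trans (s u v) (sym (eq _ _))))

  placed-sound : ∀ c → placed E c ≡ true → Res g
  placed-sound c q with c % 10
  ... | zero = path-via (does-true (all? (λ i → all? λ j → E (p (2 ↑ʳ i)) (p (2 ↑ʳ j)) Bool.≟ pathE {2 + k} i j) ×-dec bij? p) q)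
    where p = lookup (take (4 + k) clamp (digits (4 + k) (c / 10)))
  ... | suc i = exc-via {clamp i} (does-true (all? (λ u → all? λ v → adj (excG x) u v Bool.≟ E (p u) (p v)) ×-dec bij? p) q)
    where
    x = clamp {8} i
    p = lookup (take (size (excG x)) clamp (digits (size (excG x)) (c / 10)))

smalleaf : ∀ m → List ℕ → Word (3 + m) → Bool
smalleaf m ps w = does (low? E) ∨ does (appendable? E) ∨ any (placed {suc m} E) ps
  where E = rel (Three {m}) w

-- On short paths runs are not set aside: a word that has no certificate and is neither low nor
-- appendable has to be identified as two-hub or exceptional by a listed placement.
Small : ∀ m (cs ps : List ℕ) → Set
Small m cs ps = all (valid (Three {m})) cs ≡ true ×
  search (tabulate (Choice {m})) (List.map (certWord (3 + m)) cs) (smalleaf m ps) ≡ true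

small-three : ∀ {m cs ps} → Small m cs ps → (g : Gr (5 + m)) → Std 3 g → Fed g →
  K24-minor g ⊎ Low (e g) ⊎ Appendable (e g) ⊎ Res {suc m} g
small-three {m} {cs} {ps} (ok , p) g s f =
  [ inj₁ , inj₂ ∘ leaf ∘ ∨-inv (does (low? E)) ]′
    (exhaust (Three {m}) (tabulate Choice) cs (smalleaf m ps) ok p (word g) (word-choice g f) g (word-rel g s))
  where
  E = rel (Three {m}) (word g)
  E≡ : ∀ u v → E u v ≡ e g u v
  E≡ u v = sym (word-rel g s u v)
  rest : does (appendable? E) ≡ true ⊎ any (placed {suc m} E) ps ≡ true → Appendable (e g) ⊎ Res {suc m} g
  rest (inj₁ q) = inj₁ (App-cong {E = E} E≡ (does-true (appendable? E) q))
  rest (inj₂ q) = let (c , _ , r) = any-inv (placed {suc m} E) ps q in inj₂ (placed-sound {suc m} g (word-rel g s) c r)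
  leaf : does (low? E) ≡ true ⊎ does (appendable? E) ∨ any (placed {suc m} E) ps ≡ true →
    Low (e g) ⊎ Appendable (e g) ⊎ Res {suc m} g
  leaf (inj₁ q) = inj₁ (Low-cong {E = E} E≡ (does-true (low? E) q))
  leaf (inj₂ q) = inj₂ (rest (∨-inv (does (appendable? E)) q))

-- Vertex splittings of a fixed graph

module _ (X : Graph) (x : Fin (size X)) where
  -- Letter `y` records the ends of the split edge to which `y` is joined, bit 0 for `zero` and bit
  -- 1 for `suc x`.
  splitCell : Fin (suc (size X)) → Fin (suc (size X)) → Cell (size X)
  splitCell zero    zero    = fix false
  splitCell zero    (suc z) = if does (z ≟ x) then fix true else var z 0F
  splitCell (suc y) zero    = if does (y ≟ x) then fix true else var y 0F
  splitCell (suc y) (suc z) = if does (y ≟ x) then (if does (z ≟ x) then fix false else var z 1F)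
    else if does (z ≟ x) then var y 1F else fix (adj X y z)

  -- A neighbour of `x` goes to at least one end, a non-neighbour to none; at `y = x`, irreflexivity
  -- of `X` forces the blank letter.
  splitChoice : Fin (size X) → Letter → Bool
  splitChoice y (ltr a b c) = not c ∧ does ((a ∨ b) Bool.≟ adj X x y)

  splitLetter : Gr (suc (size X)) → (y : Fin (size X)) → Dec (y ≡ x) → Letter
  splitLetter g y (yes _) = ltr false false false
  splitLetter g y (no _)  = ltr (e g zero (suc y)) (e g (suc x) (suc y)) false

  splitWord : Gr (suc (size X)) → Word (size X)
  splitWord g = tabulate λ y → splitLetter g y (y ≟ x)

  module _ {g : Gr (suc (size X))} (s : Split g (gr X) x) where
    open Split s
    split-choice : ∀ y → lookup (tabulate splitChoice) y (lookup (splitWord g) y) ≡ true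
    split-choice y rewrite Vec.lookup∘tabulate splitChoice y | Vec.lookup∘tabulate (λ y → splitLetter g y (y ≟ x)) y
      with y ≟ x
    ... | yes refl = does-yes (_ Bool.≟ _) (sym (adj-irrefl X x))
    ... | no y≢ = does-yes (_ Bool.≟ _) (sym (merged y y≢))

    split-rel : ∀ u v → e g u v ≡ rel splitCell (splitWord g) u v
    split-rel zero zero = irr g _
    split-rel zero (suc z) = row z (z ≟ x) refl
      where
      row : ∀ z (d : Dec (z ≡ x)) → (z ≟ x) ≡ d → e g zero (suc z) ≡ eval (splitWord g) (if does d then fix true else var z 0F)
      row z (yes refl) _ = joined
      row z (no _) q = sym (trans (cong (bit 0F) (Vec.lookup∘tabulate (λ y → splitLetter g y (y ≟ x)) z))
        (cong (bit 0F ∘ splitLetter g z) q))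
    split-rel (suc y) zero = trans (sy g _ _) (split-rel zero (suc y))
    split-rel (suc y) (suc z) = go y z (y ≟ x) (z ≟ x) refl refl
      where
      at : ∀ z d → (z ≟ x) ≡ d → lookup (splitWord g) z ≡ splitLetter g z d
      at z d q = trans (Vec.lookup∘tabulate (λ y → splitLetter g y (y ≟ x)) z) (cong (splitLetter g z) q)
      go : ∀ y z (d : Dec (y ≡ x)) (d' : Dec (z ≡ x)) → (y ≟ x) ≡ d → (z ≟ x) ≡ d' → e g (suc y) (suc z) ≡ eval (splitWord g)
        (if does d then (if does d' then fix false else var z 1F) else if does d' then var y 1F else fix (adj X y z))
      go y z (yes refl) (yes refl) _ _ = irr g _
      go y z (yes refl) (no z≢) _ q = sym (cong (bit 1F) (at z (no z≢) q))
      go y z (no y≢) (yes refl) q _ = trans (sy g _ _) (sym (cong (bit 1F) (at y (no y≢) q)))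
      go y z (no y≢) (no z≢) _ _ = others y z y≢ z≢

-- Splittings that leave an end of the split edge with at most two neighbours are set aside, because
-- they are not 3-connected.
splitLeaf : ∀ m (X : Graph) → size X ≡ 3 + m → Fin (size X) → List ℕ → Rel (suc (size X)) → Bool
splitLeaf m X refl x ps E = does (deg (E zero) ≤? 2) ∨ does (deg (E (suc x)) ≤? 2) ∨ any (placed {m} E) ps

SplitCheck : ∀ m (X : Graph) → size X ≡ 3 + m → Vec (List ℕ × List ℕ) (size X) → Set
SplitCheck m X q d = ∀ x → all (valid (splitCell X x)) (proj₁ (lookup d x)) ≡ true ×
  search (tabulate (splitChoice X x)) (List.map (certWord (size X)) (proj₁ (lookup d x)))
    (λ w → splitLeaf m X q x (proj₂ (lookup d x)) (rel (splitCell X x) w)) ≡ true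

split-outcome : ∀ {m} (X : Graph) (q : size X ≡ 3 + m) {d} → SplitCheck m X q d →
  (g : Gr (4 + m)) (x : Fin (3 + m)) → Split g (subst Gr q (gr X)) x →
  K24-minor g ⊎ deg (e g zero) ≤ 2 ⊎ deg (e g (suc x)) ≤ 2 ⊎ Res {m} g
split-outcome {m} X refl {d} ch g x s = [ inj₁ , inj₂ ∘ leaf ∘ ∨-inv (does (deg (E zero) ≤? 2)) ]′
    (exhaust (splitCell X x) (tabulate (splitChoice X x)) (proj₁ (lookup d x))
      (λ w → splitLeaf m X refl x (proj₂ (lookup d x)) (rel (splitCell X x) w)) (proj₁ (ch x)) (proj₂ (ch x))
      (splitWord X x g) (split-choice X x s) g (split-rel X x s))
  where
  ps = proj₂ (lookup d x)
  E = rel (splitCell X x) (splitWord X x g)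
  deg≡ : ∀ u → deg (E u) ≤ 2 → deg (e g u) ≤ 2
  deg≡ u = subst (_≤ 2) (deg-cong λ v → sym (split-rel X x s u v))
  rest : does (deg (E (suc x)) ≤? 2) ≡ true ⊎ any (placed {m} E) ps ≡ true → deg (e g (suc x)) ≤ 2 ⊎ Res {m} g
  rest (inj₁ q) = inj₁ (deg≡ (suc x) (does-true (deg (E (suc x)) ≤? 2) q))
  rest (inj₂ q) = let (c , _ , r) = any-inv (placed {m} E) ps q in inj₂ (placed-sound {m} g (split-rel X x s) c r)
  leaf : does (deg (E zero) ≤? 2) ≡ true ⊎ does (deg (E (suc x)) ≤? 2) ∨ any (placed {m} E) ps ≡ true →
    deg (e g zero) ≤ 2 ⊎ deg (e g (suc x)) ≤ 2 ⊎ Res {m} g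
  leaf (inj₁ q) = inj₁ (deg≡ zero (does-true (deg (E zero) ≤? 2) q))
  leaf (inj₂ q) = inj₂ (rest (∨-inv (does (deg (E (suc x)) ≤? 2)) q))

-- Counting neighbours; minimum degree three

_∖_ : (Fin n → Bool) → Fin n → Fin n → Bool
(f ∖ a) i = f i ∧ not (does (i ≟ a))

deg-∖ : (f : Fin n → Bool) (a : Fin n) → deg f ≡ (if f a then suc (deg (f ∖ a)) else deg (f ∖ a))
deg-∖ {suc n} f zero rewrite Bool.∧-zeroʳ (f zero)
  | deg-cong {n} {(f ∖ zero) ∘ suc} {f ∘ suc} (λ i → Bool.∧-identityʳ (f (suc i))) = refl
deg-∖ {suc n} f (suc a) rewrite Bool.∧-identityʳ (f zero) | deg-∖ (f ∘ suc) a
  | deg-cong {n} {(f ∘ suc) ∖ a} {(f ∖ suc a) ∘ suc} (λ i → refl) with f zero | f (suc a)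
... | true  | true  = refl
... | true  | false = refl
... | false | true  = refl
... | false | false = refl

deg-true : (f : Fin n → Bool) {a : Fin n} → f a ≡ true → deg f ≡ suc (deg (f ∖ a))
deg-true f {a} p = trans (deg-∖ f a) (cong (if_then suc (deg (f ∖ a)) else deg (f ∖ a)) p)

∖-true : (f : Fin n → Bool) {a i : Fin n} → f i ≡ true → i ≢ a → (f ∖ a) i ≡ true
∖-true f {a} {i} p i≢ with i ≟ a
... | yes q = ⊥-elim (i≢ q)
... | no _ rewrite p = refl

∖-inv : (f : Fin n → Bool) {a i : Fin n} → (f ∖ a) i ≡ true → f i ≡ true × i ≢ a
∖-inv f {a} {i} p with f i | i ≟ a
... | true | no i≢ = refl , i≢

deg-none : (f : Fin n → Bool) → (∀ i → f i ≡ true → ⊥) → deg f ≡ 0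
deg-none {zero} f q = refl
deg-none {suc n} f q rewrite Bool.¬-not (q zero) = deg-none (f ∘ suc) (q ∘ suc)

deg-upper : (xs : List (Fin n)) (f : Fin n → Bool) → (∀ i → f i ≡ true → i ∈ˡ xs) → deg f ≤ List.length xs
deg-upper [] f q = ℕ.≤-reflexive (deg-none f λ i p → case q i p of λ ())
deg-upper (x ∷ xs) f q = ℕ.≤-trans (step≤ (f x) refl) (s≤s (deg-upper xs (f ∖ x) rest))
  where
  rest : ∀ i → (f ∖ x) i ≡ true → i ∈ˡ xs
  rest i p with ∖-inv f p
  ... | r , i≢ with q i r
  ... | (here refl) = ⊥-elim (i≢ refl)
  ... | there m = m
  step≤ : ∀ b → f x ≡ b → deg f ≤ suc (deg (f ∖ x))
  step≤ true  p = ℕ.≤-reflexive (deg-true f p)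
  step≤ false p = ℕ.≤-trans (ℕ.≤-reflexive (trans (deg-∖ f x) (cong (if_then suc (deg (f ∖ x)) else deg (f ∖ x)) p))) (ℕ.n≤1+n _)

four≤deg : (f : Fin n → Bool) {a b c d : Fin n} → f a ≡ true → f b ≡ true → f c ≡ true → f d ≡ true →
  b ≢ a → c ≢ a → d ≢ a → c ≢ b → d ≢ b → d ≢ c → 4 ≤ deg f
four≤deg f {a} {b} {c} {d} fa fb fc fd ba ca da cb db dc
  rewrite deg-true f fa
  | deg-true (f ∖ a) (∖-true f fb ba)
  | deg-true ((f ∖ a) ∖ b) (∖-true (f ∖ a) (∖-true f fc ca) cb)
  | deg-true (((f ∖ a) ∖ b) ∖ c) (∖-true ((f ∖ a) ∖ b) (∖-true (f ∖ a) (∖-true f fd da) db) dc) = s≤s (s≤s (s≤s (s≤s z≤n)))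

deg≤2 : (f : Fin (suc n) → Bool) → deg f ≤ 2 → ∃ λ s → ∃ λ t → ∀ i → f i ≡ true → i ≡ s ⊎ i ≡ t
deg≤2 f q with any? (λ i → f i Bool.≟ true)
... | no ¬p = zero , zero , λ i r → ⊥-elim (¬p (i , r))
... | yes (s , fs) with any? (λ i → (f ∖ s) i Bool.≟ true)
... | no ¬p = s , s , λ i r → case i ≟ s of λ { (yes p) → inj₁ p ; (no i≢) → ⊥-elim (¬p (i , ∖-true f r i≢)) }
... | yes (t , ft) = s , t , only
  where
  only : ∀ i → f i ≡ true → i ≡ s ⊎ i ≡ t
  only i r with i ≟ s | i ≟ t
  ... | yes p | _ = inj₁ p
  ... | no _ | yes p = inj₂ p
  ... | no i≢s | no i≢t = ⊥-elim (ℕ.<⇒≱ (s≤s (s≤s (s≤s (z≤n {deg (((f ∖ s) ∖ t) ∖ i)}))))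
    (subst (_≤ 2) (trans (deg-true f fs) (cong suc (trans (deg-true (f ∖ s) ft)
      (cong suc (deg-true ((f ∖ s) ∖ t) (∖-true (f ∖ s) (∖-true f r i≢s) i≢t)))))) q))

fresh : (a b c : Fin (4 + n)) → ∃ λ w → w ≢ a × w ≢ b × w ≢ c
fresh a b c with any? (λ w → ¬? (w ≟ a) ×-dec ¬? (w ≟ b) ×-dec ¬? (w ≟ c))
... | yes p = p
... | no ¬p = ⊥-elim (ℕ.<⇒≱ (ℕ.≤-refl {4}) (ℕ.≤-trans (s≤s (s≤s (s≤s (s≤s z≤n)))) (deg-upper (a ∷ b ∷ c ∷ []) (λ _ → true) λ i _ → into i)))
  where
  into : ∀ i → i ∈ˡ (a ∷ b ∷ c ∷ [])
  into i with i ≟ a | i ≟ b | i ≟ c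
  ... | yes refl | _ | _ = (here refl)
  ... | no _ | yes refl | _ = there (here refl)
  ... | no _ | no _ | yes refl = there (there (here refl))
  ... | no p | no q | no r = ⊥-elim (¬p (i , p , q , r))

module _ {g : Gr (4 + n)} (c : Conn3 g) where
  private
    distinct : ∀ v s t → v ≢ s → v ≢ t → (∀ i → e g v i ≡ true → i ≡ s ⊎ i ≡ t) → ⊥
    distinct v s t v≢s v≢t only with fresh v s t
    ... | w , w≢v , w≢s , w≢t with c s t (λ u → does (u ≟ v)) v w (does-yes (v ≟ v) refl) (does-no (w ≟ v) w≢v) [ v≢s , v≢t ]′ [ w≢s , w≢t ]′
    ... | a , b , Aa , Ab , a∉ , b∉ , ab with a ≟ v
    ... | yes refl = b∉ (only b ab)

  -- Otherwise `s` and `t` separate `v` from a further vertex. If one of them is `v` itself, it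
  -- accounts for no neighbour and is replaced by some other vertex.
  not-two-neighbours : ∀ v s t → (∀ i → e g v i ≡ true → i ≡ s ⊎ i ≡ t) → ⊥
  not-two-neighbours v s t only with fresh v v v | v ≟ s | v ≟ t
  ... | _ | no v≢s | no v≢t = distinct v s t v≢s v≢t only
  ... | w , w≢v , _ | yes refl | yes refl = distinct v w w (w≢v ∘ sym) (w≢v ∘ sym) λ i p → case only i p of λ
    { (inj₁ refl) → ⊥-elim (edge≢ g p refl) ; (inj₂ refl) → ⊥-elim (edge≢ g p refl) }
  ... | w , w≢v , _ | yes refl | no v≢t = distinct v w t (w≢v ∘ sym) v≢t λ i p → case only i p of λ
    { (inj₁ refl) → ⊥-elim (edge≢ g p refl) ; (inj₂ q) → inj₂ q }
  ... | w , w≢v , _ | no v≢s | yes refl = distinct v s w v≢s (w≢v ∘ sym) λ i p → case only i p of λ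
    { (inj₂ refl) → ⊥-elim (edge≢ g p refl) ; (inj₁ q) → inj₁ q }

  min-deg : ∀ v → deg (e g v) ≤ 2 → ⊥
  min-deg v q = let (s , t , only) = deg≤2 (e g v) q in not-two-neighbours v s t only

-- Three-hub graphs that are 3-connected

previous : (i : Fin (suc k)) → i ≢ zero → ∃ λ j → next j i ≡ true
previous zero q = ⊥-elim (q refl)
previous {suc k} 1F q = zero , refl
previous {suc k} (suc (suc i)) q = let (j , p) = previous (suc i) λ () in suc j , p

following : (i : Fin (suc k)) → i ≢ last → ∃ λ j → next i j ≡ true
following {zero}  zero    q = ⊥-elim (q refl)
following {suc k} zero    q = suc zero , refl
following {suc k} (suc i) q = let (j , p) = following i (q ∘ cong suc) in suc j , p

path-neighbours : (i : Fin (suc k)) → ∃ λ s → ∃ λ t → ∀ j → pathE i j ≡ true → j ≡ s ⊎ j ≡ t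
path-neighbours {k} i = proj₁ fol , proj₁ prv , λ j p → Sum.map (proj₂ fol j) (proj₂ prv j) (∨-inv (next i j) p)
  where
  fol : ∃ λ s → ∀ j → next i j ≡ true → j ≡ s
  fol with any? (λ j → next i j Bool.≟ true)
  ... | yes (s , p) = s , λ j q → next-functional i j s q p
  ... | no ¬p = i , λ j q → ⊥-elim (¬p (j , q))
  prv : ∃ λ s → ∀ j → next j i ≡ true → j ≡ s
  prv with any? (λ j → next j i Bool.≟ true)
  ... | yes (s , p) = s , λ j q → next-injective i j s q p
  ... | no ¬p = i , λ j q → ⊥-elim (¬p (j , q))

first-neighbour : ∀ j → pathE {2 + k} zero j ≡ true → j ≡ suc zero
first-neighbour 1F p = refl

last-neighbour : ∀ j → pathE {2 + k} last j ≡ true → j ≡ inject₁ last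
last-neighbour {k} j p with ∨-inv (next (fromℕ (suc k)) j) p
... | inj₁ q = ⊥-elim (t≢f q (next-last j))
... | inj₂ q = next-injective (fromℕ (suc k)) j (inject₁ last) q (trans (next-to-last (fromℕ k)) (does-yes (fromℕ k ≟ fromℕ k) refl))

at-most-one : ∀ ℓ → two-of ℓ ≡ false → ∃ λ z → ∀ a → bit a ℓ ≡ true → a ≡ z
at-most-one (ltr true false false) q = 0F , λ { zero _ → refl ; 1F () ; 2F () }
at-most-one (ltr false true false) q = 1F , λ { zero () ; 1F _ → refl ; 2F () }
at-most-one (ltr false false true) q = 2F , λ { zero () ; 1F () ; 2F _ → refl }
at-most-one (ltr false false false) q = 2F , λ { zero () ; 1F () ; 2F _ → refl }

none-of : ∀ ℓ → some ℓ ≡ false → ∀ a → bit a ℓ ≡ true → ⊥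
none-of (ltr false false false) q zero ()
none-of (ltr false false false) q 1F ()
none-of (ltr false false false) q 2F ()

data HubOrPath {k} : Fin (3 + k) → Set where
  is-hub  : ∀ a → HubOrPath (hub a)
  is-path : ∀ i → HubOrPath (3 ↑ʳ i)

hub-or-path : (v : Fin (3 + k)) → HubOrPath v
hub-or-path zero                = is-hub 0F
hub-or-path 1F          = is-hub 1F
hub-or-path 2F    = is-hub 2F
hub-or-path (suc (suc (suc i))) = is-path i

bit-edge : (g : Gr (3 + k)) → ∀ a v → e g v (hub a) ≡ true → bit a (label g v) ≡ true
bit-edge g a v p = trans (bit-label g a v) (esym g p)

module _ (g : Gr (5 + k)) (s : Std 3 g) (c : Conn3 g) where
  private
    end : ∀ i t → (∀ j → pathE i j ≡ true → j ≡ t) → two-of (label g (3 ↑ʳ i)) ≡ true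
    end i t only with two-of (label g (3 ↑ʳ i)) in eq
    ... | true = refl
    ... | false with at-most-one (label g (3 ↑ʳ i)) eq
    ... | z , q = ⊥-elim (not-two-neighbours {g = g} c (3 ↑ʳ i) (hub z) (3 ↑ʳ t) λ v p → nb v p (hub-or-path v))
      where
      nb : ∀ v → e g (3 ↑ʳ i) v ≡ true → HubOrPath v → v ≡ hub z ⊎ v ≡ 3 ↑ʳ t
      nb v p (is-hub a) = inj₁ (cong hub (q a (bit-edge g a (3 ↑ʳ i) p)))
      nb v p (is-path j) = inj₂ (cong (3 ↑ʳ_) (only j (trans (sym (s i j)) p)))

  fed : Fed g
  fed = record
    { first-two = end zero 1F first-neighbour
    ; last-two = end last (inject₁ last) last-neighbour
    ; all-some = λ i → Bool.¬-not λ q → let (a , b , ab) = path-neighbours i in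
        not-two-neighbours {g = g} c (3 ↑ʳ i) (3 ↑ʳ a) (3 ↑ʳ b) λ v p → nb i q ab v p (hub-or-path v) }
    where
    nb : ∀ i → some (label g (3 ↑ʳ i)) ≡ false → ∀ {a b} → (∀ j → pathE i j ≡ true → j ≡ a ⊎ j ≡ b) →
      ∀ v → e g (3 ↑ʳ i) v ≡ true → HubOrPath v → v ≡ 3 ↑ʳ a ⊎ v ≡ 3 ↑ʳ b
    nb i q ab v p (is-hub x) = ⊥-elim (none-of (label g (3 ↑ʳ i)) q x (bit-edge g x (3 ↑ʳ i) p))
    nb i q ab v p (is-path j) = Sum.map (cong (3 ↑ʳ_)) (cong (3 ↑ʳ_)) (ab j (trans (sym (s i j)) p))

  not-low : ¬ Low (e g)
  not-low (z , q) = min-deg {g = g} c (hub z) q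

  private
    two-hubs : ∀ z → ∃ λ a → ∃ λ b → ∀ (x : Fin 3) → x ≡ z ⊎ x ≡ a ⊎ x ≡ b
    two-hubs zero = 1F , 2F , λ { zero → inj₁ refl ; 1F → inj₂ (inj₁ refl) ; 2F → inj₂ (inj₂ refl) }
    two-hubs 1F = 0F , 2F , λ { zero → inj₂ (inj₁ refl) ; 1F → inj₁ refl ; 2F → inj₂ (inj₂ refl) }
    two-hubs 2F = 0F , 1F , λ { zero → inj₂ (inj₁ refl) ; 1F → inj₂ (inj₂ refl) ; 2F → inj₁ refl }

  hub-meets-path : ∀ z → (∀ i → e g (hub z) (3 ↑ʳ i) ≡ false) → ⊥
  hub-meets-path z q with two-hubs z
  ... | a , b , all = not-two-neighbours {g = g} c (hub z) (hub a) (hub b) λ v p → nb v p (hub-or-path v)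
    where
    nb : ∀ v → e g (hub z) v ≡ true → HubOrPath v → v ≡ hub a ⊎ v ≡ hub b
    nb v p (is-path i) = ⊥-elim (t≢f p (q i))
    nb v p (is-hub x) with all x
    ... | inj₁ refl = ⊥-elim (edge≢ g p refl)
    ... | inj₂ (inj₁ refl) = inj₁ refl
    ... | inj₂ (inj₂ refl) = inj₂ refl

  private
    first : ∀ z → Gr (5 + k)
    first z = relabel (Perm.transpose zero (hub z)) g
    first≃ : ∀ z → g ≃ first z
    first≃ z = ≃-sym (relabel-≃ (Perm.transpose zero (hub z)) g)
    first-std : ∀ z → Std 3 (first z)
    first-std zero i j = s i j
    first-std 1F i j = s i j
    first-std 2F i j = s i j
    first-row : ∀ z i → e (first z) zero (3 ↑ʳ i) ≡ e g (hub z) (3 ↑ʳ i)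
    first-row zero i = refl
    first-row 1F i = refl
    first-row 2F i = refl
    hit : ∀ z j → OnlyAt (e g) z j → e g (hub z) (3 ↑ʳ j) ≡ true
    hit z j q = Bool.¬-not λ f → hub-meets-path z λ i → case q i of λ { (inj₁ refl) → f ; (inj₂ r) → r }

  -- `OnlyAt` also admits a hub with no path neighbour at all, but such a hub would have only the
  -- two other hubs as neighbours. The hub is exchanged with the first one before it joins the path.
  append : Appendable (e g) → HubPath {3 + k} 2 g
  append (z , inj₁ q) = HubPath-≃ {3 + k} 2 (first≃ z) (append-first (first z) (first-std z)
    (trans (first-row z zero) (hit z zero q))
    λ i → trans (first-row z (suc i)) (case q (suc i) of λ { (inj₁ ()) ; (inj₂ r) → r }))
  append (z , inj₂ q) = HubPath-≃ {3 + k} 2 (first≃ z) (append-last (first z) (first-std z)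
    (trans (first-row z last) (hit z last q))
    λ i i≢ → trans (first-row z i) (case q i of λ { (inj₁ p) → ⊥-elim (i≢ p) ; (inj₂ r) → r }))

-- Contraction of an edge of the path

≟-comm : (x y : Fin n) → does (x ≟ y) ≡ does (y ≟ x)
≟-comm x y with x ≟ y
... | yes p = sym (does-yes (y ≟ x) (sym p))
... | no p = sym (does-no (y ≟ x) (p ∘ sym))

-- The vertex r is merged into the vertex x of the remaining ones.
squash : Gr (suc n) → Fin (suc n) → Fin n → Gr n
squash g r x = record
  { e = λ y z → not (does (y ≟ z)) ∧
      (e g (punchIn r y) (punchIn r z) ∨ (does (y ≟ x) ∧ e g r (punchIn r z)) ∨ (does (z ≟ x) ∧ e g (punchIn r y) r))
  ; sy = λ y z → cong₂ _∧_ (cong not (≟-comm y z)) (cong₂ _∨_ (sy g _ _)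
      (trans (Bool.∨-comm (does (y ≟ x) ∧ e g r (punchIn r z)) _)
        (cong₂ _∨_ (cong (does (z ≟ x) ∧_) (sy g _ _)) (cong (does (y ≟ x) ∧_) (sy g _ _)))))
  ; irr = λ y → cut (does-yes (y ≟ y) refl) }
  where
  cut : ∀ {b c} → b ≡ true → not b ∧ c ≡ false
  cut refl = refl

module _ (g : Gr (suc n)) (r : Fin (suc n)) (x : Fin n) where
  squash-off : ∀ y z → y ≢ x → z ≢ x → e (squash g r x) y z ≡ e g (punchIn r y) (punchIn r z)
  squash-off y z y≢ z≢ rewrite does-no (y ≟ x) y≢ | does-no (z ≟ x) z≢ | Bool.∨-identityʳ (e g (punchIn r y) (punchIn r z))
    with y ≟ z
  ... | yes refl = sym (irr g _)
  ... | no _ = refl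

  squash-at : ∀ y → y ≢ x → e (squash g r x) y x ≡ e g (punchIn r y) (punchIn r x) ∨ e g (punchIn r y) r
  squash-at y y≢ rewrite does-no (y ≟ x) y≢ | does-yes (x ≟ x) refl = refl

  absorb : Fin (suc n) → Fin n
  absorb v with r ≟ v
  ... | yes _ = x
  ... | no q = punchOut q

  absorb-r : absorb r ≡ x
  absorb-r with r ≟ r
  ... | yes _ = refl
  ... | no q = ⊥-elim (q refl)

  absorb-in : ∀ y → absorb (punchIn r y) ≡ y
  absorb-in y with r ≟ punchIn r y
  ... | yes q = ⊥-elim (punchInᵢ≢i r y (sym q))
  ... | no q = punchIn-injective r _ _ (punchIn-punchOut q)

  squash-↠ : e g r (punchIn r x) ≡ true → g ↠ squash g r x
  squash-↠ rx = record { f = absorb ; onto = λ y → punchIn r y , absorb-in y ; fibre = fib ; lift = lft }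
    where
    fib : ∀ u v → absorb u ≡ absorb v → Walk ⟪ g ⟫ (λ w → absorb w ≡ absorb u) u v
    fib u v q with punchView r u | punchView r v
    ... | new | new = here refl
    ... | new | old y = step refl (subst (λ z → e g r (punchIn r z) ≡ true) (trans (sym absorb-r) (trans q (absorb-in y))) rx) (here (sym q))
    ... | old y | new = step refl (esym g (subst (λ z → e g r (punchIn r z) ≡ true) (trans (sym absorb-r) (trans (sym q) (absorb-in y))) rx)) (here (sym q))
    ... | old y | old z with trans (sym (absorb-in y)) (trans q (absorb-in z))
    ... | refl = here refl
    lft : ∀ y z → e (squash g r x) y z ≡ true → ∃ λ u → ∃ λ v → absorb u ≡ y × absorb v ≡ z × e g u v ≡ true
    lft y z p with ∨-inv (e g (punchIn r y) (punchIn r z)) (proj₂ (∧-inv (not (does (y ≟ z))) p))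
    ... | inj₁ q = punchIn r y , punchIn r z , absorb-in y , absorb-in z , q
    ... | inj₂ q with ∨-inv (does (y ≟ x) ∧ e g r (punchIn r z)) q
    ... | inj₁ q' = let (a , b) = ∧-inv (does (y ≟ x)) q' in r , punchIn r z , trans absorb-r (sym (does-true (y ≟ x) a)) , absorb-in z , b
    ... | inj₂ q' = let (a , b) = ∧-inv (does (z ≟ x)) q' in punchIn r y , r , absorb-in y , trans absorb-r (sym (does-true (z ≟ x) a)) , b

-- Degrees, labels and runs under a merge

ι : Bool → ℕ
ι true  = 1
ι false = 0

deg-punchIn : (f : Fin (suc n) → Bool) (r : Fin (suc n)) → deg f ≡ ι (f r) + deg (f ∘ punchIn r)
deg-punchIn f zero with f zero
... | true = refl
... | false = refl
deg-punchIn {suc n} f (suc r) with f zero | deg-punchIn (f ∘ suc) r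
... | true | q = trans (cong suc q) (sym (ℕ.+-suc (ι (f (suc r))) _))
... | false | q = q

deg-ι : (f : Fin n → Bool) (a : Fin n) → deg f ≡ ι (f a) + deg (f ∖ a)
deg-ι f a with f a | deg-∖ f a
... | true | q = q
... | false | q = q

ins-self : (p : Fin k) → ins p p ≡ suc p
ins-self zero = refl
ins-self (suc p) = cong suc (ins-self p)

ins-zero : (p : Fin (suc k)) → p ≢ zero → ins p zero ≡ zero
ins-zero zero q = ⊥-elim (q refl)
ins-zero (suc p) q = refl

ins-last : (p : Fin (suc k)) → ins p last ≡ last
ins-last {zero} zero = refl
ins-last {suc k} zero = refl
ins-last {suc k} (suc p) = cong suc (ins-last p)

hub≢path : ∀ {a} {i : Fin k} → hub a ≢ 3 ↑ʳ i
hub≢path {a = zero} ()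
hub≢path {a = suc zero} ()
hub≢path {a = suc 1F} ()

3↑-inj : ∀ {i j : Fin k} → 3 ↑ʳ i ≡ 3 ↑ʳ j → i ≡ j
3↑-inj refl = refl

punchIn-hub : ∀ (i : Fin (suc k)) a → punchIn (3 ↑ʳ i) (hub a) ≡ hub a
punchIn-hub i zero = refl
punchIn-hub i 1F = refl
punchIn-hub i 2F = refl

∨-split : ∀ a b {c} → a ∨ b ≡ c → c ≡ false → a ≡ false × b ≡ false
∨-split false b p refl = refl , p
∨-split true  b refl ()

some-elim : ∀ ℓ → some ℓ ≡ true → ∃ λ a → bit a ℓ ≡ true
some-elim (ltr true b c) q = 0F , refl
some-elim (ltr false true c) q = 1F , refl
some-elim (ltr false false true) q = 2F , refl

some-bit : ∀ ℓ z → some ℓ ≡ true → (∀ a → a ≢ z → bit a ℓ ≡ false) → bit z ℓ ≡ true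
some-bit ℓ z q f with some-elim ℓ q
... | a , p with a ≟ z
... | yes refl = p
... | no a≢ = ⊥-elim (t≢f p (f a a≢))

some-intro : ∀ ℓ a → bit a ℓ ≡ true → some ℓ ≡ true
some-intro (ltr true b c) zero refl = refl
some-intro (ltr a true c) 1F refl = Bool.∨-zeroʳ a
some-intro (ltr a b true) 2F refl = ∨-r a (Bool.∨-zeroʳ b)

two-of-pick : ∀ ℓ → two-of ℓ ≡ true → ∀ {a b} → a ≢ b → bit a ℓ ≡ true ⊎ bit b ℓ ≡ true
two-of-pick ℓ q {a} {b} a≢b with bit a ℓ in p | bit b ℓ in r
... | true | _ = inj₁ refl
... | false | true = inj₂ refl
... | false | false = ⊥-elim (go ℓ a b q a≢b p r)
  where
  go : ∀ ℓ a b → two-of ℓ ≡ true → a ≢ b → bit a ℓ ≡ false → bit b ℓ ≡ false → ⊥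
  go ℓ zero zero q n p r = n refl
  go ℓ 1F 1F q n p r = n refl
  go ℓ 2F 2F q n p r = n refl
  go (ltr false false c) zero 1F () n p r
  go (ltr false false c) 1F zero () n p r
  go (ltr false true false) zero 2F () n p r
  go (ltr false false false) zero 2F () n p r
  go (ltr false true false) 2F zero () n p r
  go (ltr false false false) 2F zero () n p r
  go (ltr true false false) 1F 2F () n p r
  go (ltr false false false) 1F 2F () n p r
  go (ltr true false false) 2F 1F () n p r
  go (ltr false false false) 2F 1F () n p r

-- What is carried along when a path is shortened: conditions on labels, degrees and runs, each of
-- which can be followed through a merge.
record Good (g : Gr (5 + k)) : Set where
  field
    std     : Std 3 g
    isFed   : Fed g
    not-bad : ¬ Bad (e g)

module _ {g : Gr (6 + k)} (good : Good {suc k} g) (p : Fin (2 + k)) (p≢0 : p ≢ zero) (p≢l : p ≢ last)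
  (loose : ∀ z → e g (hub z) (3 ↑ʳ inject₁ p) ≡ true → e g (hub z) (3 ↑ʳ suc p) ≡ true → 4 ≤ deg (e g (hub z))) where
  open Good good
  open Fed isFed
  private
    -- The merged vertices have positions `inject₁ p` and `suc p` on the path: `punchIn r x` is
    -- `3 ↑ʳ suc p` by `ins-self`. The bounds on `p` make both of them interior.
    r = 3 ↑ʳ inject₁ p
    x = 3 ↑ʳ p
    M : Gr (5 + k)
    M = squash g r x

    row : ∀ a i → i ≢ p → e M (hub a) (3 ↑ʳ i) ≡ e g (hub a) (3 ↑ʳ ins p i)
    row a i i≢ = trans (squash-off g r x (hub a) (3 ↑ʳ i) hub≢path (i≢ ∘ 3↑-inj)) (cong (λ u → e g u (3 ↑ʳ ins p i)) (punchIn-hub (inject₁ p) a))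

    row-p : ∀ a → e M (hub a) x ≡ e g (hub a) (3 ↑ʳ ins p p) ∨ e g (hub a) r
    row-p a = trans (squash-at g r x (hub a) hub≢path) (cong (λ u → e g u (3 ↑ʳ ins p p) ∨ e g u r) (punchIn-hub (inject₁ p) a))

    col-p : ∀ i → i ≢ p → e M (3 ↑ʳ i) x ≡ pathE i p
    col-p i i≢ = trans (squash-at g r x (3 ↑ʳ i) (i≢ ∘ 3↑-inj)) (trans (cong₂ _∨_ (std (ins p i) (ins p p)) (std (ins p i) (inject₁ p)))
      (trans (cong₂ _∨_ (cong₂ _∨_ (next-ins-to p i i≢) (next-ins-from p i))
        (cong₂ _∨_ (next-new-to p i) (trans (next-new-from p i) (does-no (i ≟ p) i≢))))
        (trans (cong (next p i ∨_) (Bool.∨-identityʳ (next i p))) (Bool.∨-comm (next p i) (next i p)))))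

    std-M : Std 3 M
    std-M i j = go (i ≟ p) (j ≟ p)
      where
      go : Dec (i ≡ p) → Dec (j ≡ p) → e M (3 ↑ʳ i) (3 ↑ʳ j) ≡ pathE i j
      go (no i≢) (no j≢) = trans (squash-off g r x (3 ↑ʳ i) (3 ↑ʳ j) (i≢ ∘ 3↑-inj) (j≢ ∘ 3↑-inj))
        (trans (std (ins p i) (ins p j)) (cong₂ _∨_ (next-ins p i j i≢ j≢) (next-ins p j i j≢ i≢)))
      go (yes refl) (yes refl) = trans (irr M x) (sym (cong₂ _∨_ (next-irr p) (next-irr p)))
      go (no i≢) (yes refl) = col-p i i≢
      go (yes refl) (no j≢) = trans (sy M x (3 ↑ʳ j)) (trans (col-p j j≢) (pathE-sym j p))

    label-off : ∀ i → i ≢ p → label M (3 ↑ʳ i) ≡ label g (3 ↑ʳ ins p i)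
    label-off i i≢ rewrite row 0F i i≢ | row 1F i i≢ | row 2F i i≢ = refl

    fed-M : Fed M
    fed-M = record
      { first-two = trans (cong two-of (trans (label-off zero (p≢0 ∘ sym)) (cong (λ i → label g (3 ↑ʳ i)) (ins-zero p p≢0)))) first-two
      ; last-two = trans (cong two-of (trans (label-off last (p≢l ∘ sym)) (cong (λ i → label g (3 ↑ʳ i)) (ins-last p)))) last-two
      ; all-some = λ i → case i ≟ p of λ
        { (no i≢) → trans (cong some (label-off i i≢)) (all-some (ins p i))
        ; (yes refl) → let (a , q) = some-elim (label g (3 ↑ʳ ins p p)) (all-some (ins p p)) in
            some-intro (label M x) a (trans (bit-label M a x) (trans (row-p a)
              (cong (_∨ e g (hub a) r) (trans (sym (bit-label g a (3 ↑ʳ ins p p))) q)))) } }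

    degrees : ∀ z → ∃ λ d → deg (e M (hub z)) ≡ ι (e g (hub z) (3 ↑ʳ ins p p) ∨ e g (hub z) r) + d
      × deg (e g (hub z)) ≡ ι (e g (hub z) r) + (ι (e g (hub z) (3 ↑ʳ ins p p)) + d)
    degrees z = deg (e M (hub z) ∖ x) , trans (deg-ι (e M (hub z)) x) (cong (λ b → ι b + deg (e M (hub z) ∖ x)) (row-p z))
      , trans (deg-punchIn (e g (hub z)) r) (cong (ι (e g (hub z) r) +_) (trans (deg-ι (e g (hub z) ∘ punchIn r) x)
          (cong (ι (e g (hub z) (3 ↑ʳ ins p p)) +_) (deg-cong same))))
      where
      same : ∀ y → ((e g (hub z) ∘ punchIn r) ∖ x) y ≡ (e M (hub z) ∖ x) y
      same y = go (y ≟ x)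
        where
        h' = e g (hub z) (punchIn r y)
        m' = e M (hub z) y
        go : (d : Dec (y ≡ x)) → h' ∧ not (does d) ≡ m' ∧ not (does d)
        go (yes _) = trans (Bool.∧-zeroʳ h') (sym (Bool.∧-zeroʳ m'))
        go (no y≢) = cong (_∧ true) (sym (trans (squash-off g r x (hub z) y hub≢path y≢)
          (cong (λ u → e g u (punchIn r y)) (punchIn-hub (inject₁ p) z))))

    deg≤ : ∀ z → deg (e M (hub z)) ≤ deg (e g (hub z))
    deg≤ z = let (d , q , q') = degrees z in
      subst₂ _≤_ (sym q) (sym q') (ι-∨ (e g (hub z) (3 ↑ʳ ins p p)) (e g (hub z) r) d)
      where
      ι-∨ : ∀ a b d → ι (a ∨ b) + d ≤ ι b + (ι a + d)
      ι-∨ true  true  d = ℕ.n≤1+n _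
      ι-∨ true  false d = ℕ.≤-refl
      ι-∨ false true  d = ℕ.≤-refl
      ι-∨ false false d = ℕ.≤-refl

    low : ¬ Low (e M)
    low (z , l) with degrees z
    ... | d , q , q' = go (e g (hub z) (3 ↑ʳ ins p p)) (e g (hub z) r) refl refl q q'
      where
      go : ∀ a b → e g (hub z) (3 ↑ʳ ins p p) ≡ a → e g (hub z) r ≡ b → deg (e M (hub z)) ≡ ι (a ∨ b) + d →
        deg (e g (hub z)) ≡ ι b + (ι a + d) → ⊥
      go true true p₁ p₂ q q' = ℕ.<⇒≱ (loose z p₂ (subst (λ i → e g (hub z) (3 ↑ʳ i) ≡ true) (ins-self p) p₁))
        (subst (_≤ 3) (sym (trans q' (cong suc (sym q)))) (s≤s l))
      go true false _ _ q q' = not-bad (inj₁ (z , subst (_≤ 2) (trans q (sym q')) l))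
      go false true _ _ q q' = not-bad (inj₁ (z , subst (_≤ 2) (trans q (sym q')) l))
      go false false _ _ q q' = not-bad (inj₁ (z , subst (_≤ 2) (trans q (sym q')) l))

    only : ∀ {z j} → j ≢ p → OnlyAt (e M) z j → OnlyAt (e g) z (ins p j)
    only {z} {j} j≢ o I with punchView (inject₁ p) I | o p
    ... | _ | inj₁ refl = ⊥-elim (j≢ refl)
    ... | new | inj₂ q = inj₂ (proj₂ (∨-split (e g (hub z) (3 ↑ʳ ins p p)) (e g (hub z) r) (sym (row-p z)) q))
    ... | old i | inj₂ q with i ≟ p
    ... | yes refl = inj₂ (proj₁ (∨-split (e g (hub z) (3 ↑ʳ ins p p)) (e g (hub z) r) (sym (row-p z)) q))
    ... | no i≢ = Sum.map (cong (ins p)) (trans (sym (row z i i≢))) (o i)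

    app : ¬ Appendable (e M)
    app (z , inj₁ o) = not-bad (inj₂ (inj₁ (z , inj₁ (subst (OnlyAt (e g) z) (ins-zero p p≢0) (only (p≢0 ∘ sym) o)))))
    app (z , inj₂ o) = not-bad (inj₂ (inj₁ (z , inj₂ (subst (OnlyAt (e g) z) (ins-last p) (only (p≢l ∘ sym) o)))))

    inject₁≢0 : inject₁ p ≢ zero
    inject₁≢0 = go p p≢0
      where
      go : ∀ {k} (p : Fin (suc k)) → p ≢ zero → inject₁ p ≢ zero
      go zero q r = q refl

    sole-p : ∀ {z} → Sole (e M) z p → Sole (e g) z (inject₁ p) × Sole (e g) z (suc p)
    sole-p {z} s = both (inject₁ p) (λ a a≢ → proj₂ (off a a≢)) , both (suc p) (λ a a≢ → subst (λ i → e g (hub a) (3 ↑ʳ i) ≡ false) (ins-self p) (proj₁ (off a a≢)))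
      where
      off : ∀ a → a ≢ z → e g (hub a) (3 ↑ʳ ins p p) ≡ false × e g (hub a) r ≡ false
      off a a≢ = ∨-split (e g (hub a) (3 ↑ʳ ins p p)) (e g (hub a) r) (trans (sym (row-p a)) (s a)) (does-no (a ≟ z) a≢)
      both : ∀ i → (∀ a → a ≢ z → e g (hub a) (3 ↑ʳ i) ≡ false) → Sole (e g) z i
      both i f a with a ≟ z
      ... | no a≢ = f a a≢
      ... | yes refl = trans (sym (bit-label g a (3 ↑ʳ i))) (some-bit (label g (3 ↑ʳ i)) a (all-some i)
              λ b b≢ → trans (bit-label g b (3 ↑ʳ i)) (f b b≢))

    -- Labels are nonempty, so if the merged label is just `z`, both original labels were, and the
    -- merged pair was a run already.
    no-sole : ∀ {z} → 6 ≤ deg (e g (hub z)) → Sole (e M) z p → ⊥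
    no-sole {z} d s = not-bad (inj₂ (inj₂ (z , d , inject₁ p , inject₁≢0 , proj₁ (sole-p s) , suc p
      , p≢l ∘ suc-injective , trans (cong (next (inject₁ p)) (sym (ins-self p))) (trans (next-new-from p p) (does-yes (p ≟ p) refl))
      , proj₂ (sole-p s))))

    run : ¬ Run (e M)
    run (z , d , i , i≢0 , s , j , j≢l , n , t) = go (i ≟ p) (j ≟ p)
      where
      go : Dec (i ≡ p) → Dec (j ≡ p) → ⊥
      go (yes refl) _ = no-sole (ℕ.≤-trans d (deg≤ z)) s
      go (no _) (yes refl) = no-sole (ℕ.≤-trans d (deg≤ z)) t
      go (no i≢) (no j≢) = not-bad (inj₂ (inj₂ (z , ℕ.≤-trans d (deg≤ z)
        , ins p i , (λ q → i≢0 (punchIn-injective (inject₁ p) i zero (trans q (sym (ins-zero p p≢0)))))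
        , (λ a → trans (sym (row a i i≢)) (s a))
        , ins p j , (λ q → j≢l (punchIn-injective (inject₁ p) j last (trans q (sym (ins-last p)))))
        , trans (next-ins p i j i≢ j≢) n , λ a → trans (sym (row a j j≢)) (t a))))

  -- The labels of the path ends do not change. A hub loses a neighbour only if it is adjacent to
  -- both merged vertices, and then `loose` leaves it three. A hub with path neighbours at most at
  -- an end was of this kind before. A run that meets the merged vertex comes from the merged pair,
  -- and any other run is one of `g`, since degrees do not grow.
  squash-good : Good M
  squash-good = record { std = std-M ; isFed = fed-M ; not-bad = [ low , [ app , run ]′ ]′ }

  squash-path-↠ : g ↠ M
  squash-path-↠ = squash-↠ g r x (trans (std (inject₁ p) (ins p p)) (cong (_∨ next (ins p p) (inject₁ p))
    (trans (next-new-from p p) (does-yes (p ≟ p) refl))))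

-- Finding a pair to merge on a long path

apart : (a b : Fin n) → Bool
apart a b = not (does (a ≟ b))

distinct : (a b c d : Fin n) → Bool
distinct a b c d = apart b a ∧ apart c a ∧ apart d a ∧ apart c b ∧ apart d b ∧ apart d c

apart-≢ : (a b : Fin n) → apart a b ≡ true → a ≢ b
apart-≢ a b q with a ≟ b
... | no p = p

-- Light hubs are those of degree three; 0, 1, 2, 3, 4 stand for the first path vertices and 5 for the last one.
module _ (h : Fin 3 → Fin 6 → Bool) (Light : Fin 3 → Set)
  (over : ∀ z a b c d → distinct a b c d ≡ true → Light z → h z a ≡ true → h z b ≡ true → h z c ≡ true → h z d ≡ true → ⊥)
  (pick₀ : ∀ {a b} → a ≢ b → h a 0F ≡ true ⊎ h b 0F ≡ true)
  (pickₗ : ∀ {a b} → a ≢ b → h a 5F ≡ true ⊎ h b 5F ≡ true) where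

  private
    Block : Fin 6 → Fin 6 → Set
    Block p q = ∃ λ z → h z p ≡ true × h z q ≡ true × Light z

  -- No light hub takes four of the six positions. If the three blocking hubs are distinct, each
  -- path end is adjacent to at least two of them, so one of them is adjacent to both ends and to
  -- its own pair, which makes four. If two coincide, that hub already has three or four of the
  -- inner positions; where it has three, both ends fall to the remaining hub, which gets four.
  stuck : Block 1F 2F → Block 2F 3F → Block 3F 4F → ⊥
  stuck (a , a1 , a2 , la) (b , b2 , b3 , lb) (c , c3 , c4 , lc) with a ≟ b | b ≟ c | a ≟ c
  ... | yes refl | yes refl | _ = over a 1F 2F 3F 4F refl la a1 a2 b3 c4
  ... | yes refl | no a≢c | _ = case pick₀ a≢c of λ
    { (inj₁ a0) → over a 0F 1F 2F 3F refl la a0 a1 a2 b3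
    ; (inj₂ c0) → case pickₗ a≢c of λ
      { (inj₁ al) → over a 1F 2F 3F 5F refl la a1 a2 b3 al
      ; (inj₂ cl) → over c 0F 3F 4F 5F refl lc c0 c3 c4 cl } }
  ... | no a≢b | yes refl | _ = case pick₀ a≢b of λ
    { (inj₂ b0) → over b 0F 2F 3F 4F refl lb b0 b2 b3 c4
    ; (inj₁ a0) → case pickₗ a≢b of λ
      { (inj₂ bl) → over b 2F 3F 4F 5F refl lb b2 b3 c4 bl
      ; (inj₁ al) → over a 0F 1F 2F 5F refl la a0 a1 a2 al } }
  ... | no _ | no _ | yes refl = over a 1F 2F 3F 4F refl la a1 a2 c3 c4
  ... | no a≢b | no b≢c | no a≢c = case pick₀ a≢b of λ
    { (inj₁ a0) → case pick₀ b≢c of λ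
      { (inj₁ b0) → case pickₗ a≢b of λ { (inj₁ al) → A a0 al ; (inj₂ bl) → B b0 bl }
      ; (inj₂ c0) → case pickₗ a≢c of λ { (inj₁ al) → A a0 al ; (inj₂ cl) → C c0 cl } }
    ; (inj₂ b0) → case pick₀ a≢c of λ
      { (inj₁ a0) → case pickₗ a≢b of λ { (inj₁ al) → A a0 al ; (inj₂ bl) → B b0 bl }
      ; (inj₂ c0) → case pickₗ b≢c of λ { (inj₁ bl) → B b0 bl ; (inj₂ cl) → C c0 cl } } }
    where
    A : h a 0F ≡ true → h a 5F ≡ true → ⊥
    A a0 al = over a 0F 1F 2F 5F refl la a0 a1 a2 al
    B : h b 0F ≡ true → h b 5F ≡ true → ⊥
    B b0 bl = over b 0F 2F 3F 5F refl lb b0 b2 b3 bl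
    C : h c 0F ≡ true → h c 5F ≡ true → ⊥
    C c0 cl = over c 0F 3F 4F 5F refl lc c0 c3 c4 cl


-- Merging two path vertices lowers a degree only for their common hubs, so only hubs of degree three are an obstacle.
module _ {g : Gr (11 + k)} (good : Good {6 + k} g) where
  open Good good
  open Fed isFed
  private
    h : Fin 3 → Fin (8 + k) → Bool
    h z i = e g (hub z) (3 ↑ʳ i)

    Light : Fin 3 → Set
    Light z = deg (e g (hub z)) ≤ 3

    Blocked : Fin (7 + k) → Set
    Blocked p = ∃ λ z → h z (inject₁ p) ≡ true × h z (suc p) ≡ true × Light z

    blocked? : ∀ p → Dec (Blocked p)
    blocked? p = any? λ z → h z (inject₁ p) Bool.≟ true ×-dec h z (suc p) Bool.≟ true ×-dec deg (e g (hub z)) ≤? 3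

    pos : Fin 6 → Fin (8 + k)
    pos zero = zero
    pos 1F = suc zero
    pos 2F = suc 1F
    pos 3F = suc 2F
    pos 4F = suc 3F
    pos 5F = last

    pos-inj : ∀ i j → pos i ≡ pos j → i ≡ j
    pos-inj zero zero _ = refl
    pos-inj zero 1F ()
    pos-inj zero 2F ()
    pos-inj zero 3F ()
    pos-inj zero 4F ()
    pos-inj zero 5F ()
    pos-inj 1F zero ()
    pos-inj 1F 1F _ = refl
    pos-inj 1F 2F ()
    pos-inj 1F 3F ()
    pos-inj 1F 4F ()
    pos-inj 1F 5F ()
    pos-inj 2F zero ()
    pos-inj 2F 1F ()
    pos-inj 2F 2F _ = refl
    pos-inj 2F 3F ()
    pos-inj 2F 4F ()
    pos-inj 2F 5F ()
    pos-inj 3F zero ()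
    pos-inj 3F 1F ()
    pos-inj 3F 2F ()
    pos-inj 3F 3F _ = refl
    pos-inj 3F 4F ()
    pos-inj 3F 5F ()
    pos-inj 4F zero ()
    pos-inj 4F 1F ()
    pos-inj 4F 2F ()
    pos-inj 4F 3F ()
    pos-inj 4F 4F _ = refl
    pos-inj 4F 5F ()
    pos-inj 5F zero ()
    pos-inj 5F 1F ()
    pos-inj 5F 2F ()
    pos-inj 5F 3F ()
    pos-inj 5F 4F ()
    pos-inj 5F 5F _ = refl

    over : ∀ z a b c d → distinct a b c d ≡ true → Light z →
      h z (pos a) ≡ true → h z (pos b) ≡ true → h z (pos c) ≡ true → h z (pos d) ≡ true → ⊥
    over z a b c d dis l ea eb ec ed =
      let (ba , r₁) = ∧-inv (apart b a) dis
          (ca , r₂) = ∧-inv (apart c a) r₁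
          (da , r₃) = ∧-inv (apart d a) r₂
          (cb , r₄) = ∧-inv (apart c b) r₃
          (db , dc) = ∧-inv (apart d b) r₄
      in ℕ.<⇒≱ (s≤s l) (four≤deg (e g (hub z)) ea eb ec ed (ne b a ba) (ne c a ca) (ne d a da) (ne c b cb) (ne d b db) (ne d c dc))
      where
      ne : ∀ i j → apart i j ≡ true → 3 ↑ʳ pos i ≢ 3 ↑ʳ pos j
      ne i j q r = apart-≢ i j q (pos-inj i j (3↑-inj r))

    pick : ∀ v → two-of (label g v) ≡ true → ∀ {a b} → a ≢ b → e g (hub a) v ≡ true ⊎ e g (hub b) v ≡ true
    pick v t {a} {b} q = Sum.map (trans (sym (bit-label g a v))) (trans (sym (bit-label g b v))) (two-of-pick (label g v) t q)

    use : ∀ p → p ≢ zero → p ≢ last → ¬ Blocked p → ∃ λ (M : Gr (10 + k)) → Good M × g ↠ M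
    use p p≢0 p≢l nb = squash g (3 ↑ʳ inject₁ p) (3 ↑ʳ p) , squash-good {5 + k} good p p≢0 p≢l loose , squash-path-↠ {5 + k} good p p≢0 p≢l loose
      where
      loose : ∀ z → h z (inject₁ p) ≡ true → h z (suc p) ≡ true → 4 ≤ deg (e g (hub z))
      loose z q r = ℕ.≰⇒> λ l → nb (z , q , r , l)

    choose : Dec (Blocked 1F) → Dec (Blocked 2F) → Dec (Blocked 3F) →
      ∃ λ (M : Gr (10 + k)) → Good M × g ↠ M
    choose (no b) _ _ = use 1F (λ ()) (λ ()) b
    choose (yes _) (no b) _ = use 2F (λ ()) (λ ()) b
    choose (yes _) (yes _) (no b) = use 3F (λ ()) (λ ()) b
    choose (yes a) (yes b) (yes c) =
      ⊥-elim (stuck (λ z i → h z (pos i)) Light over (pick 3F first-two) (pick (3 ↑ʳ last) last-two) a b c)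

  shorten : ∃ λ (M : Gr (10 + k)) → Good M × g ↠ M
  shorten = choose (blocked? 1F) (blocked? 2F) (blocked? 3F)

-- Two-hub graphs

module _ (g : Gr n) (a : Fin n) (Y : Fin n → Bool) (leaf : Fin 4 → Fin n)
  (leaf-inj : ∀ h h' → leaf h ≡ leaf h' → h ≡ h') (leaf≢a : ∀ h → leaf h ≢ a) (leaf∉Y : ∀ h → Y (leaf h) ≡ false) (a∉Y : Y a ≡ false)
  (root : Fin n) (root∈Y : Y root ≡ true) (connected : ∀ y → Y y ≡ true → Walk ⟪ g ⟫ (λ w → Y w ≡ true) y root)
  (to-a : ∀ h → e g a (leaf h) ≡ true) (to-Y : ∀ h → ∃ λ y → Y y ≡ true × e g y (leaf h) ≡ true) where
  private
    class : (v : Fin n) → Dec (∃ λ h → leaf h ≡ v) → Dec (v ≡ a) → Bool → Maybe (Fin 6)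
    class v (yes (h , _)) _ _ = just (2 ↑ʳ h)
    class v (no _) (yes _) _ = just zero
    class v (no _) (no _) true = just 1F
    class v (no _) (no _) false = nothing

    leaf? : ∀ v → Dec (∃ λ h → leaf h ≡ v)
    leaf? v = any? λ h → leaf h ≟ v

    ρ : Fin n → Maybe (Fin 6)
    ρ v = class v (leaf? v) (v ≟ a) (Y v)

    ρ-leaf : ∀ h → ρ (leaf h) ≡ just (2 ↑ʳ h)
    ρ-leaf h with leaf? (leaf h)
    ... | yes (h' , q) = cong (λ x → just (2 ↑ʳ x)) (leaf-inj h' h q)
    ... | no q = ⊥-elim (q (h , refl))

    ρ-a : ρ a ≡ just zero
    ρ-a with leaf? a | a ≟ a
    ... | yes (h , q) | _ = ⊥-elim (leaf≢a h q)
    ... | no _ | yes _ = refl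
    ... | no _ | no q = ⊥-elim (q refl)

    ρ-Y : ∀ {v} → Y v ≡ true → ρ v ≡ just 1F
    ρ-Y {v} p with leaf? v | v ≟ a
    ... | yes (h , refl) | _ = ⊥-elim (t≢f p (leaf∉Y h))
    ... | no _ | yes refl = ⊥-elim (t≢f p a∉Y)
    ... | no _ | no _ rewrite p = refl

    a-only : ∀ v → ρ v ≡ just zero → v ≡ a
    a-only v p with leaf? v | v ≟ a | Y v
    a-only v () | yes _ | _ | _
    ... | no _ | yes q | _ = q
    a-only v () | no _ | no _ | true
    a-only v () | no _ | no _ | false

    Y-only : ∀ v → ρ v ≡ just 1F → Y v ≡ true
    Y-only v p with leaf? v | v ≟ a | Y v
    Y-only v () | yes _ | _ | _
    Y-only v () | no _ | yes _ | _
    ... | no _ | no _ | true = refl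
    Y-only v () | no _ | no _ | false

    leaf-only : ∀ v h → ρ v ≡ just (2 ↑ʳ h) → v ≡ leaf h
    leaf-only v h p with leaf? v | v ≟ a | Y v
    leaf-only v h refl | yes (h' , q) | _ | _ = sym q
    leaf-only v h () | no _ | yes _ | _
    leaf-only v h () | no _ | no _ | true
    leaf-only v h () | no _ | no _ | false

    single : ∀ {w h u v} → (∀ x → ρ x ≡ just h → x ≡ w) → ρ u ≡ just h → ρ v ≡ just h → Walk ⟪ g ⟫ (λ x → ρ x ≡ just h) u v
    single only p q with only _ p | only _ q
    ... | refl | refl = here p

    conn : ∀ h u v → ρ u ≡ just h → ρ v ≡ just h → Walk ⟪ g ⟫ (λ x → ρ x ≡ just h) u v
    conn zero u v = single a-only
    conn 1F u v p q = mapʷ ρ-Y (connected u (Y-only u p)) ++ʷ reverseʷ (mapʷ ρ-Y (connected v (Y-only v q)))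
    conn (suc (suc h)) u v = single (λ x → leaf-only x h)

    inhabited : ∀ h → ∃ λ v → ρ v ≡ just h
    inhabited zero = a , ρ-a
    inhabited 1F = root , ρ-Y root∈Y
    inhabited (suc (suc h)) = leaf h , ρ-leaf h

    edges : ∀ h h' → Edge K24 h h' → ∃ λ u → ∃ λ v → ρ u ≡ just h × ρ v ≡ just h' × Edge ⟪ g ⟫ u v
    edges zero (suc (suc h)) _ = a , leaf h , ρ-a , ρ-leaf h , to-a h
    edges (suc (suc h)) zero _ = leaf h , a , ρ-leaf h , ρ-a , esym g (to-a h)
    edges 1F (suc (suc h)) _ = let (y , p , q) = to-Y h in y , leaf h , ρ-Y p , ρ-leaf h , q
    edges (suc (suc h)) 1F _ = let (y , p , q) = to-Y h in leaf h , y , ρ-leaf h , ρ-Y p , esym g q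
    edges zero zero ()
    edges zero 1F ()
    edges 1F zero ()
    edges 1F 1F ()
    edges (suc (suc h)) (suc (suc h')) p = ⊥-elim (K24-leaves h h' p)

  star-minor : K24-minor g
  star-minor = ρ , inhabited , conn , edges

next-toℕ : (i j : Fin k) → next i j ≡ true → toℕ j ≡ suc (toℕ i)
next-toℕ zero 1F p = refl
next-toℕ (suc i) (suc j) p = cong suc (next-toℕ i j p)

-- One branch set is the first hub, the other consists of the second hub and the path from j to i'.
crossing-minor : (g : Gr (4 + k)) → Std 2 g →
  (∀ z → z ≡ zero ⊎ z ≡ last → e g zero (2 ↑ʳ z) ≡ true × e g 1F (2 ↑ʳ z) ≡ true) →
  ∀ i j i' j' → next i j ≡ true → next i' j' ≡ true → toℕ i < toℕ i' → i ≢ zero → j' ≢ last →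
  e g zero (2 ↑ʳ i) ≡ true → e g 1F (2 ↑ʳ j) ≡ true → e g zero (2 ↑ʳ j') ≡ true → K24-minor g
crossing-minor {k} g s ends i j i' j' ij i'j' i<i' i≢0 j'≢l ai bj aj' =
  star-minor g zero Y leaf leaf-inj leaf≢a leaf∉Y refl 1F refl connected to-a to-Y
  where
  inner : Fin (2 + k) → Bool
  inner l = does (toℕ i <? toℕ l) ∧ does (toℕ l <? toℕ j')
  Y : Fin (4 + k) → Bool
  Y zero = false
  Y 1F = true
  Y (suc (suc l)) = inner l
  -- The four leaves: both path ends, which see both hubs, and the two vertices just outside the
  -- segment from `j` to `i'`, which see the first hub directly and the second through the segment.
  q : Fin 4 → Fin (2 + k)
  q zero = zero
  q 1F = i
  q 2F = j'
  q 3F = last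
  leaf : Fin 4 → Fin (4 + k)
  leaf h = 2 ↑ʳ q h
  j=1+i = next-toℕ i j ij
  j'=1+i' = next-toℕ i' j' i'j'
  i<j' : toℕ i < toℕ j'
  i<j' = subst (toℕ i <_) (sym j'=1+i') (ℕ.m<n⇒m<1+n i<i')
  j'<l : toℕ j' < toℕ (fromℕ (suc k))
  j'<l = ℕ.≤∧≢⇒< (subst (toℕ j' ≤_) (sym (toℕ-fromℕ (suc k))) (ℕ.≤-pred (toℕ<n j'))) (j'≢l ∘ toℕ-injective)
  0<i : 0 < toℕ i
  0<i = ℕ.n≢0⇒n>0 (i≢0 ∘ toℕ-injective)
  lt≢ : ∀ {x y : Fin (2 + k)} → toℕ x < toℕ y → x ≢ y
  lt≢ p refl = ℕ.<-irrefl refl p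
  q-mono : ∀ h h' → toℕ h < toℕ h' → toℕ (q h) < toℕ (q h')
  q-mono zero zero ()
  q-mono zero 1F _ = 0<i
  q-mono zero 2F _ = ℕ.<-trans 0<i i<j'
  q-mono zero 3F _ = ℕ.<-trans 0<i (ℕ.<-trans i<j' j'<l)
  q-mono 1F zero ()
  q-mono 1F 1F (s≤s ())
  q-mono 1F 2F _ = i<j'
  q-mono 1F 3F _ = ℕ.<-trans i<j' j'<l
  q-mono 2F zero ()
  q-mono 2F 1F (s≤s ())
  q-mono 2F 2F (s≤s (s≤s ()))
  q-mono 2F 3F _ = j'<l
  q-mono 3F zero ()
  q-mono 3F 1F (s≤s ())
  q-mono 3F 2F (s≤s (s≤s ()))
  q-mono 3F 3F (s≤s (s≤s (s≤s ())))
  leaf-inj : ∀ h h' → leaf h ≡ leaf h' → h ≡ h'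
  leaf-inj h h' p with ℕ.<-cmp (toℕ h) (toℕ h')
  ... | tri< l _ _ = ⊥-elim (lt≢ (q-mono h h' l) (2↑-inj p))
  ... | tri≈ _ r _ = toℕ-injective r
  ... | tri> _ _ l = ⊥-elim (lt≢ (q-mono h' h l) (2↑-inj (sym p)))
  leaf≢a : ∀ h → leaf h ≢ zero
  leaf≢a h ()
  leaf∉Y : ∀ h → inner (q h) ≡ false
  leaf∉Y zero = cong (_∧ does (0 <? toℕ j')) (does-no (toℕ i <? 0) λ ())
  leaf∉Y 1F = cong (_∧ does (toℕ i <? toℕ j')) (does-no (toℕ i <? toℕ i) (ℕ.<-irrefl refl))
  leaf∉Y 2F = trans (cong (does (toℕ i <? toℕ j') ∧_) (does-no (toℕ j' <? toℕ j') (ℕ.<-irrefl refl))) (Bool.∧-zeroʳ _)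
  leaf∉Y 3F = trans (cong (does (toℕ i <? toℕ (fromℕ (suc k))) ∧_)
    (does-no (toℕ (fromℕ (suc k)) <? toℕ j') (ℕ.<⇒≯ j'<l))) (Bool.∧-zeroʳ _)
  inner-intro : ∀ {l} → toℕ i < toℕ l → toℕ l < toℕ j' → inner l ≡ true
  inner-intro {l} p r = cong₂ _∧_ (does-yes (toℕ i <? toℕ l) p) (does-yes (toℕ l <? toℕ j') r)
  inner-elim : ∀ {l} → inner l ≡ true → toℕ i < toℕ l × toℕ l < toℕ j'
  inner-elim {l} p = let (a , b) = ∧-inv (does (toℕ i <? toℕ l)) p in does-true (toℕ i <? toℕ l) a , does-true (toℕ l <? toℕ j') b
  -- The segment is followed downwards for `t` steps to `j`, where the second hub is adjacent.
  down : ∀ t l → toℕ l ≡ t + suc (toℕ i) → toℕ l < toℕ j' → Walk ⟪ g ⟫ (λ w → Y w ≡ true) (2 ↑ʳ l) 1F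
  down zero l p r with toℕ-injective (trans p (sym j=1+i))
  ... | refl = step (inner-intro (ℕ.≤-reflexive (sym p)) r) (esym g bj) (here refl)
  down (suc t) l p r = let (l' , l'l) = previous l (λ { refl → case p of λ () }) ; l=1+l' = next-toℕ l' l l'l in
    step (inner-intro (subst (toℕ i <_) (sym p) (s≤s (ℕ.≤-trans (ℕ.n≤1+n _) (ℕ.m≤n+m _ t)))) r)
      (trans (s l l') (∨-r (next l l') l'l))
      (down t l' (ℕ.suc-injective (trans (sym l=1+l') p)) (ℕ.<-trans (ℕ.≤-reflexive (sym l=1+l')) r))
  connected : ∀ y → Y y ≡ true → Walk ⟪ g ⟫ (λ w → Y w ≡ true) y 1F
  connected 1F p = here refl
  connected (suc (suc l)) p = let (a , b) = inner-elim p in down (toℕ l ∸ suc (toℕ i)) l (sym (ℕ.m∸n+n≡m a)) b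
  to-a : ∀ h → e g zero (leaf h) ≡ true
  to-a zero = proj₁ (ends zero (inj₁ refl))
  to-a 1F = ai
  to-a 2F = aj'
  to-a 3F = proj₁ (ends last (inj₂ refl))
  to-Y : ∀ h → ∃ λ y → Y y ≡ true × e g y (leaf h) ≡ true
  to-Y zero = suc zero , refl , proj₂ (ends zero (inj₁ refl))
  to-Y 1F = 2 ↑ʳ j , inner-intro (ℕ.≤-reflexive (sym j=1+i)) (subst₂ _<_ (sym j=1+i) (sym j'=1+i') (s≤s i<i')) , trans (s j i) (∨-r (next j i) ij)
  to-Y 2F = 2 ↑ʳ i' , inner-intro i<i' (ℕ.≤-reflexive (sym j'=1+i')) , trans (s i' j') (cong (_∨ next j' i') i'j')
  to-Y 3F = suc zero , refl , proj₂ (ends last (inj₂ refl))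

-- Monotone labels

Interior-closed : (A B : Fin (suc k) → Bool) → Set
Interior-closed A B = ∀ i j → next i j ≡ true → i ≢ zero → j ≢ last → (A i ≡ true → A j ≡ true) × (B j ≡ true → B i ≡ true)

-- The last clause excludes a pair of vertices that both see both hubs. Such a pair is consistent
-- with either direction and would otherwise count as a violation of both.
Violation : (A B : Fin (suc k) → Bool) → Set
Violation A B = ∃ λ i → ∃ λ j → next i j ≡ true × i ≢ zero × j ≢ last × A i ≡ true × B j ≡ true × (A j ≡ true → B i ≡ true → ⊥)

closed⊎violation : (A B : Fin (suc k) → Bool) → (∀ i → A i ≡ true ⊎ B i ≡ true) → Interior-closed A B ⊎ Violation A B
closed⊎violation A B some with any? (λ i → any? λ j → next i j Bool.≟ true ×-dec ¬? (i ≟ zero) ×-dec ¬? (j ≟ last)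
  ×-dec A i Bool.≟ true ×-dec B j Bool.≟ true ×-dec (A j Bool.≟ true →-dec B i Bool.≟ true →-dec no id))
... | yes v = inj₂ v
... | no ¬v = inj₁ λ i j ij i≢ j≢ →
  (λ ai → Bool.¬-not λ aj → case some j of λ
    { (inj₁ p) → t≢f p aj
    ; (inj₂ bj) → ¬v (i , j , ij , i≢ , j≢ , ai , bj , λ p _ → t≢f p aj) })
  , λ bj → Bool.¬-not λ bi → case some i of λ
    { (inj₂ p) → t≢f p bi
    ; (inj₁ ai) → ¬v (i , j , ij , i≢ , j≢ , ai , bj , λ _ p → t≢f p bi) }

module _ (g : Gr (4 + k)) (s : Std 2 g) (c : Conn3 g) (free : ¬ K24-minor g) where
  private
    A B : Fin (2 + k) → Bool
    A i = e g zero (2 ↑ʳ i)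
    B i = e g 1F (2 ↑ʳ i)

    some-hub : ∀ i → A i ≡ true ⊎ B i ≡ true
    some-hub i with A i in a | B i in b
    ... | true | _ = inj₁ refl
    ... | false | true = inj₂ refl
    ... | false | false with path-neighbours i
    ... | p , q , only = ⊥-elim (not-two-neighbours {g = g} c (2 ↑ʳ i) (2 ↑ʳ p) (2 ↑ʳ q) λ
      { zero r → ⊥-elim (t≢f (esym g r) a)
      ; 1F r → ⊥-elim (t≢f (esym g r) b)
      ; (suc (suc l)) r → Sum.map (cong (2 ↑ʳ_)) (cong (2 ↑ʳ_)) (only l (trans (sym (s i l)) r)) })

    end : ∀ i t → (∀ j → pathE i j ≡ true → j ≡ t) → A i ≡ true × B i ≡ true
    end i t only =
      (Bool.¬-not λ a → not-two-neighbours {g = g} c (2 ↑ʳ i) 1F (2 ↑ʳ t) λ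
        { zero r → ⊥-elim (t≢f (esym g r) a)
        ; 1F r → inj₁ refl
        ; (suc (suc l)) r → inj₂ (cong (2 ↑ʳ_) (only l (trans (sym (s i l)) r))) })
      , (Bool.¬-not λ b → not-two-neighbours {g = g} c (2 ↑ʳ i) zero (2 ↑ʳ t) λ
        { zero r → inj₁ refl
        ; 1F r → ⊥-elim (t≢f (esym g r) b)
        ; (suc (suc l)) r → inj₂ (cong (2 ↑ʳ_) (only l (trans (sym (s i l)) r))) })

    swapped : Gr (4 + k)
    swapped = relabel (Perm.transpose zero 1F) g

  hub-ends : ∀ z → z ≡ zero ⊎ z ≡ last → e g zero (2 ↑ʳ z) ≡ true × e g 1F (2 ↑ʳ z) ≡ true
  hub-ends z (inj₁ refl) = end zero 1F first-neighbour
  hub-ends z (inj₂ refl) = end last (inject₁ last) last-neighbour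

  private
    -- The earlier of two opposite violations marks the start of the segment in `crossing-minor`,
    -- with the hubs exchanged if necessary. At the same place the two contradict the last clause of
    -- `Violation`.
    clash : Violation A B → Violation B A → ⊥
    clash (i , j , ij , i≢ , j≢ , ai , bj , x) (i' , j' , ij' , i≢' , j≢' , bi , aj , x') with ℕ.<-cmp (toℕ i) (toℕ i')
    ... | tri< l _ _ = free (crossing-minor g s hub-ends i j i' j' ij ij' l i≢ j≢' ai bj aj)
    ... | tri> _ _ l = free (K24-lift (≃⇒↠ (≃-sym (relabel-≃ (Perm.transpose zero 1F) g)))
      (crossing-minor swapped s (λ z p → let (a , b) = hub-ends z p in b , a) i' j' i j ij' ij l i≢' j≢ bi aj bj))
    ... | tri≈ _ q _ with toℕ-injective q
    ... | refl with next-functional i j j' ij ij'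
    ... | refl = x aj bi

  monotone-hubs : Interior-closed A B ⊎ Interior-closed B A
  monotone-hubs with closed⊎violation A B some-hub | closed⊎violation B A (λ i → Sum.swap (some-hub i))
  ... | inj₁ q | _ = inj₁ q
  ... | inj₂ _ | inj₁ q = inj₂ q
  ... | inj₂ v | inj₂ w = ⊥-elim (clash v w)

≤ᵇ-suc : ∀ t i → (t ≤ᵇ i) ≡ (suc t ≤ᵇ suc i)
≤ᵇ-suc zero i = refl
≤ᵇ-suc (suc t) i = refl

threshold : (f : Fin n → Bool) → (∀ i j → next i j ≡ true → f i ≡ true → f j ≡ true) → ∃ λ t → t ≤ n × ∀ i → f i ≡ (t ≤ᵇ toℕ i)
threshold {zero} f up = 0 , z≤n , λ ()
threshold {suc n} f up with f zero in f0
... | true = 0 , z≤n , every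
  where
  every : ∀ i → f i ≡ true
  every zero = f0
  every (suc i) = go (toℕ i) i refl
    where
    go : ∀ m (i : Fin n) → toℕ i ≡ m → f (suc i) ≡ true
    go zero zero p = up zero 1F refl f0
    go (suc m) i p = let (j , ji) = previous′ i (λ q → case trans (sym p) q of λ ()) in
      up (suc j) (suc i) ji (go m j (ℕ.suc-injective (trans (sym (next-toℕ j i ji)) p)))
      where
      previous′ : ∀ {n} (i : Fin n) → toℕ i ≢ 0 → ∃ λ j → next j i ≡ true
      previous′ {suc n} i q = previous i (q ∘ cong toℕ)
... | false with threshold (f ∘ suc) (λ i j p → up (suc i) (suc j) p)
... | t , t≤ , eq = suc t , s≤s t≤ , λ { zero → f0 ; (suc i) → trans (eq i) (≤ᵇ-suc t (toℕ i)) }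

-- Identification with the graphs G_{n,r,s}

≡ᵇ-refl : ∀ n → (n ≡ᵇ n) ≡ true
≡ᵇ-refl zero = refl
≡ᵇ-refl (suc n) = ≡ᵇ-refl n

<⇒≢ᵇ : ∀ {a b} → a < b → (a ≡ᵇ b) ≡ false
<⇒≢ᵇ {zero} {suc b} p = refl
<⇒≢ᵇ {suc a} {suc b} (s≤s p) = <⇒≢ᵇ p

>⇒≢ᵇ : ∀ {a b} → b < a → (a ≡ᵇ b) ≡ false
>⇒≢ᵇ {suc a} {zero} p = refl
>⇒≢ᵇ {suc a} {suc b} (s≤s p) = >⇒≢ᵇ p

<⇒<ᵇ≡ : ∀ {a b} → a < b → (suc a ≤ᵇ b) ≡ true
<⇒<ᵇ≡ {zero} {suc b} p = refl
<⇒<ᵇ≡ {suc a} {suc b} (s≤s p) = <⇒<ᵇ≡ p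

n≮ᵇn : ∀ n → (suc n ≤ᵇ n) ≡ false
n≮ᵇn zero = refl
n≮ᵇn (suc n) = n≮ᵇn n

not-≤ᵇ : ∀ u i → not (u ≤ᵇ i) ≡ (suc i ≤ᵇ u)
not-≤ᵇ zero i = refl
not-≤ᵇ (suc u) zero = refl
not-≤ᵇ (suc u) (suc i) = trans (cong not (sym (≤ᵇ-suc u i))) (not-≤ᵇ u i)

next-≡ᵇ : (i j : Fin k) → next i j ≡ (suc (toℕ i) ≡ᵇ toℕ j)
next-≡ᵇ zero zero = refl
next-≡ᵇ zero 1F = refl
next-≡ᵇ zero (suc (suc j)) = refl
next-≡ᵇ (suc i) zero = refl
next-≡ᵇ (suc i) (suc j) = next-≡ᵇ i j

gℕ : (n r s : ℕ) → Bool → ℕ → ℕ → Bool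
gℕ n r s plus a b = (suc a ≡ᵇ b) ∨ ((a ≡ᵇ 0) ∧ (n ∸ suc r ≤ᵇ b) ∧ (suc b ≤ᵇ n ∸ 1))
  ∨ ((a ≡ᵇ n ∸ 1) ∧ (1 ≤ᵇ b) ∧ (b ≤ᵇ s)) ∨ (plus ∧ (a ≡ᵇ 0) ∧ (b ≡ᵇ n ∸ 1))

Gnrs-adj : ∀ n r s plus {x y a b} → x ≢ y → toℕ x ≡ a → toℕ y ≡ b →
  adj (Gnrs n r s plus) x y ≡ gℕ n r s plus a b ∨ gℕ n r s plus b a
Gnrs-adj n r s plus {x} {y} x≢y refl refl = cong (λ d → not d ∧ (gℕ n r s plus (toℕ x) (toℕ y) ∨ gℕ n r s plus (toℕ y) (toℕ x)))
  (apart′ (x ≟ y))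
  where
  apart′ : (d : Dec (x ≡ y)) → ⌊ d ⌋ ≡ false
  apart′ (yes p) = ⊥-elim (x≢y p)
  apart′ (no _) = refl

module _ {k : ℕ} (g : Gr (4 + k)) (st : Std 2 g)
  (ends : ∀ z → z ≡ zero ⊎ z ≡ last → e g zero (2 ↑ʳ z) ≡ true × e g 1F (2 ↑ʳ z) ≡ true)
  (closed : Interior-closed (λ i → e g zero (2 ↑ʳ i)) (λ i → e g 1F (2 ↑ʳ i))) where
  private
    A B : Fin (2 + k) → Bool
    A i = e g zero (2 ↑ʳ i)
    B i = e g 1F (2 ↑ʳ i)

    A-up : ∀ i j → next i j ≡ true → A (suc i) ≡ true → A (suc j) ≡ true
    A-up i j ij p with suc j ≟ last
    ... | yes refl = proj₁ (ends last (inj₂ refl))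
    ... | no j≢ = proj₁ (closed (suc i) (suc j) ij (λ ()) j≢) p

    B-down : ∀ i j → next i j ≡ true → not (B (inject₁ i)) ≡ true → not (B (inject₁ j)) ≡ true
    B-down zero j ij p = case trans (sym p) (cong not (proj₂ (ends zero (inj₁ refl)))) of λ ()
    B-down (suc i) j ij p = Bool.¬-not λ q → t≢f (proj₂ (closed (inject₁ (suc i)) (inject₁ j) (trans (next-inject₁ (suc i) j) ij)
      (λ ()) (Fin.fromℕ≢inject₁ ∘ sym)) (Bool.not-injective q)) (Bool.not-injective p)

    -- The edges from the first hub to the first path vertex and from the second hub to the last one
    -- become v_1 v_2 and v_{n-1} v_n. The thresholds therefore concern the other path vertices
    -- only.
    T = threshold (A ∘ suc) A-up
    U = threshold (not ∘ B ∘ inject₁) B-down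
    t = proj₁ T
    s = proj₁ U
    -- Of the `suc k` path vertices after the first, the first hub misses the initial `t`; `r`
    -- counts those it sees.
    r = suc k ∸ t
    plus = e g zero 1F

    from-t : 3 + k ∸ r ≡ 2 + t
    from-t = trans (ℕ.+-∸-assoc 2 (ℕ.m∸n≤m (suc k) t)) (cong (2 +_) (ℕ.m∸[m∸n]≡n (proj₁ (proj₂ T))))

    -- The first hub stays in front as v_1, and the second moves behind the path to become v_n.
    φ : Permutation′ (4 + k)
    φ = insert 1F last Perm.id

    φ-0 : toℕ (φ ⟨$⟩ʳ zero) ≡ 0
    φ-0 = refl

    φ-1 : toℕ (φ ⟨$⟩ʳ suc zero) ≡ 3 + k
    φ-1 = trans (cong toℕ (insert-self 1F last Perm.id)) (toℕ-fromℕ (3 + k))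

    φ-2 : ∀ i → toℕ (φ ⟨$⟩ʳ (2 ↑ʳ i)) ≡ suc (toℕ i)
    φ-2 i = trans (cong toℕ (trans (insert-punchIn 1F last Perm.id (suc i)) (punchIn-last (suc i)))) (toℕ-inject₁ (suc i))

    G = Gnrs (4 + k) r s plus

    adj≡ : ∀ {u v a b} → u ≢ v → toℕ (φ ⟨$⟩ʳ u) ≡ a → toℕ (φ ⟨$⟩ʳ v) ≡ b →
      adj G (φ ⟨$⟩ʳ u) (φ ⟨$⟩ʳ v) ≡ gℕ (4 + k) r s plus a b ∨ gℕ (4 + k) r s plus b a
    adj≡ u≢v = Gnrs-adj (4 + k) r s plus (u≢v ∘ perm-inj φ)

    hubs : plus ≡ gℕ (4 + k) r s plus 0 (3 + k) ∨ gℕ (4 + k) r s plus (3 + k) 0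
    hubs rewrite ≡ᵇ-refl k | n≮ᵇn k | Bool.∧-zeroʳ (3 + k ∸ r ≤ᵇ 3 + k) | Bool.∧-identityʳ plus | Bool.∧-zeroʳ plus = sym (Bool.∨-identityʳ plus)

    first-hub : ∀ i → A i ≡ gℕ (4 + k) r s plus 0 (suc (toℕ i)) ∨ gℕ (4 + k) r s plus (suc (toℕ i)) 0
    first-hub i rewrite from-t | <⇒≢ᵇ (toℕ<n i) | <⇒<ᵇ≡ (toℕ<n i) | Bool.∧-zeroʳ plus
      | Bool.∨-identityʳ ((2 + t ≤ᵇ suc (toℕ i)) ∧ true) | Bool.∧-identityʳ (2 + t ≤ᵇ suc (toℕ i))
      | Bool.∨-identityʳ ((0 ≡ᵇ toℕ i) ∨ (2 + t ≤ᵇ suc (toℕ i))) = go i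
      where
      go : ∀ i → A i ≡ (0 ≡ᵇ toℕ i) ∨ (2 + t ≤ᵇ suc (toℕ i))
      go zero = proj₁ (ends zero (inj₁ refl))
      go (suc i) = trans (proj₂ (proj₂ T) i) (≤ᵇ-suc t (toℕ i))

    second-hub : ∀ i → B i ≡ gℕ (4 + k) r s plus (3 + k) (suc (toℕ i)) ∨ gℕ (4 + k) r s plus (suc (toℕ i)) (3 + k)
    second-hub i rewrite >⇒≢ᵇ {3 + k} {toℕ i} (ℕ.m<n⇒m<1+n (toℕ<n i)) | ≡ᵇ-refl k | <⇒≢ᵇ (toℕ<n i) | Bool.∧-zeroʳ plus
      | Bool.∨-identityʳ (suc (toℕ i) ≤ᵇ s) | Bool.∨-identityʳ (toℕ i ≡ᵇ suc k) = go i (view i)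
      where
      go : ∀ i → View i → B i ≡ (suc (toℕ i) ≤ᵇ s) ∨ (toℕ i ≡ᵇ suc k)
      go _ ‵fromℕ = trans (proj₂ (ends last (inj₂ refl))) (sym (∨-r (suc (toℕ (fromℕ (suc k))) ≤ᵇ s)
        (trans (cong (_≡ᵇ suc k) (toℕ-fromℕ (suc k))) (≡ᵇ-refl (suc k)))))
      go _ (‵inject₁ i) = trans (Bool.not-injective (trans (proj₂ (proj₂ U) i)
        (trans (sym (Bool.not-involutive (s ≤ᵇ toℕ i))) (cong not (not-≤ᵇ s (toℕ i))))))
        (trans (cong (λ a → suc a ≤ᵇ s) (sym (toℕ-inject₁ i)))
          (sym (trans (cong ((suc (toℕ (inject₁ i)) ≤ᵇ s) ∨_) (<⇒≢ᵇ (subst (_< suc k) (sym (toℕ-inject₁ i)) (toℕ<n i)))) (Bool.∨-identityʳ _))))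

    along : ∀ (i j : Fin (2 + k)) → pathE i j ≡ gℕ (4 + k) r s plus (suc (toℕ i)) (suc (toℕ j)) ∨ gℕ (4 + k) r s plus (suc (toℕ j)) (suc (toℕ i))
    along i j = trans (cong₂ _∨_ (next-≡ᵇ i j) (next-≡ᵇ j i)) (sym (cong₂ _∨_
        (tidy (suc (toℕ i) ≡ᵇ toℕ j) (suc (toℕ j) ≤ᵇ s) (<⇒≢ᵇ (toℕ<n i)) plus)
        (tidy (suc (toℕ j) ≡ᵇ toℕ i) (suc (toℕ i) ≤ᵇ s) (<⇒≢ᵇ (toℕ<n j)) plus)))
      where
      tidy : ∀ x b {y} → y ≡ false → ∀ p → x ∨ (y ∧ b) ∨ (p ∧ false) ≡ x
      tidy x b refl p = trans (cong (x ∨_) (Bool.∧-zeroʳ p)) (Bool.∨-identityʳ x)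

    agree : ∀ u v → e g u v ≡ adj G (φ ⟨$⟩ʳ u) (φ ⟨$⟩ʳ v)
    agree u v with u ≟ v
    ... | yes refl = trans (irr g u) (sym (adj-irrefl G (φ ⟨$⟩ʳ u)))
    agree zero zero | no q = ⊥-elim (q refl)
    agree zero 1F | no q = trans hubs (sym (adj≡ q φ-0 φ-1))
    agree 1F zero | no q = trans (sy g _ _) (trans hubs (trans (Bool.∨-comm (gℕ (4 + k) r s plus 0 (3 + k)) _) (sym (adj≡ q φ-1 φ-0))))
    agree 1F 1F | no q = ⊥-elim (q refl)
    agree zero (suc (suc i)) | no q = trans (first-hub i) (sym (adj≡ q φ-0 (φ-2 i)))
    agree (suc (suc i)) zero | no q = trans (sy g _ _) (trans (first-hub i) (trans (Bool.∨-comm (gℕ (4 + k) r s plus 0 (suc (toℕ i))) _) (sym (adj≡ q (φ-2 i) φ-0))))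
    agree 1F (suc (suc i)) | no q = trans (second-hub i) (sym (adj≡ q φ-1 (φ-2 i)))
    agree (suc (suc i)) 1F | no q = trans (sy g _ _) (trans (second-hub i) (trans (Bool.∨-comm (gℕ (4 + k) r s plus (3 + k) (suc (toℕ i))) _) (sym (adj≡ q (φ-2 i) φ-1))))
    agree (suc (suc i)) (suc (suc j)) | no q = trans (st i j) (trans (along i j) (sym (adj≡ q (φ-2 i) (φ-2 j))))

  two-hub-Gnrs : ∃ λ r → ∃ λ s → ∃ λ plus → r ≤ suc k × s ≤ suc k × g ≃ gr (Gnrs (4 + k) r s plus)
  two-hub-Gnrs = r , s , plus , ℕ.m∸n≤m (suc k) t , proj₁ (proj₂ U) , iso φ agree

path-Gnrs : (g : Gr (4 + k)) → HubPath {2 + k} 2 g → Conn3 g → ¬ K24-minor g →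
  ∃ λ r → ∃ λ s → ∃ λ plus → r ≤ suc k × s ≤ suc k × g ≃ gr (Gnrs (4 + k) r s plus)
path-Gnrs {k} g (h , i , st) c free = go (monotone-hubs h st ch fh)
  where
  ch : Conn3 h
  ch = Conn3-≃ i c
  fh : ¬ K24-minor h
  fh q = free (K24-lift (≃⇒↠ i) q)
  sw = Perm.transpose zero 1F
  ends = hub-ends h st ch fh
  back : ∀ {g' : Gr (4 + k)} → g ≃ g' → (∃ λ r → ∃ λ s → ∃ λ plus → r ≤ suc k × s ≤ suc k × g' ≃ gr (Gnrs (4 + k) r s plus)) →
    ∃ λ r → ∃ λ s → ∃ λ plus → r ≤ suc k × s ≤ suc k × g ≃ gr (Gnrs (4 + k) r s plus)
  back j (r , s , p , a , b , l) = r , s , p , a , b , ≃-trans j l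
  go : Interior-closed (λ i → e h zero (2 ↑ʳ i)) (λ i → e h 1F (2 ↑ʳ i)) ⊎ Interior-closed (λ i → e h 1F (2 ↑ʳ i)) (λ i → e h zero (2 ↑ʳ i)) →
    ∃ λ r → ∃ λ s → ∃ λ plus → r ≤ suc k × s ≤ suc k × g ≃ gr (Gnrs (4 + k) r s plus)
  go (inj₁ q) = back i (two-hub-Gnrs h st ends q)
  go (inj₂ q) = back (≃-trans i (≃-sym (relabel-≃ sw h))) (two-hub-Gnrs (relabel sw h) st (λ z p → let (a , b) = ends z p in b , a) q)

-- The exceptional graphs have no K24 minor

-- A table of values, so that testing an iterated deletion or contraction does not evaluate the
-- whole chain of operations again at every entry.
freeze : Rel n → Rel n
freeze E = λ u v → lookup (lookup table u) v
  where table = tabulate λ u → tabulate (E u)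

freeze-eq : (E : Rel n) → ∀ u v → freeze E u v ≡ E u v
freeze-eq E u v = trans (cong (λ r → lookup r v) (Vec.lookup∘tabulate (λ u → tabulate (E u)) u)) (Vec.lookup∘tabulate (E u) v)

delete : Gr (suc n) → Fin (suc n) → Gr n
delete g r = record { e = λ u v → e g (punchIn r u) (punchIn r v) ; sy = λ u v → sy g _ _ ; irr = λ u → irr g _ }

tabled : Gr n → Gr n
tabled g = record
  { e = freeze (e g)
  ; sy = λ u v → trans (freeze-eq (e g) u v) (trans (sy g u v) (sym (freeze-eq (e g) v u)))
  ; irr = λ u → trans (freeze-eq (e g) u u) (irr g u) }

tabled-≃ : (g : Gr n) → g ≃ tabled g
tabled-≃ g = iso Perm.id λ u v → sym (freeze-eq (e g) u v)

-- On six vertices a K_{2,4} minor is a spanning subgraph, and `x` and `y` are its vertices of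
-- degree four.
Dominating : Gr n → Set
Dominating g = ∃ λ x → ∃ λ y → x ≢ y × ∀ z → z ≡ x ⊎ z ≡ y ⊎ e g x z ≡ true × e g y z ≡ true

dominating? : (g : Gr n) → Dec (Dominating g)
dominating? g = any? λ x → any? λ y → ¬? (x ≟ y) ×-dec all? λ z → z ≟ x ⊎-dec z ≟ y ⊎-dec e g x z Bool.≟ true ×-dec e g y z Bool.≟ true

Pushes : (g : Gr n) (h : Gr m) → (Fin n → Fin m) → Set
Pushes g h f = ∀ u v → e g u v ≡ true → f u ≡ f v ⊎ e h (f u) (f v) ≡ true

-- A minor model on more than six vertices leaves a vertex unused or has an edge inside a branch set.
noK24 : ∀ d → Gr (d + 6) → Bool
noK24 zero    g = not (does (dominating? g))
noK24 (suc d) g = does (all? λ r → noK24 d (tabled (delete g r)) Bool.≟ true) ∧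
  does (all? λ r → all? λ x → e g r (punchIn r x) Bool.≟ true →-dec noK24 d (tabled (squash g r x)) Bool.≟ true)

K24-irr : ∀ h → ¬ Edge K24 h h
K24-irr h p = t≢f p (adj-irrefl K24 h)

push-walk : {g : Gr n} {h : Gr m} {f : Fin n → Fin m} → Pushes g h f → {P : Fin n → Set} {Q : Fin m → Set} →
  (∀ u → P u → Q (f u)) → ∀ {u v} → Walk ⟪ g ⟫ P u v → Walk ⟪ h ⟫ Q (f u) (f v)
push-walk ps q (here p) = here (q _ p)
push-walk {h = h} {f} ps {P} {Q} q {u} {v} (step {w = w} p uw ws) with ps u w uw | push-walk {h = h} {f} ps {P} {Q} q ws
... | inj₁ eq | r = subst (λ x → Walk ⟪ h ⟫ Q x (f v)) (sym eq) r
... | inj₂ fw | r = step (q _ p) fw r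

-- A model also descends along `f` if `f` identifies only vertices of the same branch set, which is
-- what `same` ensures. Edges of the model join different branch sets and so are never collapsed.
minor-push : {g : Gr n} {h : Gr m} (f : Fin n → Fin m) (s : Fin m → Fin n) → (∀ x → f (s x) ≡ x) → Pushes g h f →
  (M : K24-minor g) → (∀ u → proj₁ M (s (f u)) ≡ proj₁ M u) → K24-minor h
minor-push {g = g} {h} f s fs ps (ρ , ne , cn , ed) same = ρ ∘ s
  , (λ x → let (v , q) = ne x in f v , trans (same v) q)
  , (λ x u v p q → subst₂ (Walk ⟪ h ⟫ (λ w → ρ (s w) ≡ just x)) (fs u) (fs v)
      (push-walk {g = g} {h} {f} ps (λ w r → trans (same w) r) (cn x (s u) (s v) p q)))
  , λ x y xy → let (u , v , p , q , uv) = ed x y xy in f u , f v , trans (same u) p , trans (same v) q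
      , [ (λ eq → ⊥-elim (K24-irr x (subst (Edge K24 x) (Maybe.just-injective (trans (sym q) (trans (sym (same v)) (trans (cong (ρ ∘ s) (sym eq)) (trans (same u) p))))) xy))) , id ]′ (ps u v uv)

minor-≃ : {g : Gr n} {h : Gr m} → g ≃ h → K24-minor g → K24-minor h
minor-≃ {g = g} {h} i M = minor-push {g = g} {h} (π ⟨$⟩ʳ_) (π ⟨$⟩ˡ_) (λ _ → inverseʳ π)
  (λ u v p → inj₂ (trans (sym (_≃_.e-eq i u v)) p)) M (λ u → cong (proj₁ M) (inverseˡ π))
  where π = _≃_.perm i

module _ (g : Gr (suc n)) (r : Fin (suc n)) where
  minor-delete : (M : K24-minor g) → proj₁ M r ≡ nothing → K24-minor (delete g r)
  minor-delete (ρ , ne , cn , ed) rn = ρ ∘ punchIn r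
    , (λ x → let (v , q) = ne x ; (w , p) = back v q in w , trans (cong ρ p) q)
    , (λ x u v p q → walk x (cn x (punchIn r u) (punchIn r v) p q) refl refl)
    , λ x y xy → let (u , v , p , q , uv) = ed x y xy ; (u' , pu) = back u p ; (v' , pv) = back v q in
        u' , v' , trans (cong ρ pu) p , trans (cong ρ pv) q , trans (cong₂ (e g) pu pv) uv
    where
    back : ∀ {x} v → ρ v ≡ just x → ∃ λ w → punchIn r w ≡ v
    back v q with r ≟ v
    ... | yes refl = case trans (sym rn) q of λ ()
    ... | no p = punchOut p , punchIn-punchOut p
    walk : ∀ x {u v} → Walk ⟪ g ⟫ (λ w → ρ w ≡ just x) u v → ∀ {a b} → punchIn r a ≡ u → punchIn r b ≡ v →
      Walk ⟪ delete g r ⟫ (λ w → ρ (punchIn r w) ≡ just x) a b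
    walk x (here p) {a} refl q with punchIn-injective r _ _ q
    ... | refl = here p
    walk x (step p uw ws) {a} refl q with back _ (walk-start ws)
    ... | c , pc = step p (trans (cong (e g (punchIn r a)) pc) uw) (walk x ws pc q)

  module _ (x : Fin n) where
    private
      M = squash g r x
      f = absorb g r x
      off : ∀ y z → e g (punchIn r y) (punchIn r z) ≡ true → y ≡ z ⊎ e M y z ≡ true
      off y z p with y ≟ z
      ... | yes q = inj₁ q
      ... | no _ = inj₂ (∨-l p)
        where
        ∨-l : ∀ {a b} → a ≡ true → a ∨ b ≡ true
        ∨-l refl = refl
      at : ∀ z → e g r (punchIn r z) ≡ true → x ≡ z ⊎ e M x z ≡ true
      at z p = go (x ≟ z)
        where
        go : Dec (x ≡ z) → x ≡ z ⊎ e M x z ≡ true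
        go (yes q) = inj₁ q
        go (no q) = inj₂ (trans (sy M x z) (trans (squash-at g r x z (q ∘ sym)) (∨-r _ (esym g p))))
      ps : Pushes g M f
      ps u v p with punchView r u | punchView r v
      ... | new | new = inj₁ refl
      ... | new | old z rewrite absorb-r g r x | absorb-in g r x z = at z p
      ... | old y | new rewrite absorb-r g r x | absorb-in g r x y = Sum.map sym (trans (sy M y x)) (at y (esym g p))
      ... | old y | old z rewrite absorb-in g r x y | absorb-in g r x z = off y z p

    minor-squash : (m : K24-minor g) → proj₁ m r ≡ proj₁ m (punchIn r x) → K24-minor M
    minor-squash m@(ρ , _) q = minor-push {g = g} {M} f (punchIn r) (absorb-in g r x) ps m same
      where
      same : ∀ u → ρ (punchIn r (f u)) ≡ ρ u
      same u with punchView r u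
      ... | new = trans (cong (ρ ∘ punchIn r) (absorb-r g r x)) (sym q)
      ... | old y = cong (ρ ∘ punchIn r) (absorb-in g r x y)

-- Six nonempty branch sets on six vertices are single vertices.
minor-dominating : (g : Gr 6) → K24-minor g → Dominating g
minor-dominating g (ρ , ne , cn , ed) = b zero , b 1F
  , (λ q → case trans (sym (pb zero)) (trans (cong ρ q) (pb 1F)) of λ ())
  , every
  where
  b : Fin 6 → Fin 6
  b h = proj₁ (ne h)
  pb : ∀ h → ρ (b h) ≡ just h
  pb h = proj₂ (ne h)
  b-inj : ∀ {h h'} → b h ≡ b h' → h ≡ h'
  b-inj {h} {h'} q = Maybe.just-injective (trans (sym (pb h)) (trans (cong ρ q) (pb h')))
  onto : ∀ z → ∃ λ h → b h ≡ z
  onto z with any? (λ h → b h ≟ z)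
  ... | yes p = p
  ... | no ¬p with Fin.pigeonhole ℕ.≤-refl (λ h → punchOut (avoid h))
    where
    avoid : ∀ h → z ≢ b h
    avoid h q = ¬p (h , sym q)
  ... | i , j , i<j , eq = ⊥-elim (Fin.<⇒≢ i<j (b-inj (Fin.punchOut-injective (λ q → ¬p (i , sym q)) (λ q → ¬p (j , sym q)) eq)))
  inj : ∀ u v → ρ u ≡ ρ v → u ≡ v
  inj u v q with onto u | onto v
  ... | h , refl | h' , refl = cong b (Maybe.just-injective (trans (sym (pb h)) (trans q (pb h'))))
  edge : ∀ h h' → Edge K24 h h' → e g (b h) (b h') ≡ true
  edge h h' p with ed h h' p
  ... | u , v , pu , pv , uv = subst₂ (λ x y → e g x y ≡ true) (inj u (b h) (trans pu (sym (pb h)))) (inj v (b h') (trans pv (sym (pb h')))) uv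
  every : ∀ z → z ≡ b zero ⊎ z ≡ b 1F ⊎ e g (b zero) z ≡ true × e g (b 1F) z ≡ true
  every z with onto z
  ... | zero , refl = inj₁ refl
  ... | suc zero , refl = inj₂ (inj₁ refl)
  ... | suc (suc h) , refl = inj₂ (inj₂ (edge zero (2 ↑ʳ h) (left h) , edge 1F (2 ↑ʳ h) (right h)))
    where
    left : ∀ h → Edge K24 zero (2 ↑ʳ h)
    left zero = refl
    left 1F = refl
    left 2F = refl
    left 3F = refl
    right : ∀ h → Edge K24 1F (2 ↑ʳ h)
    right zero = refl
    right 1F = refl
    right 2F = refl
    right 3F = refl

classes : ∀ d (ρ : Fin (suc d + 6) → Maybe (Fin 6)) →
  (∃ λ v → ρ v ≡ nothing) ⊎ (∃ λ u → ∃ λ v → ∃ λ h → u ≢ v × ρ u ≡ just h × ρ v ≡ just h)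
classes d ρ with any? (λ v → Maybe.≡-dec _≟_ (ρ v) nothing)
... | yes p = inj₁ p
... | no ¬n = let (i , j , i<j , eq) = Fin.pigeonhole (s≤s (ℕ.m≤n+m 6 d)) (proj₁ ∘ value) in
  inj₂ (i , j , _ , Fin.<⇒≢ i<j , proj₂ (value i) , trans (proj₂ (value j)) (cong just (sym eq)))
  where
  value : ∀ v → ∃ λ h → ρ v ≡ just h
  value v with ρ v in p
  ... | just h = h , refl
  ... | nothing = ⊥-elim (¬n (v , p))

-- If every vertex is used, two of them share a branch set; the first edge of a walk between them
-- inside that set can be contracted without spoiling the model.
noK24-sound : ∀ d (g : Gr (d + 6)) → noK24 d g ≡ true → ¬ K24-minor g
noK24-sound zero g ok M = t≢f ok (cong not (does-yes (dominating? g) (minor-dominating g M)))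
noK24-sound (suc d) g ok M@(ρ , ne , cn , ed) = cases (classes d ρ)
  where
  both = ∧-inv (does (all? λ r → noK24 d (tabled (delete g r)) Bool.≟ true)) ok
  del : ∀ r → noK24 d (tabled (delete g r)) ≡ true
  del = does-true (all? λ r → noK24 d (tabled (delete g r)) Bool.≟ true) (proj₁ both)
  con : ∀ r x → e g r (punchIn r x) ≡ true → noK24 d (tabled (squash g r x)) ≡ true
  con = does-true (all? λ r → all? λ x → e g r (punchIn r x) Bool.≟ true →-dec noK24 d (tabled (squash g r x)) Bool.≟ true) (proj₂ both)
  at : ∀ u w → u ≢ w → e g u w ≡ true → ρ u ≡ ρ w → ⊥
  at u w u≢w uw q = noK24-sound d (tabled (squash g u x)) (con u x (trans (cong (e g u) xw) uw))
    (minor-≃ (tabled-≃ (squash g u x)) (minor-squash g u x M (trans q (cong ρ (sym xw)))))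
    where
    x = punchOut u≢w
    xw : punchIn u x ≡ w
    xw = punchIn-punchOut u≢w
  first-step : ∀ {h u v} → u ≢ v → Walk ⟪ g ⟫ (λ w → ρ w ≡ just h) u v → ⊥
  first-step u≢v (here _) = u≢v refl
  first-step u≢v (step p uw ws) = at _ _ (edge≢ g uw) uw (trans p (sym (walk-start ws)))
  cases : (∃ λ v → ρ v ≡ nothing) ⊎ (∃ λ u → ∃ λ v → ∃ λ h → u ≢ v × ρ u ≡ just h × ρ v ≡ just h) → ⊥
  cases (inj₁ (v , q)) = noK24-sound d (tabled (delete g v)) (del v) (minor-≃ (tabled-≃ (delete g v)) (minor-delete g v M q))
  cases (inj₂ (u , v , h , u≢v , p , q)) = first-step u≢v (cn h u v p q)

abstract
  noK24-GA⁺ : noK24 0 (tabled (gr GA⁺)) ≡ true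
  noK24-GA⁺ = refl

  noK24-GB⁺ : noK24 1 (tabled (gr GB⁺)) ≡ true
  noK24-GB⁺ = refl

  noK24-GD : noK24 1 (tabled (gr GD)) ≡ true
  noK24-GD = refl

  noK24-GC⁺ : noK24 2 (tabled (gr GC⁺)) ≡ true
  noK24-GC⁺ = refl

-- Certificates and placements for three-hub graphs

certs7 : List ℕ
certs7 =
  1416251301202010211 ∷ 1416251302101020122 ∷ 1416251310204010411 ∷ 1416251312004020422 ∷ 1162251421320400234 ∷
  1416251321002040244 ∷ 1261111542310400162 ∷ 1261111543210400251 ∷ 1162251423140400134 ∷ 1511162242311040026 ∷
  1462511320101400154 ∷ 1416251311244010211 ∷ 1261541301200211211 ∷ 1261541302100122122 ∷ 1511162242314010026 ∷
  1511162224321020046 ∷ 1462511321002402064 ∷ 1511622431224200112 ∷ 1511162224342010045 ∷ 1511622412311400224 ∷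
  1361524121224201062 ∷ 1511162243212040015 ∷ 1416251312124020122 ∷ 1416251311242010411 ∷ 1406152312000240264 ∷
  1416225132161002021 ∷ 1261541310200411411 ∷ 1416225121322040043 ∷ 1261541312000422422 ∷ 1111622254300404033 ∷
  1111622254300202055 ∷ 1416225123141040043 ∷ 1116222514320002164 ∷ 1116222514302020154 ∷ 1406152310200140154 ∷
  1416251312121020422 ∷ 1511622413212400114 ∷ 1162251432140200152 ∷ 1416225112314002025 ∷ 1162251412310020452 ∷
  1511622432144100221 ∷ 1361524112212401064 ∷ 1261111543220200431 ∷ 1162251413210010461 ∷ 1116222541304040132 ∷
  1511162242340410023 ∷ 1416225131262001012 ∷ 1462511312004204062 ∷ 1511162243222040013 ∷ 1316514010204114110 ∷
  1416251113214010214 ∷ 1406251312120420162 ∷ 1416251132141020421 ∷ 1162251431220010261 ∷ 1511162243214020015 ∷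
  1511162242344010023 ∷ 1416251131222010412 ∷ 1462511310204104051 ∷ 1406251311240410251 ∷ 1162251421320040234 ∷
  1361524102102102031 ∷ 1111162254300040433 ∷ 1316514012004224220 ∷ 1511622413214200114 ∷ 1426115310201004145 ∷
  1162225141300104063 ∷ 1062251114344210005 ∷ 1062251114324120006 ∷ 1462511302101200132 ∷ 1116222514340001254 ∷
  1162225143100600053 ∷ 1111622254300101066 ∷ 1511162243224020013 ∷ 1261111543220400231 ∷ 1261115024320021460 ∷
  1416251321111040244 ∷ 1116222541340001432 ∷ 1411625321000204246 ∷ 1361524101201201032 ∷ 1116222541310040162 ∷
  1261115024340012450 ∷ 1411625320100104145 ∷ 1361524122144102051 ∷ 1416251321112040144 ∷ 1511162224322010046 ∷
  1162250043120421030 ∷ 1162251432140020152 ∷ 1162251423140040134 ∷ 1411652302100121221 ∷ 1162225114300102065 ∷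
  1162225141340401023 ∷ 1416225113214001016 ∷ 1162225143100600035 ∷ 1511162224340210045 ∷ 1411625310200401415 ∷
  1116222514301001264 ∷ 1116222514301010264 ∷ 1116222543104040231 ∷ 1416225312121002426 ∷ 1426115312002004246 ∷
  1062251141312140006 ∷ 1416225121302041043 ∷ 1116222514320020164 ∷ 1411625302101002123 ∷ 1006115243220124003 ∷
  1061115224344021005 ∷ 1162225143100024053 ∷ 1261111543210200451 ∷ 1511622431222400112 ∷ 1162225143100060035 ∷
  1406115301200120133 ∷ 1400615301200012133 ∷ 1511622431202404112 ∷ 1361524112211402054 ∷ 1111162254300020255 ∷
  1162225143100240053 ∷ 1416225132141002025 ∷ 1116222514301002164 ∷ 1416225112304021025 ∷ 1416225123141004043 ∷
  1116222543110040251 ∷ 1416225121322004043 ∷ 1511622432101404221 ∷ 1261115042310041260 ∷ 1061115224324012006 ∷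
  1511622421302101442 ∷ 1411652321000242442 ∷ 1511622423101202441 ∷ 1416250320101041045 ∷ 1511622412320401224 ∷
  1111162254300010166 ∷ 1416251321222010244 ∷ 1511622423110102441 ∷ 1162514301200102123 ∷ 1261115042340104230 ∷
  1416225112314020025 ∷ 1162225114300201056 ∷ 1022611154303404003 ∷ 1162225114300201065 ∷ 1511622432120104221 ∷
  1162225143100042053 ∷ 1462511320101401054 ∷ 1511116243212004015 ∷ 1511116242311004026 ∷ 1511622421310201442 ∷
  1162225141300401036 ∷ 1111162254300040136 ∷ 1006115242340214003 ∷ 1511622431240204112 ∷ 1162225141300041063 ∷
  1416225321112004145 ∷ 1416225131222001016 ∷ 1416251322141040122 ∷ 1116222514340010254 ∷ 1511162224341020045 ∷
  1162225141300050063 ∷ 1406150302100212033 ∷ 1116222541340010432 ∷ 1111162254300040235 ∷ 1162225141300014036 ∷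
  1162225141300041036 ∷ 1511622421301201442 ∷ 1416251322141020144 ∷ 1511622413240402114 ∷ 1416225121302014043 ∷
  1162225143100402035 ∷ 1411625301200201213 ∷ 1226111054304041230 ∷ 1316514001202112110 ∷ 1162225114300012056 ∷
  1162225114300102056 ∷ 1511622432141400221 ∷ 1426511302102121012 ∷ 1426511320104141014 ∷ 1511162224300120146 ∷
  1511162242300140126 ∷ 1116222541310010462 ∷ 1111162254300020453 ∷ 1406150310200141055 ∷ 1162225114300021065 ∷
  1162225114300012065 ∷ 1162225141340014023 ∷ 1162225143100240035 ∷ 1162225114340102045 ∷ 1162225114300021056 ∷
  1162225141300014063 ∷ 1416225123101042043 ∷ 1162225143100024035 ∷ 1116222543120020431 ∷ 1116222543102020451 ∷
  1116222541301010462 ∷ 1162225141300401063 ∷ 1162225141300500036 ∷ 1226111054301012460 ∷ 1006115242340241003 ∷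
  1006115243220142003 ∷ 1511622421302104142 ∷ 1511622412304102124 ∷ 1511162243200240116 ∷ 1261111524320100264 ∷
  1261111542310100462 ∷ 1062251143111420005 ∷ 1162225141300140036 ∷ 1416225112304012025 ∷ 1162225143120024013 ∷
  1162225143100006053 ∷ 1511162224342100045 ∷ 1261111524320200164 ∷ 1416225113204012016 ∷ 1511162224321200046 ∷
  1511116224321002046 ∷ 1416225321111004246 ∷ 1162250041310142060 ∷ 1226111054302012450 ∷ 1511622423101204241 ∷
  1111162254300010463 ∷ 1226111054302021450 ∷ 1416225123101024043 ∷ 1226111054304024130 ∷ 1162225143100420053 ∷
  1511622413204202114 ∷ 1162225114340201045 ∷ 1511622413202402114 ∷ 1416251320101040144 ∷ 1116222541301001462 ∷
  1226111054304014230 ∷ 1511162242341040023 ∷ 1511116243224002013 ∷ 1416225311242001415 ∷ 1006115224340412005 ∷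
  1162251413210100461 ∷ 1406152301200120132 ∷ 1162251412310200452 ∷ 1062251141342140003 ∷ 1416250302101021023 ∷
  1511162242304010126 ∷ 1511162243200420116 ∷ 1111162254300020156 ∷ 1511622421301204142 ∷ 1162225141300005063 ∷
  1162225143100006035 ∷ 1261111542340400132 ∷ 1162225143100060053 ∷ 1162225143100204053 ∷ 1406251311240210431 ∷
  1111162254300010265 ∷ 1061115243221024003 ∷ 1411652320100141441 ∷ 1162251431220100261 ∷ 1162225114340012045 ∷
  1261115043210042150 ∷ 1511162243200240215 ∷ 1416251123141040241 ∷ 1511622423102102441 ∷ 1416225113204021016 ∷
  1162225114300003065 ∷ 1162225141300005036 ∷ 1511116242344001023 ∷ 1406150301200121033 ∷ 1062514311244102103 ∷
  1511622423102104241 ∷ 1416225312124002123 ∷ 1062514311242104105 ∷ 1162225143100204035 ∷ 1511116224342001045 ∷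
  1062251143111240005 ∷ 1162225141300410036 ∷ 1062514312121204206 ∷ 1261111542340100432 ∷ 1511162224302010146 ∷
  1261111524340100254 ∷ 1511622412304101224 ∷ 1116222514340020154 ∷ 1511162242300140225 ∷ 1162225114300003056 ∷
  1116222514320010264 ∷ 1261115024320201460 ∷ 1062251143121240003 ∷ 1162225143100402053 ∷ 1416225311244001213 ∷
  1162225141300140063 ∷ 1511162242300410225 ∷ 1361524122142104031 ∷ 1261111524340200154 ∷ 1116222543102002451 ∷
  1416225132101024025 ∷ 1162225141300104036 ∷ 1361524121221204032 ∷ 1416225131202014016 ∷ 1416251112314020124 ∷
  1416251121322040142 ∷ 1511162224301020245 ∷ 1461500301201210033 ∷ 1511162224300210443 ∷ 1162225141300500063 ∷
  1162225143100042035 ∷ 1416225131202041016 ∷ 1062541312124242102 ∷ 1511162242300410423 ∷ 1162225141340104023 ∷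
  1062251141342410003 ∷ 1162225141300410063 ∷ 1062251143121420003 ∷ 1162225114300210065 ∷ 1162225114300120065 ∷
  1261115043220024130 ∷ 1162225114300210056 ∷ 1162225114300120056 ∷ 1511162224300120443 ∷ 1162225114300030065 ∷
  1062251114304120205 ∷ 1511162243204020215 ∷ 1416225132101042025 ∷ 1162225141300050036 ∷ 1511622431202401412 ∷
  1511622413202401214 ∷ 1261115043220402130 ∷ 1062541311244121201 ∷ 1062541311244141201 ∷ 1511162243202040413 ∷
  1511162242344100023 ∷ 1062541312124212102 ∷ 1511162242301040423 ∷ 1511162243200420215 ∷ 1062541311242121401 ∷
  1062541321112414104 ∷ 1406251321110240164 ∷ 1511622413204201214 ∷ 1116222541304001432 ∷ 1406251312120120432 ∷
  1022611154306101006 ∷ 1406251321110140254 ∷ 1062251141302140403 ∷ 1062251143101240403 ∷ 1162225114300030056 ∷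
  1511622432104102421 ∷ 1116222543104002431 ∷ 1511622432101402421 ∷ 1162225114300300065 ∷ 1162225114300300056 ∷ []

abstract
  bad7 : AllBad 5 certs7
  bad7 = refl , refl

-- The number in these names counts path vertices. Two of them make a graph on five vertices, too
-- few for six branch sets, so there is nothing to certify.
certs2 placements2 : List ℕ
certs2 =
  []
placements2 =
  1241300 ∷ 1240310 ∷ 1140320 ∷ 1432101 ∷ []

certs3 placements3 : List ℕ
certs3 =
  16154235522 ∷ 16154323611 ∷ 16152436344 ∷ 15643126333 ∷ 15641325555 ∷ 15641233666 ∷ 11625430077 ∷ []
placements3 =
  13152400 ∷ 13052410 ∷ 13251400 ∷ 13051420 ∷ 13250410 ∷ 13150420 ∷ 15230410 ∷ 15231400 ∷ 15032410 ∷ 15132400 ∷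
  15031420 ∷ 15130420 ∷ 15324102 ∷ 15324103 ∷ 15321403 ∷ 15320413 ∷ 14103523 ∷ 13524104 ∷ 13521404 ∷ 13520414 ∷
  15314202 ∷ 15314203 ∷ 15312403 ∷ 15310423 ∷ 14203513 ∷ 13514204 ∷ 13512404 ∷ 10423514 ∷ 14215302 ∷ 15304213 ∷
  15302413 ∷ 15301423 ∷ 14213503 ∷ 14213504 ∷ 12413504 ∷ 11423504 ∷ 14105323 ∷ 15324104 ∷ 15321404 ∷ 15320414 ∷
  14205313 ∷ 15314204 ∷ 15312404 ∷ 10425314 ∷ 14215303 ∷ 14215304 ∷ 12415304 ∷ 11425304 ∷ []

certs4 placements4 : List ℕ
certs4 =
  1611542354122 ∷ 1611543234211 ∷ 1526143126013 ∷ 1611542351422 ∷ 1611543232411 ∷ 1526141345023 ∷ 1611524362144 ∷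
  1561413251451 ∷ 1516024363440 ∷ 1561412332462 ∷ 1611524361244 ∷ 1162541340532 ∷ 1162543120631 ∷ 1526143116015 ∷
  1526114343045 ∷ 1162543110651 ∷ 1162541310562 ∷ 1061524364304 ∷ 1561421334264 ∷ 1526141315026 ∷ 1162514340354 ∷
  1526114323046 ∷ 1162514320364 ∷ 1506431260333 ∷ 1516043236110 ∷ 1516042355220 ∷ 1516413254115 ∷ 1116254304037 ∷
  1116254302057 ∷ 1116254301067 ∷ 1061542352502 ∷ 1061543231601 ∷ 1165432142353 ∷ 1165431221363 ∷ 1165413211565 ∷
  1560431263033 ∷ 1465132143235 ∷ 1465112316265 ∷ 1465131223136 ∷ 1465113215156 ∷ 1465311245353 ∷ 1465123145453 ∷
  1465121326463 ∷ 1165412312656 ∷ 1165423144535 ∷ 1165421324636 ∷ 1465312126363 ∷ 1561431261231 ∷ 1516431262113 ∷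
  1516432161223 ∷ 1561432162132 ∷ 1516412334226 ∷ 1561423154154 ∷ 1516421332446 ∷ 1261154300473 ∷ 1465311243535 ∷
  1465312123636 ∷ 1261154300275 ∷ 1516423151445 ∷ 1261154300176 ∷ 1465321116565 ∷ 1465321115656 ∷ 1465311245335 ∷
  1560413255055 ∷ 1506413250555 ∷ 1465312126336 ∷ 1465321116556 ∷ 1560412336066 ∷ 1506412330666 ∷ 1465311243553 ∷
  1465312123663 ∷ 1465321115665 ∷ []
placements4 =
  143062510 ∷ 156031420 ∷ 143162500 ∷ 156130420 ∷ 143061520 ∷ 156032410 ∷ 143261500 ∷ 156230410 ∷ 143160520 ∷
  156132400 ∷ 143260510 ∷ 156231400 ∷ 161234500 ∷ 131652400 ∷ 130652410 ∷ 162134500 ∷ 162431500 ∷ 156213400 ∷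
  131562400 ∷ 162034510 ∷ 162430510 ∷ 130562410 ∷ 156203410 ∷ 161432500 ∷ 156123400 ∷ 132561400 ∷ 132651400 ∷
  130651420 ∷ 161430520 ∷ 130561420 ∷ 156103420 ∷ 161034520 ∷ 160432510 ∷ 160234510 ∷ 156023410 ∷ 132560410 ∷
  160431520 ∷ 131560420 ∷ 156013420 ∷ 160134520 ∷ 132650410 ∷ 131650420 ∷ 126031540 ∷ 126130540 ∷ 123061540 ∷
  116230540 ∷ 123160540 ∷ 113260540 ∷ 152031640 ∷ 152130640 ∷ 151032640 ∷ 151230640 ∷ 150132640 ∷ 150231640 ∷
  142160530 ∷ 142061530 ∷ 141260530 ∷ 141062530 ∷ 140261530 ∷ 140162530 ∷ 115624305 ∷ 105624315 ∷ 141326505 ∷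
  140326515 ∷ 136105425 ∷ 136105426 ∷ 164135209 ∷ 135264109 ∷ 164523015 ∷ 135416025 ∷ 132416055 ∷ 164523016 ∷
  161523045 ∷ 161523046 ∷ 135416026 ∷ 132416056 ∷ 164035219 ∷ 135624109 ∷ 164523105 ∷ 135406125 ∷ 132406155 ∷
  164523106 ∷ 135406126 ∷ 132406156 ∷ 160523145 ∷ 160523146 ∷ 115624306 ∷ 120436519 ∷ 105624316 ∷ 121436509 ∷
  135426015 ∷ 164513025 ∷ 131426055 ∷ 164513026 ∷ 162513045 ∷ 162513046 ∷ 164235109 ∷ 135164209 ∷ 135426016 ∷
  131426056 ∷ 125614305 ∷ 142316505 ∷ 136205415 ∷ 136205416 ∷ 140316525 ∷ 105614325 ∷ 164305219 ∷ 164513205 ∷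
  135406215 ∷ 164513206 ∷ 131406255 ∷ 135406216 ∷ 131406256 ∷ 135614209 ∷ 160513245 ∷ 160513246 ∷ 125614306 ∷
  110436529 ∷ 105614326 ∷ 112436509 ∷ 135426105 ∷ 164503125 ∷ 164503126 ∷ 130426155 ∷ 162503145 ∷ 162503146 ∷
  164325109 ∷ 135426106 ∷ 130426156 ∷ 135064219 ∷ 135416205 ∷ 164503215 ∷ 164503216 ∷ 130416255 ∷ 164315209 ∷
  135416206 ∷ 130416256 ∷ 161503245 ∷ 161503246 ∷ 135604219 ∷ 136215405 ∷ 136215406 ∷ 142306515 ∷ 141306525 ∷
  125604315 ∷ 115604325 ∷ 125604316 ∷ 101436529 ∷ 115604326 ∷ 102436519 ∷ 141326506 ∷ 140326516 ∷ 125164309 ∷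
  125064319 ∷ 142316506 ∷ 140316526 ∷ 115264309 ∷ 115064329 ∷ 142306516 ∷ 141306526 ∷ 105264319 ∷ 105164329 ∷ []

certs5 placements5 : List ℕ
certs5 =
  151162423441023 ∷ 151162432242013 ∷ 116225413401432 ∷ 151624312620112 ∷ 151162423414023 ∷ 116225431202431 ∷
  151624231510441 ∷ 146152132414053 ∷ 151624213320442 ∷ 151624132540114 ∷ 151162423114026 ∷ 151162432224013 ∷
  116225143401254 ∷ 161115432340211 ∷ 116225431102451 ∷ 151160243612440 ∷ 116225413104162 ∷ 116225413101462 ∷
  116225143201264 ∷ 111622543040433 ∷ 116225143202164 ∷ 146152123224063 ∷ 116254231404135 ∷ 146153212242163 ∷
  151162243421045 ∷ 146152312412035 ∷ 116225431104251 ∷ 116254321402153 ∷ 151600432361010 ∷ 146152213142065 ∷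
  151162243212046 ∷ 116254312201263 ∷ 116225431204231 ∷ 111622543020255 ∷ 106115423524102 ∷ 116254213204236 ∷
  111622543020453 ∷ 111622543010463 ∷ 161115423540122 ∷ 151160243621440 ∷ 151162432124015 ∷ 111622543040235 ∷
  111622543010166 ∷ 106115243642104 ∷ 116225413404132 ∷ 151162243412045 ∷ 151160423514220 ∷ 111622543010265 ∷
  111622543040136 ∷ 111622543020156 ∷ 151624123340224 ∷ 116254132101465 ∷ 116254123102456 ∷ 146153221441253 ∷
  146152231141056 ∷ 146152321221036 ∷ 151160432324110 ∷ 146153122124165 ∷ 100615432301601 ∷ 146153212212436 ∷
  146153122114256 ∷ 146153221421435 ∷ 116251431006053 ∷ 106115432314201 ∷ 151624132160114 ∷ 116225143402154 ∷
  151162432142015 ∷ 146051312230136 ∷ 146051132150156 ∷ 116251413005063 ∷ 100615423502502 ∷ 151162423141026 ∷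
  151162243221046 ∷ 161115243620144 ∷ 116251143003065 ∷ 116251431006035 ∷ 116250143403450 ∷ 151160423541220 ∷
  116250143203460 ∷ 161115243610244 ∷ 116251413005036 ∷ 106251143443005 ∷ 151162423450023 ∷ 151264312065213 ∷
  161115432320411 ∷ 116225413004172 ∷ 116225143200364 ∷ 116251143003056 ∷ 151264321056123 ∷ 146051321430235 ∷
  116225431200631 ∷ 116225431100651 ∷ 156124231043651 ∷ 116225413100562 ∷ 156124213043562 ∷ 116225431004271 ∷
  151162243430045 ∷ 116225143400354 ∷ 151600423552020 ∷ 151162243230046 ∷ 151162423150026 ∷ 151162432260013 ∷
  146051123160265 ∷ 116250413105260 ∷ 156124123025364 ∷ 151264231036145 ∷ 161115423510422 ∷ 116225143002174 ∷
  116225413400532 ∷ 116054312210363 ∷ 156124321025631 ∷ 116225431002471 ∷ 151264132063415 ∷ 116225143001274 ∷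
  151264123053426 ∷ 156124312016532 ∷ 146051231450453 ∷ 146051213260463 ∷ 156124132016354 ∷ 151264213035246 ∷
  116054321420353 ∷ 151162432160015 ∷ 116054231440535 ∷ 106251431116005 ∷ 116054132110565 ∷ 116054213240636 ∷
  116054123120656 ∷ 106251413425003 ∷ 106251431216003 ∷ 116225413001472 ∷ 106115243641204 ∷ 151160432342110 ∷
  111162543004037 ∷ 111162543002057 ∷ 111162543001067 ∷ 116250431206130 ∷ 116250431106150 ∷ 106251413125006 ∷
  106251143243006 ∷ 116250413405230 ∷ 106115432312401 ∷ 106115423521402 ∷ []
placements5 =
  1713452600 ∷ 1715432600 ∷ 1543072610 ∷ 1567031420 ∷ 1543172600 ∷ 1567130420 ∷ 1543071620 ∷ 1567032410 ∷ 1543271600 ∷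
  1567230410 ∷ 1543170620 ∷ 1567132400 ∷ 1543270610 ∷ 1567231400 ∷ 1712345600 ∷ 1315672400 ∷ 1305672410 ∷ 1567123400 ∷
  1430762510 ∷ 1317652400 ∷ 1307652410 ∷ 1721345600 ∷ 1725431600 ∷ 1567213400 ∷ 1720345610 ∷ 1725430610 ∷ 1567203410 ∷
  1325671400 ∷ 1432761500 ∷ 1327651400 ∷ 1307651420 ∷ 1430761520 ∷ 1305671420 ∷ 1567103420 ∷ 1715430620 ∷ 1710345620 ∷
  1705432610 ∷ 1702345610 ∷ 1567023410 ∷ 1325670410 ∷ 1315670420 ∷ 1567013420 ∷ 1705431620 ∷ 1701345620 ∷ 1327650410 ∷
  1317650420 ∷ 1432760510 ∷ 1431760520 ∷ 1527031640 ∷ 1513072640 ∷ 1527130640 ∷ 1503172640 ∷ 1517032640 ∷ 1523071640 ∷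
  1503271640 ∷ 1517230640 ∷ 1523170640 ∷ 1507132640 ∷ 1513270640 ∷ 1507231640 ∷ 1175624307 ∷ 1175624308 ∷ 1532417607 ∷
  1532417608 ∷ 1075624317 ∷ 1075624318 ∷ 1532407617 ∷ 1532407618 ∷ 1275614307 ∷ 1275614308 ∷ 1531427607 ∷ 1531427608 ∷
  1531407627 ∷ 1531407628 ∷ 1075614327 ∷ 1075614328 ∷ 1530427617 ∷ 1275604317 ∷ 1275604318 ∷ 1530427618 ∷ 1530417627 ∷
  1530417628 ∷ 1175604327 ∷ 1175604328 ∷ []

certs6 placements6 : List ℕ
certs6 =
  15226114134410023 ∷ 12261115430404033 ∷ 14615232010410451 ∷ 14615232100420462 ∷ 15226114312420013 ∷
  12611154234001432 ∷ 14162530210102123 ∷ 14615231200240264 ∷ 14625131212420162 ∷ 12261115430202055 ∷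
  14162530120201213 ∷ 14615231020140154 ∷ 12261115430204053 ∷ 14615030210212033 ∷ 15226114311240015 ∷
  15226114131140026 ∷ 11625142132040234 ∷ 15226111434210045 ∷ 11116225430040433 ∷ 16111154323400211 ∷
  15226111432120046 ∷ 15226114134140023 ∷ 11625142314040134 ∷ 14625131124410251 ∷ 15261143122102421 ∷
  12611152434001254 ∷ 12261115430104063 ∷ 12611154321040251 ∷ 12611154231040162 ∷ 14165231020414114 ∷
  12611152432002164 ∷ 14162531212102426 ∷ 14162512132204043 ∷ 14162531020401415 ∷ 16111154235400122 ∷
  14162512314104043 ∷ 12261115430402035 ∷ 14265131212242142 ∷ 11625141231020452 ∷ 11625143214020152 ∷
  15226114130410423 ∷ 14162513214102025 ∷ 14162531200402426 ∷ 12261115430102065 ∷ 14162513122201016 ∷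
  14162511321401016 ∷ 14625132111240164 ∷ 12261115430101066 ∷ 11622514310060053 ∷ 14162532010104145 ∷
  14162511231402025 ∷ 14265131124141241 ∷ 15116004323241010 ∷ 12611154234004132 ∷ 14162532100204246 ∷
  15226111434120045 ∷ 14165231200424224 ∷ 11622514310060035 ∷ 14615230120120132 ∷ 11116225430020255 ∷
  11625041321014065 ∷ 14162531124201415 ∷ 11625043122012063 ∷ 10611154323140201 ∷ 15111604323402110 ∷
  15226111430120146 ∷ 14625131124210431 ∷ 10611524322124003 ∷ 16111154323200411 ∷ 11622501434012450 ∷
  11622501432021460 ∷ 15116004235142020 ∷ 11116225430010166 ∷ 12611154322002431 ∷ 14165230120212112 ∷
  10611522432412006 ∷ 15226114312240013 ∷ 10611522434421005 ∷ 12611154322040231 ∷ 15111624231401026 ∷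
  12611154234040132 ∷ 15111622432201046 ∷ 14625132111140254 ∷ 11116225430040136 ∷ 11622504134014230 ∷
  15226114310420413 ∷ 12611154234010432 ∷ 11622514130041063 ∷ 15226114311420015 ∷ 10611524231214006 ∷
  10611154323120401 ∷ 15160002436340040 ∷ 10611524234241003 ∷ 11622514130050063 ∷ 11116225430040235 ∷
  14615230210210231 ∷ 10611154235240102 ∷ 11622504131041260 ∷ 11625141321010461 ∷ 11622514130014036 ∷
  11625143122010261 ∷ 11622514130041036 ∷ 11622514310024053 ∷ 12611152434002154 ∷ 15226114310420116 ∷
  12261115430401036 ∷ 11116225430020453 ∷ 11622511430012056 ∷ 11622511430012065 ∷ 15111624231104026 ∷
  12611152434010254 ∷ 11622511430021065 ∷ 15261141231201442 ∷ 12611152434020154 ∷ 15226114130410126 ∷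
  11622511430021056 ∷ 15226111432210046 ∷ 15226114130140126 ∷ 11622514130014063 ∷ 15111624321204015 ∷
  11622514310024035 ∷ 12611543212001263 ∷ 15160004323610010 ∷ 15111622432102046 ∷ 15111624234401023 ∷
  12611154322004231 ∷ 15111622434201045 ∷ 12611542311001465 ∷ 12611541232004236 ∷ 12611542131002456 ∷
  15111604323204110 ∷ 15160004235520020 ∷ 10006154323001601 ∷ 11622514310042053 ∷ 11116225430010463 ∷
  14265131124121421 ∷ 15261142132401224 ∷ 16111154235100422 ∷ 12611152432020164 ∷ 15226111430210245 ∷
  12611543124002153 ∷ 11622514310006053 ∷ 15226111430120443 ∷ 15226114130410225 ∷ 15111624322204013 ∷
  15226111430210146 ∷ 12261115430201056 ∷ 12611541324004135 ∷ 11625043214021053 ∷ 12611154321004251 ∷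
  12611154231004162 ∷ 11622504312042130 ∷ 11116225430020156 ∷ 12611154322020431 ∷ 15226111430210443 ∷
  14061523212021036 ∷ 14061522311041056 ∷ 11622514130005063 ∷ 11622514310006035 ∷ 12611154321020451 ∷
  15226114310240116 ∷ 15111604235104220 ∷ 10061154323014201 ∷ 11116225430010265 ∷ 15226114130140225 ∷
  14162531124401213 ∷ 15111624321402015 ∷ 15111622434102045 ∷ 14162532111104246 ∷ 11622511430003065 ∷
  11622514130005036 ∷ 14162532111204145 ∷ 12611154231010462 ∷ 15111624322402013 ∷ 15226114310240215 ∷
  15111624234104023 ∷ 10006154235002502 ∷ 10061154235024102 ∷ 11622511430003056 ∷ 14162531212402123 ∷
  15261142310601214 ∷ 12611152432010264 ∷ 14625131212120432 ∷ 11622514310042035 ∷ 15226114310420215 ∷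
  16111152436200144 ∷ 16111152436100244 ∷ 10006152436004304 ∷ 15226114310240413 ∷ 15226114130140423 ∷
  11622511430030065 ∷ 11622514130050036 ∷ 11622504134041230 ∷ 10611524322142003 ∷ 14265132111424124 ∷
  15226111430120245 ∷ 10611524321124005 ∷ 11622504312024130 ∷ 14265131212212412 ∷ 11622504311042150 ∷
  14265132111414214 ∷ 11622511430030056 ∷ []
placements6 =
  18134562700 ∷ 17813452600 ∷ 14328761500 ∷ 16543082710 ∷ 15678031420 ∷ 13156782400 ∷ 16543182700 ∷ 15678130420 ∷
  13056782410 ∷ 18165432700 ∷ 16543081720 ∷ 15678032410 ∷ 18234561700 ∷ 13287651400 ∷ 16543281700 ∷ 13056781420 ∷
  15678230410 ∷ 18065432710 ∷ 16543180720 ∷ 15678132400 ∷ 16543280710 ∷ 18065431720 ∷ 15678231400 ∷ 18234560710 ∷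
  17823451600 ∷ 18213456700 ∷ 15678213400 ∷ 18203456710 ∷ 15678203410 ∷ 18123456700 ∷ 15678123400 ∷ 15678103420 ∷
  18103456720 ∷ 18023456710 ∷ 15678023410 ∷ 15678013420 ∷ 18013456720 ∷ 15430872610 ∷ 14308762510 ∷ 13187652400 ∷
  13087652410 ∷ 18265431700 ∷ 18265430710 ∷ 13256781400 ∷ 13087651420 ∷ 14308761520 ∷ 15430871620 ∷ 18165430720 ∷
  13256780410 ∷ 13156780420 ∷ 13287650410 ∷ 13187650420 ∷ 14328760510 ∷ 14318760520 ∷ 15431870620 ∷ []

abstract
  small2 : Small 0 certs2 placements2
  small2 = refl , refl

  small3 : Small 1 certs3 placements3
  small3 = refl , refl

  small4 : Small 2 certs4 placements4
  small4 = refl , refl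

  small5 : Small 3 certs5 placements5
  small5 = refl , refl

  small6 : Small 4 certs6 placements6
  small6 = refl , refl

-- Certificates and placements for splittings of the exceptional graphs

splitsK5 : Vec (List ℕ × List ℕ) 5
splitsK5 =
  (161543212110 ∷ 116543221110 ∷ 165143211210 ∷ 165413211120 ∷ 165412322210 ∷ 165142322120 ∷ 161542321220 ∷ 116542312220 ∷ [] ,
    10541324 ∷ 10531424 ∷ 10431524 ∷ 11430524 ∷ 11530424 ∷ 11540324 ∷ []) ∷
  (161543212101 ∷ 116543221101 ∷ 165143211201 ∷ 165431211102 ∷ 165412322201 ∷ 165124322102 ∷ 161524321202 ∷ 116524312202 ∷ [] ,
    10542314 ∷ 10532414 ∷ 10432514 ∷ 12430514 ∷ 12530414 ∷ 12540314 ∷ []) ∷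
  (161543212011 ∷ 116543221011 ∷ 165413211021 ∷ 165431211012 ∷ 165142322021 ∷ 165124322012 ∷ 161254321022 ∷ 116254312022 ∷ [] ,
    10543214 ∷ 10523414 ∷ 10423514 ∷ 13420514 ∷ 13520414 ∷ 13540214 ∷ []) ∷
  (165143210211 ∷ 116543220111 ∷ 165413210121 ∷ 165431210112 ∷ 161542320221 ∷ 161524320212 ∷ 161254320122 ∷ 112654310222 ∷ [] ,
    10534214 ∷ 10524314 ∷ 10324514 ∷ 14320514 ∷ 14520314 ∷ 14530214 ∷ []) ∷
  (165143201211 ∷ 161543202111 ∷ 165413201121 ∷ 165431201112 ∷ 116542302221 ∷ 116524302212 ∷ 116254302122 ∷ 112654301222 ∷ [] ,
    10435214 ∷ 10425314 ∷ 10325414 ∷ 15320414 ∷ 15420314 ∷ 15430214 ∷ []) ∷ []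

splitsK33 : Vec (List ℕ × List ℕ) 6
splitsK33 =
  (11206543330000 ∷ 11026543303000 ∷ 10126543033000 ∷ [] ,
    145321065 ∷ 146321055 ∷ 154321065 ∷ 164321055 ∷ 156321045 ∷ 165321045 ∷ []) ∷
  (11206543330000 ∷ 11026543303000 ∷ 10126543033000 ∷ [] ,
    145312065 ∷ 146312055 ∷ 154312065 ∷ 164312055 ∷ 156312045 ∷ 165312045 ∷ []) ∷
  (11206543330000 ∷ 11026543303000 ∷ 10126543033000 ∷ [] ,
    145213065 ∷ 146213055 ∷ 154213065 ∷ 164213055 ∷ 156213045 ∷ 165213045 ∷ []) ∷
  (16541203000330 ∷ 16541023000303 ∷ 16540123000033 ∷ [] ,
    112654035 ∷ 113654025 ∷ 121654035 ∷ 131654025 ∷ 123654015 ∷ 132654015 ∷ []) ∷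
  (16541203000330 ∷ 16541023000303 ∷ 16540123000033 ∷ [] ,
    112645035 ∷ 113645025 ∷ 121645035 ∷ 131645025 ∷ 123645015 ∷ 132645015 ∷ []) ∷
  (16541203000330 ∷ 16541023000303 ∷ 16540123000033 ∷ [] ,
    112546035 ∷ 113546025 ∷ 121546035 ∷ 131546025 ∷ 123546015 ∷ 132546015 ∷ []) ∷ []

splitsGA : Vec (List ℕ × List ℕ) 6
splitsGA =
  (16151432121010 ∷ 11651432211010 ∷ 16511432112010 ∷ 16540132111020 ∷ 16540123222010 ∷ 16511423221020 ∷ 16151423212020 ∷ 11651423122020 ∷ [] ,
    113654025 ∷ 113645025 ∷ 113546025 ∷ 103546125 ∷ 103645125 ∷ 103654125 ∷ []) ∷
  (16151432121001 ∷ 11651432211001 ∷ 16511432112001 ∷ 16540312111002 ∷ 16540123222001 ∷ 16511243221002 ∷ 16151243212002 ∷ 11651243122002 ∷ [] ,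
    123654015 ∷ 123645015 ∷ 123546015 ∷ 103546215 ∷ 103645215 ∷ 103654215 ∷ []) ∷
  (11206543330000 ∷ 11026543303000 ∷ 10126543033000 ∷ [] ,
    145213066 ∷ 146213056 ∷ 154213066 ∷ 164213056 ∷ 156213046 ∷ 165213046 ∷ []) ∷
  (16541231000121 ∷ 16541321000112 ∷ 16511423000221 ∷ 16511243000212 ∷ [] ,
    []) ∷
  (16541231000121 ∷ 16541321000112 ∷ 16151423000221 ∷ 16151243000212 ∷ [] ,
    []) ∷
  (16541231000121 ∷ 16541321000112 ∷ 11651423000221 ∷ 11651243000212 ∷ [] ,
    []) ∷ []

splitsGA⁺ : Vec (List ℕ × List ℕ) 6
splitsGA⁺ =
  (11625413221000 ∷ 11265413212000 ∷ 11625431112000 ∷ 11265431121000 ∷ 16540123222010 ∷ 16540132111020 ∷ 11651432211010 ∷ 11651423122020 ∷ [] ,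
    113546026 ∷ 103546126 ∷ []) ∷
  (11625143221000 ∷ 11265143212000 ∷ 11625431112000 ∷ 11265431121000 ∷ 16540123222001 ∷ 16540312111002 ∷ 11651432211001 ∷ 11651243122002 ∷ [] ,
    123546016 ∷ 103546216 ∷ []) ∷
  (11265431121000 ∷ 11625431112000 ∷ 11621543221000 ∷ 11261543212000 ∷ [] ,
    []) ∷
  (16541231000121 ∷ 16541321000112 ∷ 11651432010211 ∷ 16511423000221 ∷ 11621543020122 ∷ 10165432020111 ∷ 16511243000212 ∷ 10126543010222 ∷ [] ,
    160214356 ∷ 146213056 ∷ []) ∷
  (16541231000121 ∷ 16541321000112 ∷ 11651432001211 ∷ 16151423000221 ∷ 11261543002122 ∷ 10615432002111 ∷ 16151243000212 ∷ 10126543001222 ∷ [] ,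
    160215346 ∷ 156213046 ∷ []) ∷
  (16541231000121 ∷ 16541321000112 ∷ 11651423000221 ∷ 11651243000212 ∷ [] ,
    []) ∷ []

splitsGB : Vec (List ℕ × List ℕ) 7
splitsGB =
  (1615142320012010 ∷ 1611542320021010 ∷ 1615142230021020 ∷ 1611542230012020 ∷ 1106541230022210 ∷ 1106541320011120 ∷ 1016514320011210 ∷ 1016514230022120 ∷ [] ,
    1716543207 ∷ 1706543217 ∷ []) ∷
  (1126524311000201 ∷ 1106543211000102 ∷ 1106541232000201 ∷ 1126521432000102 ∷ [] ,
    []) ∷
  (1016514230200021 ∷ 1016543210100012 ∷ 1126541320100021 ∷ 1126521430200012 ∷ [] ,
    []) ∷
  (1615142232200001 ∷ 1615432211100002 ∷ 1126541322100001 ∷ 1126524311200001 ∷ [] ,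
    []) ∷
  (1611542232200001 ∷ 1615432211100002 ∷ 1126541322100001 ∷ 1126524311200001 ∷ [] ,
    []) ∷
  (1165124320012100 ∷ 1161524320021100 ∷ 1126125430021200 ∷ 1121625430012200 ∷ [] ,
    []) ∷
  (1615142320012010 ∷ 1611542320021010 ∷ 1126251430021020 ∷ 1122651430012020 ∷ [] ,
    []) ∷ []

splitsGB⁺ : Vec (List ℕ × List ℕ) 7
splitsGB⁺ =
  (1615142320012010 ∷ 1611542320021010 ∷ 1615142230021020 ∷ 1611542230012020 ∷ 1106541230022210 ∷ 1106541320011120 ∷ 1016514320011210 ∷ 1016514230022120 ∷ [] ,
    1716543208 ∷ 1706543218 ∷ []) ∷
  (1126524311000201 ∷ 1106543211000102 ∷ 1106541232000201 ∷ 1126521432000102 ∷ [] ,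
    []) ∷
  (1016514230200021 ∷ 1016543210100012 ∷ 1126541320100021 ∷ 1126521430200012 ∷ [] ,
    []) ∷
  (1615142232200001 ∷ 1126541322100001 ∷ 1126524311200001 ∷ 1126125432100002 ∷ 1126251431200002 ∷ 1615432211100002 ∷ [] ,
    []) ∷
  (1611542232200001 ∷ 1126541322100001 ∷ 1126524311200001 ∷ 1121625432100002 ∷ 1122651431200002 ∷ 1615432211100002 ∷ [] ,
    []) ∷
  (1165124320012100 ∷ 1161524320021100 ∷ 1126125430021200 ∷ 1121625430012200 ∷ [] ,
    []) ∷
  (1615142320012010 ∷ 1611542320021010 ∷ 1126251430021020 ∷ 1122651430012020 ∷ [] ,
    []) ∷ []

splitsGC : Vec (List ℕ × List ℕ) 8
splitsGC =
  (101265243101000210 ∷ 101265241302000120 ∷ 112065412302000210 ∷ 112065413201000120 ∷ [] ,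
    []) ∷
  (110265243110000201 ∷ 112065432110000102 ∷ 112065412320000201 ∷ 110265214320000102 ∷ [] ,
    []) ∷
  (101265241300200021 ∷ 101265431200100012 ∷ 110265413200100021 ∷ 110265214300200012 ∷ [] ,
    []) ∷
  (126152141322100000 ∷ 126154131211200000 ∷ 161254311212100000 ∷ 161252411321200000 ∷ [] ,
    []) ∷
  (126125141322100000 ∷ 126154131211200000 ∷ 161254311212100000 ∷ 161225411321200000 ∷ [] ,
    []) ∷
  (126542131100012100 ∷ 126524131100021100 ∷ 126152141300021200 ∷ 126125141300012200 ∷ [] ,
    []) ∷
  (165242311100012001 ∷ 165224311100021001 ∷ 161252411300021002 ∷ 161225411300012002 ∷ [] ,
    []) ∷
  (165242311100012010 ∷ 165224311100021010 ∷ 121161524300021020 ∷ 121116524300012020 ∷ [] ,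
    []) ∷ []

splitsGC⁺ : Vec (List ℕ × List ℕ) 8
splitsGC⁺ =
  (101265243101000210 ∷ 101265241302000120 ∷ 112065412302000210 ∷ 112065413201000120 ∷ [] ,
    []) ∷
  (110265243110000201 ∷ 112065432110000102 ∷ 112065412320000201 ∷ 110265214320000102 ∷ [] ,
    []) ∷
  (101265241300200021 ∷ 101265431200100012 ∷ 110265413200100021 ∷ 110265214300200012 ∷ [] ,
    []) ∷
  (126152141322100000 ∷ 161252411321200000 ∷ 121161524312200000 ∷ 121165423121100000 ∷ 161254311212100000 ∷ 126154131211200000 ∷ [] ,
    []) ∷
  (126125141322100000 ∷ 161225411321200000 ∷ 121116524312200000 ∷ 121165423121100000 ∷ 161254311212100000 ∷ 126154131211200000 ∷ [] ,
    []) ∷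
  (126542131100012100 ∷ 126524131100021100 ∷ 126152141300021200 ∷ 126125141300012200 ∷ [] ,
    []) ∷
  (165242311100012001 ∷ 165224311100021001 ∷ 161252411300021002 ∷ 161225411300012002 ∷ [] ,
    []) ∷
  (165242311100012010 ∷ 165224311100021010 ∷ 121161524300021020 ∷ 121116524300012020 ∷ [] ,
    []) ∷ []

splitsGD : Vec (List ℕ × List ℕ) 7
splitsGD =
  (1615412320001210 ∷ 1651421320001120 ∷ 1654122132002010 ∷ 1651421230002210 ∷ 1654122311001020 ∷ 1615412230002120 ∷ [] ,
    []) ∷
  (1615413220010201 ∷ 1654123120010102 ∷ 1651421232020001 ∷ 1654122130020201 ∷ 1651423211010002 ∷ 1615412230020102 ∷ [] ,
    []) ∷
  (1651431220100021 ∷ 1654132120100012 ∷ 1615412232200001 ∷ 1654122130200021 ∷ 1615432211100002 ∷ 1651421230200012 ∷ [] ,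
    []) ∷
  (1651431220120001 ∷ 1615413220210001 ∷ 1651241230210002 ∷ 1615214230120002 ∷ [] ,
    []) ∷
  (1654132120102010 ∷ 1615412320201010 ∷ 1651241230201020 ∷ 1612512430102020 ∷ [] ,
    []) ∷
  (1654123120012100 ∷ 1651421320021100 ∷ 1615214230021200 ∷ 1612512430012200 ∷ [] ,
    []) ∷
  (1615412230000321 ∷ 1615412230000312 ∷ 1651421230000231 ∷ 1651421230000132 ∷ 1654122130000213 ∷ 1654122130000123 ∷ [] ,
    []) ∷ []

abstract
  checkK5 : SplitCheck 2 K5 refl splitsK5
  checkK5 zero = refl , refl
  checkK5 1F = refl , refl
  checkK5 2F = refl , refl
  checkK5 3F = refl , refl
  checkK5 4F = refl , refl

  checkK33 : SplitCheck 3 K33 refl splitsK33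
  checkK33 zero = refl , refl
  checkK33 1F = refl , refl
  checkK33 2F = refl , refl
  checkK33 3F = refl , refl
  checkK33 4F = refl , refl
  checkK33 5F = refl , refl

  checkGA : SplitCheck 3 GA refl splitsGA
  checkGA zero = refl , refl
  checkGA 1F = refl , refl
  checkGA 2F = refl , refl
  checkGA 3F = refl , refl
  checkGA 4F = refl , refl
  checkGA 5F = refl , refl

  checkGA⁺ : SplitCheck 3 GA⁺ refl splitsGA⁺
  checkGA⁺ zero = refl , refl
  checkGA⁺ 1F = refl , refl
  checkGA⁺ 2F = refl , refl
  checkGA⁺ 3F = refl , refl
  checkGA⁺ 4F = refl , refl
  checkGA⁺ 5F = refl , refl

  checkGB : SplitCheck 4 GB refl splitsGB
  checkGB zero = refl , refl
  checkGB 1F = refl , refl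
  checkGB 2F = refl , refl
  checkGB 3F = refl , refl
  checkGB 4F = refl , refl
  checkGB 5F = refl , refl
  checkGB 6F = refl , refl

  checkGB⁺ : SplitCheck 4 GB⁺ refl splitsGB⁺
  checkGB⁺ zero = refl , refl
  checkGB⁺ 1F = refl , refl
  checkGB⁺ 2F = refl , refl
  checkGB⁺ 3F = refl , refl
  checkGB⁺ 4F = refl , refl
  checkGB⁺ 5F = refl , refl
  checkGB⁺ 6F = refl , refl

  checkGC : SplitCheck 5 GC refl splitsGC
  checkGC zero = refl , refl
  checkGC 1F = refl , refl
  checkGC 2F = refl , refl
  checkGC 3F = refl , refl
  checkGC 4F = refl , refl
  checkGC 5F = refl , refl
  checkGC 6F = refl , refl
  checkGC 7F = refl , refl

  checkGC⁺ : SplitCheck 5 GC⁺ refl splitsGC⁺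
  checkGC⁺ zero = refl , refl
  checkGC⁺ 1F = refl , refl
  checkGC⁺ 2F = refl , refl
  checkGC⁺ 3F = refl , refl
  checkGC⁺ 4F = refl , refl
  checkGC⁺ 5F = refl , refl
  checkGC⁺ 6F = refl , refl
  checkGC⁺ 7F = refl , refl

  checkGD : SplitCheck 4 GD refl splitsGD
  checkGD zero = refl , refl
  checkGD 1F = refl , refl
  checkGD 2F = refl , refl
  checkGD 3F = refl , refl
  checkGD 4F = refl , refl
  checkGD 5F = refl , refl
  checkGD 6F = refl , refl

-- The induction

-- A good graph is not bad, so at seven path vertices the check leaves only the minor. Longer paths
-- are merged down to that length, and the minor lifts back.
long : ∀ m (g : Gr (10 + m)) → Good {5 + m} g → K24-minor g
long zero g good = [ id , ⊥-elim ∘ not-bad ]′ (minor-or-bad 5 {certs7} bad7 g std isFed)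
  where open Good good
long (suc m) g good = let (M , good' , c) = shorten {m} {g = g} good in K24-lift c (long m M good')

-- A run described without hubs and path, so that it can be carried by isomorphisms into another
-- three-hub presentation of the graph.
record RunAt (g : Gr n) (u v y c d : Fin n) : Set where
  field
    y≢u : y ≢ u
    y≢v : y ≢ v
    c≢d : c ≢ d
    N-u : ∀ w → e g u w ≡ true → w ≡ v ⊎ w ≡ y ⊎ w ≡ c
    N-v : ∀ w → e g v w ≡ true → w ≡ u ⊎ w ≡ y ⊎ w ≡ d
    big : 6 ≤ deg (e g y)

RunAt-sym : {g : Gr n} {u v y c d : Fin n} → RunAt g u v y c d → RunAt g v u y d c
RunAt-sym r = record { y≢u = y≢v ; y≢v = y≢u ; c≢d = c≢d ∘ sym ; N-u = N-v ; N-v = N-u ; big = big }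
  where open RunAt r

swap-side : (π : Permutation m n) → ∀ {a b} → π ⟨$⟩ʳ a ≡ b → π ⟨$⟩ˡ b ≡ a
swap-side π refl = inverseˡ π

deg-perm : (π : Permutation m n) (f : Fin n → Bool) → deg (λ i → f (π ⟨$⟩ʳ i)) ≡ deg f
deg-perm {zero} {zero} π f = refl
deg-perm {zero} {suc n} π f = case π ⟨$⟩ˡ zero of λ ()
deg-perm {suc m} {zero} π f = case π ⟨$⟩ʳ zero of λ ()
deg-perm {suc m} {suc n} π f = trans (deg-punchIn (λ i → f (π ⟨$⟩ʳ i)) zero)
  (trans (cong (ι (f (π ⟨$⟩ʳ zero)) +_) (trans (deg-cong λ i → cong f (Perm.punchIn-permute π zero i))
    (deg-perm (Perm.remove zero π) (f ∘ punchIn (π ⟨$⟩ʳ zero)))))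
    (sym (deg-punchIn f (π ⟨$⟩ʳ zero))))

RunAt-≃ : {g : Gr n} {g' : Gr m} (i : g ≃ g') → ∀ {u v y c d} → RunAt g u v y c d →
  let π = _≃_.perm i in RunAt g' (π ⟨$⟩ʳ u) (π ⟨$⟩ʳ v) (π ⟨$⟩ʳ y) (π ⟨$⟩ʳ c) (π ⟨$⟩ʳ d)
RunAt-≃ {g = g} {g'} (iso π q) {u} {v} {y} r = record
  { y≢u = y≢u ∘ perm-inj π ; y≢v = y≢v ∘ perm-inj π ; c≢d = c≢d ∘ perm-inj π
  ; N-u = λ w p → Sum.map back (Sum.map back back) (N-u (π ⟨$⟩ˡ w) (trans (q _ _) (trans (cong (e g' _) (inverseʳ π)) p)))
  ; N-v = λ w p → Sum.map back (Sum.map back back) (N-v (π ⟨$⟩ˡ w) (trans (q _ _) (trans (cong (e g' _) (inverseʳ π)) p)))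
  ; big = subst (6 ≤_) (trans (deg-cong (q y)) (deg-perm π (e g' (π ⟨$⟩ʳ y)))) big }
  where
  open RunAt r
  back : ∀ {w x} → π ⟨$⟩ˡ w ≡ x → w ≡ π ⟨$⟩ʳ x
  back refl = sym (inverseʳ π)

RunOn : (g : Gr n) (u v : Fin n) → Set
RunOn g u v = ∃ λ y → ∃ λ c → ∃ λ d → RunAt g u v y c d

RunOn-≃ : {g : Gr n} {g' : Gr m} (i : g ≃ g') {u v : Fin n} {u' v' : Fin m} →
  _≃_.perm i ⟨$⟩ʳ u ≡ u' → _≃_.perm i ⟨$⟩ʳ v ≡ v' → RunOn g u v → RunOn g' u' v'
RunOn-≃ i refl refl (y , c , d , r) = _ , _ , _ , RunAt-≃ i r

-- A separation {u, v, s} leaves y on one side and c, d on the other, and then {y, s} already separates.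
module _ {g : Gr n} (c3 : Conn3 g) {u v y c d : Fin n} (r : RunAt g u v y c d) where
  open RunAt r
  private
    core : ∀ {s D} → SepAt g (Trio u v s) D → u ≢ s → y ∈ᵇ D → ¬ (c ∈ᵇ D) → ¬ (d ∈ᵇ D) → ⊥
    core {s} {D} (sepAt _ _ av cl) u≢s y∈ c∉ d∉ with any? (λ w → w ∈ᵇ? D ×-dec ¬? (w ≟ y))
    -- With `y` alone in `D`, the neighbours of `y` are among the four listed vertices, against
    -- degree six.
    ... | no none = ℕ.<⇒≱ (s≤s (ℕ.n≤1+n 4)) (ℕ.≤-trans big (deg-upper (y ∷ u ∷ v ∷ s ∷ []) (e g y) nb))
      where
      nb : ∀ i → e g y i ≡ true → i ∈ˡ (y ∷ u ∷ v ∷ s ∷ [])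
      nb i p with cl y y∈ i p
      ... | inj₂ (inj₁ refl) = there (here refl)
      ... | inj₂ (inj₂ (inj₁ refl)) = there (there (here refl))
      ... | inj₂ (inj₂ (inj₂ refl)) = there (there (there (here refl)))
      ... | inj₁ i∈ with i ≟ y
      ... | yes refl = (here refl)
      ... | no i≢ = ⊥-elim (none (i , i∈ , i≢))
    -- Otherwise `{y, s}` separates the rest of `D` from `u`: neither `u` nor `v` has a neighbour
    -- there, because apart from each other they see only `y`, `c` and `d`.
    ... | yes (w , w∈ , w≢y) with c3 y s (lookup D ∖ y) w u (∖-true (lookup D) w∈ w≢y)
             (cong (_∧ not (does (u ≟ y))) (Bool.¬-not λ q → av u q (inj₁ refl)))
             [ w≢y , (λ { refl → av w w∈ (inj₂ (inj₂ refl)) }) ]′ [ y≢u ∘ sym , u≢s ]′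
    ... | a , b , a∈ , b∉ , a∉C , b∉C , ab = out (cl a (proj₁ a∈') b ab)
      where
      a∈' : a ∈ᵇ D × a ≢ y
      a∈' = ∖-inv (lookup D) a∈
      out : b ∈ᵇ D ⊎ Trio u v s b → ⊥
      out (inj₁ b∈) = t≢f (∖-true (lookup D) b∈ (b∉C ∘ inj₁)) b∉
      out (inj₂ (inj₂ (inj₂ q))) = b∉C (inj₂ q)
      out (inj₂ (inj₁ refl)) with N-u a (esym g ab)
      ... | inj₁ refl = av a (proj₁ a∈') (inj₂ (inj₁ refl))
      ... | inj₂ (inj₁ q) = proj₂ a∈' q
      ... | inj₂ (inj₂ refl) = c∉ (proj₁ a∈')
      out (inj₂ (inj₂ (inj₁ refl))) with N-v a (esym g ab)
      ... | inj₁ refl = av a (proj₁ a∈') (inj₁ refl)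
      ... | inj₂ (inj₁ q) = proj₂ a∈' q
      ... | inj₂ (inj₂ refl) = d∉ (proj₁ a∈')

    meets : ∀ {s D} → SepAt g (Trio u v s) D → u ≢ s × (y ∈ᵇ D ⊎ c ∈ᵇ D) × (y ∈ᵇ D ⊎ d ∈ᵇ D)
    meets {s} {D} sp@(sepAt i (o , o∉ , o∉C) av cl)
      with reach {g = g} c3 {v} {s} {u} {D} (sepAt i (o , o∉ , o∉C ∘ rot₁) (λ a p → av a p ∘ rot₁) λ a p b ab → Sum.map₂ rot₁' (cl a p b ab)) o o∉
             (o∉C ∘ inj₂ ∘ inj₁) (o∉C ∘ inj₂ ∘ inj₂)
         | reach {g = g} c3 {u} {s} {v} {D} (sepAt i (o , o∉ , o∉C ∘ rot₂) (λ a p → av a p ∘ rot₂) λ a p b ab → Sum.map₂ rot₂' (cl a p b ab)) o o∉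
             (o∉C ∘ inj₁) (o∉C ∘ inj₂ ∘ inj₂)
      where
      rot₁ : ∀ {w} → Trio v s u w → Trio u v s w
      rot₁ (inj₁ p) = inj₂ (inj₁ p)
      rot₁ (inj₂ (inj₁ p)) = inj₂ (inj₂ p)
      rot₁ (inj₂ (inj₂ p)) = inj₁ p
      rot₁' : ∀ {w} → Trio u v s w → Trio v s u w
      rot₁' (inj₁ p) = inj₂ (inj₂ p)
      rot₁' (inj₂ (inj₁ p)) = inj₁ p
      rot₁' (inj₂ (inj₂ p)) = inj₂ (inj₁ p)
      rot₂ : ∀ {w} → Trio u s v w → Trio u v s w
      rot₂ = Sum.map₂ Sum.swap
      rot₂' : ∀ {w} → Trio u v s w → Trio u s v w
      rot₂' = Sum.map₂ Sum.swap
    ... | a , a∈ , au , u≢v , u≢s | b , b∈ , bv , _ = u≢s , at-u (N-u a (esym g au)) , at-v (N-v b (esym g bv))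
      where
      at-u : a ≡ v ⊎ a ≡ y ⊎ a ≡ c → y ∈ᵇ D ⊎ c ∈ᵇ D
      at-u (inj₁ refl) = ⊥-elim (av a a∈ (inj₂ (inj₁ refl)))
      at-u (inj₂ (inj₁ refl)) = inj₁ a∈
      at-u (inj₂ (inj₂ refl)) = inj₂ a∈
      at-v : b ≡ u ⊎ b ≡ y ⊎ b ≡ d → y ∈ᵇ D ⊎ d ∈ᵇ D
      at-v (inj₁ refl) = ⊥-elim (av b b∈ (inj₁ refl))
      at-v (inj₂ (inj₁ refl)) = inj₁ b∈
      at-v (inj₂ (inj₂ refl)) = inj₂ b∈

    no-sep : ∀ {s D} → SepAt g (Trio u v s) D → ⊥
    -- Both `u` and `v` have a neighbour on either side, so each side meets `{y, c}` and `{y, d}`. A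
    -- side without `y` contains `c` and `d`; hence `y` lies on exactly one side, and `core` applies
    -- to that one.
    no-sep {s} {D} sp with complement {g = g} (trio? u v s) sp
    ... | B , sB , dis , _ with meets {s} {D} sp | meets {s} {B} sB | y ∈ᵇ? D
    ... | u≢s , _ , _ | _ , inj₂ c∈ , inj₂ d∈ | yes y∈ = core {s} {D} sp u≢s y∈ (dis c c∈) (dis d d∈)
    ... | _ | _ , inj₁ y∈B , _ | yes y∈ = dis y y∈B y∈
    ... | _ | _ , inj₂ _ , inj₁ y∈B | yes y∈ = dis y y∈B y∈
    ... | _ , inj₁ y∈ , _ | _ | no y∉ = y∉ y∈
    ... | _ , inj₂ _ , inj₁ y∈ | _ | no y∉ = y∉ y∈
    ... | u≢s , inj₂ c∈ , inj₂ d∈ | _ , inj₂ c∈B , _ | no y∉ = dis c c∈B c∈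
    ... | u≢s , inj₂ c∈ , inj₂ d∈ | _ , inj₁ y∈B , _ | no y∉ = core {s} {B} sB u≢s y∈B (λ q → dis c q c∈) λ q → dis d q d∈

  run-tight : Tight g u v
  run-tight s with cross⊎sep g (trio? u v s)
  ... | inj₁ cr = cr
  ... | inj₂ (D , sp) = ⊥-elim (no-sep sp)

run-at : (g : Gr (3 + suc k)) → Std 3 g → Run (e g) →
  ∃ λ u → ∃ λ v → ∃ λ y → ∃ λ c → ∃ λ d → e g u v ≡ true × RunAt g u v y c d
run-at g s (z , big , i , i≢0 , si , j , j≢l , ij , sj) with previous i i≢0 | following j j≢l
... | c , ci | d , jd = 3 ↑ʳ i , 3 ↑ʳ j , hub z , 3 ↑ʳ c , 3 ↑ʳ d , trans (s i j) (cong (_∨ next j i) ij) , record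
  { y≢u = hub≢path ; y≢v = hub≢path
  ; c≢d = λ q → ℕ.m≢1+m+n (toℕ c) {2} (trans (cong toℕ (3↑-inj q)) (trans (next-toℕ j d jd)
      (cong suc (trans (next-toℕ i j ij) (trans (cong suc (next-toℕ c i ci)) (ℕ.+-comm 2 (toℕ c)))))))
  ; N-u = λ w p → nu w p (hub-or-path w) ; N-v = λ w p → nv w p (hub-or-path w) ; big = big }
  where
  at : ∀ {i a} → Sole (e g) z i → e g (3 ↑ʳ i) (hub a) ≡ true → a ≡ z
  at {i} {a} si p = does-true (a ≟ z) (trans (sym (si a)) (esym g p))
  nu : ∀ w → e g (3 ↑ʳ i) w ≡ true → HubOrPath w → w ≡ 3 ↑ʳ j ⊎ w ≡ hub z ⊎ w ≡ 3 ↑ʳ c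
  nu _ p (is-hub a) = inj₂ (inj₁ (cong hub (at si p)))
  nu _ p (is-path l) with ∨-inv (next i l) (trans (sym (s i l)) p)
  ... | inj₁ q = inj₁ (cong (3 ↑ʳ_) (next-functional i l j q ij))
  ... | inj₂ q = inj₂ (inj₂ (cong (3 ↑ʳ_) (next-injective i l c q ci)))
  nv : ∀ w → e g (3 ↑ʳ j) w ≡ true → HubOrPath w → w ≡ 3 ↑ʳ i ⊎ w ≡ hub z ⊎ w ≡ 3 ↑ʳ d
  nv _ p (is-hub a) = inj₂ (inj₁ (cong hub (at sj p)))
  nv _ p (is-path l) with ∨-inv (next j l) (trans (sym (s j l)) p)
  ... | inj₁ q = inj₂ (inj₂ (cong (3 ↑ʳ_) (next-functional j l d q jd)))
  ... | inj₂ q = inj₁ (cong (3 ↑ʳ_) (next-injective j l i q ij))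

module _ {h : Gr (5 + k)} (c3 : Conn3 h) {M : Gr (4 + k)} (st : Std 2 M) (s : Std 3 h) where
  private
    big-hub : ∀ y → 6 ≤ deg (e h y) → HubOrPath y → ∃ λ b → y ≡ hub b
    big-hub _ big (is-hub b) = b , refl
    big-hub _ big (is-path q) with path-neighbours q
    ... | a , b , only = ⊥-elim (ℕ.<⇒≱ big (deg-upper (hub 0F ∷ hub 1F ∷ hub 2F ∷ (3 ↑ʳ a) ∷ (3 ↑ʳ b) ∷ []) (e h (3 ↑ʳ q))
            λ i p → nb i p (hub-or-path i)))
      where
      nb : ∀ i → e h (3 ↑ʳ q) i ≡ true → HubOrPath i → i ∈ˡ (hub 0F ∷ hub 1F ∷ hub 2F ∷ (3 ↑ʳ a) ∷ (3 ↑ʳ b) ∷ [])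
      nb _ p (is-hub zero) = (here refl)
      nb _ p (is-hub 1F) = there (here refl)
      nb _ p (is-hub 2F) = there (there (here refl))
      nb _ p (is-path i) with only i (trans (sym (s q i)) p)
      ... | inj₁ refl = there (there (there (here refl)))
      ... | inj₂ refl = there (there (there (there (here refl))))

    Full : Fin (4 + k) → Set
    Full x = ∀ p i → x ≡ 2 ↑ʳ p → pathE p i ≡ true → e h (3 ↑ʳ p) (3 ↑ʳ i) ≡ true

    -- The run consists of the hubs `zero` and `hub a`, each with at most one path neighbour. Each
    -- path end needs one of the two, and `hub a` cannot serve both, so the only path neighbour of
    -- `zero` is an end.
    hub-case : ∀ (a : Fin 3) → zero ≢ a → ∀ {y c d} → RunAt h zero (hub a) y c d → (∃ λ b → y ≡ hub b) → Appendable (e h)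
    hub-case a 0≢a {c = c} {d} r (b , refl) = ends (pick 3F first-two) (pick (3 ↑ʳ last) last-two)
      where
      open RunAt r
      open Fed (fed h s c3)
      pick : ∀ v → two-of (label h v) ≡ true → e h zero v ≡ true ⊎ e h (hub a) v ≡ true
      pick v t = Sum.map (trans (sym (bit-label h zero v))) (trans (sym (bit-label h a v))) (two-of-pick (label h v) t 0≢a)
      on-u : ∀ i → e h zero (3 ↑ʳ i) ≡ true → 3 ↑ʳ i ≡ c
      on-u i p with N-u _ p
      ... | inj₁ q = ⊥-elim (hub≢path {a = a} (sym q))
      ... | inj₂ (inj₁ q) = ⊥-elim (hub≢path {a = b} (sym q))
      ... | inj₂ (inj₂ q) = q
      on-v : ∀ i → e h (hub a) (3 ↑ʳ i) ≡ true → 3 ↑ʳ i ≡ d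
      on-v i p with N-v _ p
      ... | inj₂ (inj₁ q) = ⊥-elim (hub≢path {a = b} (sym q))
      ... | inj₂ (inj₂ q) = q
      single : ∀ j → e h zero (3 ↑ʳ j) ≡ true → OnlyAt (e h) zero j
      single j p i with e h zero (3 ↑ʳ i) in eq
      ... | false = inj₂ refl
      ... | true = inj₁ (3↑-inj (trans (on-u i eq) (sym (on-u j p))))
      ends : e h zero 3F ≡ true ⊎ e h (hub a) 3F ≡ true →
        e h zero (3 ↑ʳ last) ≡ true ⊎ e h (hub a) (3 ↑ʳ last) ≡ true → Appendable (e h)
      ends (inj₁ p) _ = zero , inj₁ (single zero p)
      ends (inj₂ _) (inj₁ p) = zero , inj₂ (single last p)
      ends (inj₂ p) (inj₂ q) = case trans (on-v zero p) (sym (on-v last q)) of λ ()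

    -- Every path neighbour of `p` is still a neighbour of `3 ↑ʳ p`, which leaves only `d` for it,
    -- so `p` is an end of the path. A path neighbour of `zero` other than `p` would have to be `c`,
    -- but as a path neighbour of `p` it would also be `d`.
    path-case : ∀ p → Split h M (2 ↑ʳ p) → Full (2 ↑ʳ p) → ∀ {y c d} → RunAt h zero (3 ↑ʳ p) y c d → (∃ λ b → y ≡ hub b) → Appendable (e h)
    path-case p sp full {c = c} {d} r (b , refl) = zero , ends (p ≟ zero) (p ≟ last)
      where
      open RunAt r
      on-v : ∀ i → pathE p i ≡ true → 3 ↑ʳ i ≡ d
      on-v i q with N-v _ (full p i refl q)
      ... | inj₂ (inj₁ q) = ⊥-elim (hub≢path {a = b} (sym q))
      ... | inj₂ (inj₂ q) = q
      single : OnlyAt (e h) zero p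
      single i with i ≟ p | e h zero (3 ↑ʳ i) in eq
      ... | yes q | _ = inj₁ q
      ... | no _ | false = inj₂ refl
      ... | no i≢ | true with N-u _ eq
      ... | inj₁ q = inj₁ (3↑-inj q)
      ... | inj₂ (inj₁ q) = ⊥-elim (hub≢path {a = b} (sym q))
      ... | inj₂ (inj₂ q) = ⊥-elim (c≢d (trans (sym q) (on-v i (trans (sym (st p i))
              (trans (Split.merged sp (2 ↑ʳ i) (i≢ ∘ 2↑-inj)) (cong (_∨ e h (3 ↑ʳ p) (3 ↑ʳ i)) eq))))))
      ends : Dec (p ≡ zero) → Dec (p ≡ last) → OnlyAt (e h) zero zero ⊎ OnlyAt (e h) zero last
      ends (yes refl) _ = inj₁ single
      ends (no _) (yes refl) = inj₂ single
      ends (no p≢0) (no p≢l) = let (i , ip) = previous p p≢0 ; (j , pj) = following p p≢l in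
        ⊥-elim (ℕ.m≢1+m+n (toℕ i) {1} (trans (cong toℕ (3↑-inj (trans (on-v i (∨-r (next p i) ip)) (sym (on-v j (cong (_∨ next j p) pj))))))
          (trans (next-toℕ p j pj) (cong suc (trans (next-toℕ i p ip) (ℕ.+-comm 1 (toℕ i)))))))

  run-appendable : ∀ x → Split h M x → Full x → ∀ {y c d} → RunAt h zero (suc x) y c d → Appendable (e h)
  run-appendable x sp full {y} r = go x sp full r (big-hub y (RunAt.big r) (hub-or-path y))
    where
    go : ∀ x → Split h M x → Full x → ∀ {y c d} → RunAt h zero (suc x) y c d → (∃ λ b → y ≡ hub b) → Appendable (e h)
    go zero sp full = hub-case 1F (λ ())
    go 1F sp full = hub-case 2F (λ ())
    go (suc (suc p)) sp full = path-case p sp full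

relabel-to : (π : Permutation m n) (g : Gr n) → g ≃ relabel π g
relabel-to π g = ≃-sym (relabel-≃ π g)

exc-size : ∀ i → Permutation (9 + n) (size (excG i)) → ⊥
exc-size i π = big i (sym (Perm.↔⇒≡ π))
  where
  big : ∀ i {n} → size (excG i) ≢ 9 + n
  big zero ()
  big 1F ()
  big 2F ()
  big 3F ()
  big 4F ()
  big 5F ()
  big 6F ()
  big 7F ()
  big 8F ()

Hypothesis : ℕ → Set
Hypothesis m = ∀ (M : Gr (4 + m)) → Conn3 M → ¬ K24-minor M → Res {m} M

module _ {m : ℕ} (ih : Hypothesis (5 + m)) (g : Gr (10 + m)) (c3 : Conn3 g) (free : ¬ K24-minor g) where
  -- Contracting a run gives a two-hub graph, and undoing the contraction prolongs the path.
  run-lift : ∀ {u v y c d} → e g u v ≡ true → RunAt g u v y c d → HubPath {8 + m} 2 g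
  run-lift {u} {v} {y} {c} {d} uv r = HubPath-≃ {8 + m} 2 (relabel-to π g) (lifted (ih (contract g₀)
      (Conn3-contract g₀ c₀ (run-tight c₀ (proj₂ (proj₂ (proj₂ r₀))))) (λ q → free (K24-lift (≃⇒↠ (relabel-to π g)) (K24-lift (contract-↠ g₀ uv₀) q)))))
    where
    u≢v = edge≢ g uv
    π = pairFirst u v u≢v
    g₀ = relabel π g
    c₀ : Conn3 g₀
    c₀ = Conn3-≃ (relabel-to π g) c3
    uv₀ : e g₀ zero 1F ≡ true
    uv₀ = trans (cong (e g u) (pairFirst-1 u v u≢v)) uv
    r₀ : RunOn g₀ zero 1F
    r₀ = RunOn-≃ (relabel-to π g) (swap-side π {zero} refl) (swap-side π (pairFirst-1 u v u≢v)) (y , c , d , r)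
    lifted : Res {5 + m} (contract g₀) → HubPath {8 + m} 2 g₀
    -- The contraction has at least nine vertices, and the exceptional graphs have at most eight.
    lifted (exc i (iso σ _)) = ⊥-elim (exc-size i σ)
    lifted (path (M , i , st)) = outcome (split-two {P = P} st x (contract-split g₀ uv₀ i) P₁ P₂)
      where
      x = _≃_.perm i ⟨$⟩ʳ zero
      σ = flip (lift₀ (_≃_.perm i))
      g₁ = relabel σ g₀
      -- Either end of the split edge may be called `zero` in the outcome, so the run is recorded in
      -- a form that survives the exchange of its two vertices.
      P : Gr (10 + m) → Set
      P h = Conn3 h × RunOn h zero (suc x)
      P₁ : P g₁
      P₁ = Conn3-≃ (relabel-to σ g₀) c₀ , RunOn-≃ (relabel-to σ g₀) refl refl r₀
      P₂ : P (relabel (swap₀ x) g₁)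
      P₂ = Conn3-≃ (relabel-to (swap₀ x) g₁) (proj₁ P₁)
        , (let (y , c , d , r) = RunOn-≃ (relabel-to (swap₀ x) g₁) {zero} {suc x} (swap-side (swap₀ x) (swap₀-x x)) (swap-side (swap₀ x) {zero} refl) (proj₂ P₁)
           in y , d , c , RunAt-sym r)
      outcome : Outcome P g₁ M x → HubPath {8 + m} 2 g₀
      outcome (two t) = HubPath-≃ {8 + m} 2 (relabel-to σ g₀) t
      outcome (three h (ch , _ , _ , _ , rh) i' sp std full) = HubPath-≃ {8 + m} 2 (≃-trans (relabel-to σ g₀) i')
        (append h std ch (run-appendable ch st std x sp full rh))

small-hub : ∀ m cs ps → Small m cs ps → (g : Gr (5 + m)) → Std 3 g → Conn3 g → ¬ K24-minor g → Res {suc m} g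
small-hub m cs ps sm g s c free with small-three {m} {cs} {ps} sm g s (fed g s c)
... | inj₁ q = ⊥-elim (free q)
... | inj₂ (inj₁ l) = ⊥-elim (not-low g s c l)
... | inj₂ (inj₂ (inj₁ a)) = path (append g s c a)
... | inj₂ (inj₂ (inj₂ r)) = r

-- There are `2 + m` path vertices. Up to six, every remaining graph is identified by a placement;
-- from seven on only bad graphs remain, and a run among them calls the induction hypothesis.
three-hub : ∀ m → Hypothesis m → (g : Gr (5 + m)) → Std 3 g → Conn3 g → ¬ K24-minor g → Res {suc m} g
three-hub 0 ih = small-hub 0 certs2 placements2 small2
three-hub 1 ih = small-hub 1 certs3 placements3 small3
three-hub 2 ih = small-hub 2 certs4 placements4 small4
three-hub 3 ih = small-hub 3 certs5 placements5 small5
three-hub 4 ih = small-hub 4 certs6 placements6 small6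
three-hub (suc (suc (suc (suc (suc m))))) ih g s c free = go (bad? (e g))
  where
  go : Dec (Bad (e g)) → Res {6 + m} g
  go (no nb) = ⊥-elim (free (long m g (record { std = s ; isFed = fed g s c ; not-bad = nb })))
  go (yes (inj₁ l)) = ⊥-elim (not-low g s c l)
  go (yes (inj₂ (inj₁ a))) = path (append g s c a)
  go (yes (inj₂ (inj₂ r))) = let (_ , _ , _ , _ , _ , uv , ra) = run-at g s r in path (run-lift ih g c free uv ra)

split-exc : ∀ {m} i (q : size (excG i) ≡ 3 + m) (g : Gr (4 + m)) (x : Fin (3 + m)) → Split g (subst Gr q (gr (excG i))) x →
  K24-minor g ⊎ deg (e g zero) ≤ 2 ⊎ deg (e g (suc x)) ≤ 2 ⊎ Res {m} g
split-exc zero refl = split-outcome K5 refl {splitsK5} checkK5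
split-exc 1F refl = split-outcome K33 refl {splitsK33} checkK33
split-exc 2F refl = split-outcome GA refl {splitsGA} checkGA
split-exc 3F refl = split-outcome GA⁺ refl {splitsGA⁺} checkGA⁺
split-exc 4F refl = split-outcome GB refl {splitsGB} checkGB
split-exc 5F refl = split-outcome GB⁺ refl {splitsGB⁺} checkGB⁺
split-exc 6F refl = split-outcome GC refl {splitsGC} checkGC
split-exc 7F refl = split-outcome GC⁺ refl {splitsGC⁺} checkGC⁺
split-exc 8F refl = split-outcome GD refl {splitsGD} checkGD

≃-cast : {g : Gr n} {h : Gr m} (q : m ≡ n) → g ≃ h → g ≃ subst Gr q h
≃-cast refl i = i

some-edge : (g : Gr (3 + n)) → Conn3 g → ∃ λ x → ∃ λ y → e g x y ≡ true
some-edge g c with c 1F 1F (λ { zero → true ; (suc _) → false }) zero 2F refl refl [ (λ ()) , (λ ()) ]′ [ (λ ()) , (λ ()) ]′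
... | x , y , _ , _ , _ , _ , xy = x , y , xy

-- The graph is complete, so any two vertices serve as hubs and the other two form the path.
four-vertices : Hypothesis 0
four-vertices g c free = path (g , ≃-refl , std)
  where
  joined : e g 2F 3F ≡ true
  joined = Bool.¬-not λ f → not-two-neighbours {g = g} c 2F 0F 1F λ
    { zero _ → inj₁ refl ; 1F _ → inj₂ refl ; 2F p → ⊥-elim (edge≢ g p refl)
    ; 3F p → ⊥-elim (t≢f p f) }
  std : Std {2} 2 g
  std zero zero = irr g _
  std zero 1F = joined
  std 1F zero = esym g joined
  std 1F 1F = irr g _
module _ {m : ℕ} (ih : Hypothesis m) (g : Gr (5 + m)) (c : Conn3 g) (free : ¬ K24-minor g) (joined : e g zero 1F ≡ true) where
  private
    module _ {M : Gr (4 + m)} (i : contract g ≃ M) where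
      σ : Permutation′ (5 + m)
      σ = flip (lift₀ (_≃_.perm i))
      g₁ : Gr (5 + m)
      g₁ = relabel σ g
      x : Fin (4 + m)
      x = _≃_.perm i ⟨$⟩ʳ zero
      i₁ : g ≃ g₁
      i₁ = relabel-to σ g
      c₁ : Conn3 g₁
      c₁ = Conn3-≃ i₁ c
      free₁ : ¬ K24-minor g₁
      free₁ q = free (K24-lift (≃⇒↠ i₁) q)
      sp : Split g₁ M x
      sp = contract-split g joined i

    exceptional : ∀ y (q : size (excG y) ≡ 4 + m) → contract g ≃ subst Gr q (gr (excG y)) → Res {suc m} g
    exceptional y q i = go (split-exc {suc m} y q (g₁ i) (x i) (sp i))
      where
      go : K24-minor (g₁ i) ⊎ deg (e (g₁ i) zero) ≤ 2 ⊎ deg (e (g₁ i) (suc (x i))) ≤ 2 ⊎ Res {suc m} (g₁ i) → Res {suc m} g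
      go (inj₁ k) = ⊥-elim (free₁ i k)
      go (inj₂ (inj₁ l)) = ⊥-elim (min-deg {g = g₁ i} (c₁ i) zero l)
      go (inj₂ (inj₂ (inj₁ l))) = ⊥-elim (min-deg {g = g₁ i} (c₁ i) (suc (x i)) l)
      go (inj₂ (inj₂ (inj₂ r))) = Res-≃ {suc m} (i₁ i) r

    two-hub : {M : Gr (4 + m)} (i : contract g ≃ M) → Std {2 + m} 2 M → Res {suc m} g
    two-hub {M} i st = go (split-two {P = λ _ → ⊤} st (x i) (sp i) tt tt)
      where
      go : Outcome (λ _ → ⊤) (g₁ i) M (x i) → Res {suc m} g
      go (two t) = Res-≃ {suc m} (i₁ i) (path t)
      go (three h _ j _ s _) = Res-≃ {suc m} (≃-trans (i₁ i) j)
        (three-hub m ih h s (Conn3-≃ j (c₁ i)) λ q → free₁ i (K24-lift (≃⇒↠ j) q))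

  uncontract : Res {m} (contract g) → Res {suc m} g
  uncontract (path (M , i , st)) = two-hub i st
  uncontract (exc y i) = exceptional y q (≃-cast q i)
    where
    q : size (excG y) ≡ 4 + m
    q = sym (Perm.↔⇒≡ (_≃_.perm i))

module _ {m : ℕ} (ih : Hypothesis m) (g : Gr (5 + m)) (c : Conn3 g) (free : ¬ K24-minor g) where
  private
    via : ∀ {u v} → e g u v ≡ true → Tight g u v → Res {suc m} g
    via {u} {v} uv tight = Res-≃ {suc m} (relabel-to π g)
      (uncontract ih g₀ c₀ free₀ uv₀ (ih (contract g₀) (Conn3-contract g₀ c₀ tight₀) λ q → free₀ (K24-lift (contract-↠ g₀ uv₀) q)))
      where
      u≢v = edge≢ g uv
      π = pairFirst u v u≢v
      g₀ = relabel π g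
      c₀ : Conn3 g₀
      c₀ = Conn3-≃ (relabel-to π g) c
      free₀ : ¬ K24-minor g₀
      free₀ q = free (K24-lift (≃⇒↠ (relabel-to π g)) q)
      uv₀ : e g₀ zero 1F ≡ true
      uv₀ = trans (cong (e g u) (pairFirst-1 u v u≢v)) uv
      tight₀ : Tight g₀ zero 1F
      tight₀ = subst₂ (Tight g₀) (swap-side π {zero} refl) (swap-side π (pairFirst-1 u v u≢v)) (Tight-≃ (relabel-to π g) {u} {v} tight)

  inductive-step : Res {suc m} g
  inductive-step = let (x , y , xy) = some-edge g c ; (u , v , uv , tight) = contractible-edge {g = g} c x y xy in via uv tight

classification : ∀ m → Hypothesis m
classification zero = four-vertices
classification (suc m) = inductive-step (classification m)

-- Return to the graphs of the statement

≅⇒≃ : {G H : Graph} → G ≅ H → gr G ≃ gr H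
≅⇒≃ (f , q) = iso f q

≃⇒≅ : {G H : Graph} → gr G ≃ gr H → G ≅ H
≃⇒≅ (iso f q) = f , q

size-deg : (S : Subset n) → ∣ S ∣ ≡ deg (lookup S)
size-deg [] = refl
size-deg (true ∷ S) = cong suc (size-deg S)
size-deg (false ∷ S) = size-deg S

-- Membership in `InCalG~` asks for 3-connectivity of the representative in terms of walks, while
-- `conn3` leads only from walks to colourings. The property is therefore carried over from `G`
-- itself.
ThreeConnected-≅ : {G H : Graph} → G ≅ H → ThreeConnected G → ThreeConnected H
ThreeConnected-≅ {G} {H} (π , q) (large , conn) = subst (3 <_) (Perm.↔⇒≡ π) large , walk
  where
  module _ (S : Subset (size H)) (small : ∣ S ∣ < 3) where
    S' : Subset (size G)
    S' = tabulate (λ x → lookup S (π ⟨$⟩ʳ x))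
    small' : ∣ S' ∣ < 3
    small' = subst (_< 3) (trans (size-deg S) (sym (trans (size-deg S') (trans (deg-cong {f = lookup S'} {λ i → lookup S (π ⟨$⟩ʳ i)} (Vec.lookup∘tabulate _)) (deg-perm π (lookup S)))))) small
    to : ∀ {x} → x ∈ˢ S' → (π ⟨$⟩ʳ x) ∈ˢ S
    to {x} p = Vec.lookup⇒[]= (π ⟨$⟩ʳ x) S (trans (sym (Vec.lookup∘tabulate _ x)) (Vec.[]=⇒lookup p))
    from : ∀ {x} → (π ⟨$⟩ʳ x) ∈ˢ S → x ∈ˢ S'
    from {x} p = Vec.lookup⇒[]= x S' (trans (Vec.lookup∘tabulate _ x) (Vec.[]=⇒lookup p))
    walk : ∀ u v → u ∉ˢ S → v ∉ˢ S → Walk H (λ x → x ∉ˢ S) u v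
    walk u v u∉ v∉ = subst₂ (Walk H (λ x → x ∉ˢ S)) (inverseʳ π) (inverseʳ π)
      (push-walk {g = gr G} {gr H} {π ⟨$⟩ʳ_} (λ a b p → inj₂ (trans (sym (q a b)) p)) (λ x x∉ → x∉ ∘ from)
        (conn S' small' (π ⟨$⟩ˡ u) (π ⟨$⟩ˡ v) (back u∉) (back v∉)))
      where
      back : ∀ {w} → w ∉ˢ S → (π ⟨$⟩ˡ w) ∉ˢ S'
      back w∉ p = w∉ (subst (_∈ˢ S) (inverseʳ π) (to p))

K24-≅ : {G H : Graph} → G ≅ H → HasMinor G K24 → HasMinor H K24
K24-≅ i = K24-lift (≃⇒↠ (≃-sym (≅⇒≃ i)))

Classified : Gr n → Set
Classified g = (∃ λ N → ∃ λ r → ∃ λ s → ∃ λ plus → 3 ≤ N × r ≤ N ∸ 3 × s ≤ N ∸ 3 × g ≃ gr (Gnrs N r s plus)) ⊎ ∃ λ i → g ≃ gr (excG i)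

classified : (g : Gr n) → 3 < n → Conn3 g → ¬ K24-minor g → Classified g
classified {suc (suc (suc (suc k)))} g _ c free with classification k g c free
... | exc i j = inj₂ (i , j)
... | path p = let (r , s , plus , r≤ , s≤ , j) = path-Gnrs g p c free in
  inj₁ (4 + k , r , s , plus , s≤s (s≤s (s≤s z≤n)) , r≤ , s≤ , j)
classified {suc zero} g (s≤s ())
classified {suc (suc zero)} g (s≤s (s≤s ()))
classified {suc (suc (suc zero))} g (s≤s (s≤s (s≤s ())))

K5-free : ¬ HasMinor K5 K24
K5-free (ρ , ne , _) = let (i , j , i<j , q) = Fin.pigeonhole ℕ.≤-refl (proj₁ ∘ ne) in
  Fin.<⇒≢ i<j (Maybe.just-injective (trans (sym (proj₂ (ne i))) (trans (cong ρ q) (proj₂ (ne j)))))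

GA⁺-free : ¬ HasMinor GA⁺ K24
GA⁺-free M = noK24-sound 0 (tabled (gr GA⁺)) noK24-GA⁺ (minor-≃ (tabled-≃ (gr GA⁺)) M)

GB⁺-free : ¬ HasMinor GB⁺ K24
GB⁺-free M = noK24-sound 1 (tabled (gr GB⁺)) noK24-GB⁺ (minor-≃ (tabled-≃ (gr GB⁺)) M)

GC⁺-free : ¬ HasMinor GC⁺ K24
GC⁺-free M = noK24-sound 2 (tabled (gr GC⁺)) noK24-GC⁺ (minor-≃ (tabled-≃ (gr GC⁺)) M)

GD-free : ¬ HasMinor GD K24
GD-free M = noK24-sound 1 (tabled (gr GD)) noK24-GD (minor-≃ (tabled-≃ (gr GD)) M)

subgraph? : (g h : Gr n) → Dec (g ⊆ᵍ h)
subgraph? g h = all? λ u → all? λ v → e g u v Bool.≟ true →-dec e h u v Bool.≟ true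

exc-free : ∀ i → ¬ HasMinor (excG i) K24
exc-free zero = K5-free
exc-free 1F M = GA⁺-free (K24-lift (⊆⇒↠ (does-true (subgraph? (gr K33) (gr GA⁺)) refl)) M)
exc-free 2F M = GA⁺-free (K24-lift (⊆⇒↠ (does-true (subgraph? (gr GA) (gr GA⁺)) refl)) M)
exc-free 3F = GA⁺-free
exc-free 4F M = GB⁺-free (K24-lift (⊆⇒↠ (does-true (subgraph? (gr GB) (gr GB⁺)) refl)) M)
exc-free 5F = GB⁺-free
exc-free 6F M = GC⁺-free (K24-lift (⊆⇒↠ (does-true (subgraph? (gr GC) (gr GC⁺)) refl)) M)
exc-free 7F = GC⁺-free
exc-free 8F = GD-free

theorem2p12 : (G : Graph) → ThreeConnected G →
    ((¬ HasMinor G K24) ⇔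
    (InCalG~ G ⊎ G ≅ K5 ⊎ G ≅ K33 ⊎ G ≅ GA ⊎ G ≅ GA⁺ ⊎ G ≅ GB ⊎ G ≅ GB⁺
    ⊎ G ≅ GC ⊎ G ≅ GC⁺ ⊎ G ≅ GD))
theorem2p12 G tc = mk⇔ forward backward
  where
  Exceptional : Set
  Exceptional = G ≅ K5 ⊎ G ≅ K33 ⊎ G ≅ GA ⊎ G ≅ GA⁺ ⊎ G ≅ GB ⊎ G ≅ GB⁺ ⊎ G ≅ GC ⊎ G ≅ GC⁺ ⊎ G ≅ GD

  inject : ∀ i → G ≅ excG i → Exceptional
  inject zero j = inj₁ j
  inject 1F j = inj₂ (inj₁ j)
  inject 2F j = inj₂ (inj₂ (inj₁ j))
  inject 3F j = inj₂ (inj₂ (inj₂ (inj₁ j)))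
  inject 4F j = inj₂ (inj₂ (inj₂ (inj₂ (inj₁ j))))
  inject 5F j = inj₂ (inj₂ (inj₂ (inj₂ (inj₂ (inj₁ j)))))
  inject 6F j = inj₂ (inj₂ (inj₂ (inj₂ (inj₂ (inj₂ (inj₁ j))))))
  inject 7F j = inj₂ (inj₂ (inj₂ (inj₂ (inj₂ (inj₂ (inj₂ (inj₁ j)))))))
  inject 8F j = inj₂ (inj₂ (inj₂ (inj₂ (inj₂ (inj₂ (inj₂ (inj₂ j)))))))

  free : ∀ i → G ≅ excG i → ¬ HasMinor G K24
  free i j M = exc-free i (K24-≅ j M)

  forward : ¬ HasMinor G K24 → InCalG~ G ⊎ Exceptional
  forward nk with classified (gr G) (proj₁ tc) (conn3 G tc) nk
  ... | inj₂ (i , j) = inj₂ (inject i (≃⇒≅ j))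
  ... | inj₁ (N , r , s , plus , 3≤N , r≤ , s≤ , j) =
    inj₁ (N , r , s , plus , 3≤N , r≤ , s≤ , ThreeConnected-≅ (≃⇒≅ j) tc , (λ M → nk (K24-lift (≃⇒↠ j) M)) , ≃⇒≅ j)

  backward : InCalG~ G ⊎ Exceptional → ¬ HasMinor G K24
  backward (inj₁ (_ , _ , _ , _ , _ , _ , _ , _ , nk , j)) M = nk (K24-≅ j M)
  backward (inj₂ (inj₁ j)) = free 0F j
  backward (inj₂ (inj₂ (inj₁ j))) = free 1F j
  backward (inj₂ (inj₂ (inj₂ (inj₁ j)))) = free 2F j
  backward (inj₂ (inj₂ (inj₂ (inj₂ (inj₁ j))))) = free 3F j
  backward (inj₂ (inj₂ (inj₂ (inj₂ (inj₂ (inj₁ j)))))) = free 4F j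
  backward (inj₂ (inj₂ (inj₂ (inj₂ (inj₂ (inj₂ (inj₁ j))))))) = free 5F j
  backward (inj₂ (inj₂ (inj₂ (inj₂ (inj₂ (inj₂ (inj₂ (inj₁ j)))))))) = free 6F j
  backward (inj₂ (inj₂ (inj₂ (inj₂ (inj₂ (inj₂ (inj₂ (inj₂ (inj₁ j))))))))) = free 7F j
  backward (inj₂ (inj₂ (inj₂ (inj₂ (inj₂ (inj₂ (inj₂ (inj₂ (inj₂ j))))))))) = free 8F j
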